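{- Let $n>10^{20}$ be an integer with $\gcd(n,6)=1$, and let $G=\mathbb{Z}/n$. Let $S=(a_1)(a_2)(a_3)(a_4)$ be a minimal zero-sum sequence of length $4$ over $G$ such that $\gcd(n,a_i)=1$ for all $i=1,2,3,4$. Then $\operatorname{ind}(S)=1$.
   Context: A sequence of length $k$ over $G=\mathbb{Z}/n$ is a multiset-like list $(a_1)\cdots(a_k)$ of elements of $G$; each element is identified with an integer, here taken with $1\le a_j\le n$. It is a zero-sum sequence if $\sum_j a_j\equiv 0\pmod n$, and a minimal zero-sum sequence if it is zero-sum but no proper nontrivial subsequence is zero-sum. For an integer $x$, $(x)_n$ denotes the least non-negative integer congruent to $x$ modulo $n$. The index of $S=(a_1)\cdots(a_k)$ (with $1\le a_j\le n$) is $\operatorname{ind}(S)=\min\left\{\frac1n\sum_{j=1}^k (g a_j)_n : g\in(\mathbb{Z}/n)^*\right\}$, where $(\mathbb{Z}/n)^*$ is the group of units modulo $n$. -}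

module Defs where

open import Data.Nat using (ℕ; zero; suc; _+_; _*_; _≤_; _<_; NonZero; _⊓_)
open import Data.Nat.DivMod using (_%_)
open import Data.Nat.Divisibility using (_∣_)
open import Data.Nat.GCD using (gcd)
open import Data.Nat.Coprimality using (Coprime)
open import Data.Fin using (Fin)
open import Data.Vec using (Vec; lookup)
open import Data.Bool using (Bool; true; false; if_then_else_)
open import Data.List using (List; []; _∷_; filter; map; upTo)
open import Data.Nat.Properties using (_≟_)
open import Relation.Nullary using (¬_)
open import Data.Product using (_×_; ∃)
open import Relation.Binary.PropositionalEquality using (_≡_)

-- A sequence of length k over Z/n, elements represented by integers 1 ≤ a ≤ n.
Seq : ℕ → Set
Seq k = Vec ℕ k

selSum : {k : ℕ} → Vec Bool k → Vec ℕ k → ℕ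
selSum Data.Vec.[] Data.Vec.[] = 0
selSum (b Data.Vec.∷ bs) (a Data.Vec.∷ as) = (if b then a else 0) + selSum bs as

card : {k : ℕ} → Vec Bool k → ℕ
card Data.Vec.[] = 0
card (b Data.Vec.∷ bs) = (if b then 1 else 0) + card bs

seqSum : {k : ℕ} → Vec ℕ k → ℕ
seqSum Data.Vec.[] = 0
seqSum (a Data.Vec.∷ as) = a + seqSum as

InRange : {k : ℕ} → ℕ → Vec ℕ k → Set
InRange {k} n S = (i : Fin k) → 1 ≤ lookup S i × lookup S i ≤ n

ZeroSum : {k : ℕ} → ℕ → Vec ℕ k → Set
ZeroSum n S = n ∣ seqSum S

MinimalZeroSum : {k : ℕ} → ℕ → Vec ℕ k → Set
MinimalZeroSum {k} n S =
  ZeroSum n S ×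
  ((T : Vec Bool k) → 0 < card T → card T < k → ¬ (n ∣ selSum T S))

gSum : {k : ℕ} (n : ℕ) .{{_ : NonZero n}} → ℕ → Vec ℕ k → ℕ
gSum n g Data.Vec.[] = 0
gSum n g (a Data.Vec.∷ as) = ((g * a) % n) + gSum n g as

units : ℕ → List ℕ
units n = filter (λ g → gcd g n ≟ 1) (map suc (upTo n))

minWith : ℕ → List ℕ → ℕ
minWith d [] = d
minWith d (x ∷ []) = x
minWith d (x ∷ y ∷ ys) = x ⊓ minWith d (y ∷ ys)

-- n · ind(S) = min { Σ_j (g a_j)_n : g ∈ (Z/n)^* }
nInd : {k : ℕ} (n : ℕ) .{{_ : NonZero n}} → Vec ℕ k → ℕ
nInd n S = minWith 0 (map (λ g → gSum n g S) (units n))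

-- ind(S) = 1  ⇔  n · ind(S) = n
IndexOne : {k : ℕ} (n : ℕ) .{{_ : NonZero n}} → Vec ℕ k → Set
IndexOne n S = nInd n S ≡ n

{-# OPTIONS --safe #-}
-- If ind(S) ≠ 1 then, since g and -g give sums adding up to 4n, every unit g has
-- Σ (g a_j)_n = 2n.  Applying this to g, 2g, 3g and 6g shows that Σ_j u(g a_j) = 0 for
-- all units g, where u(x) is the odd step function of x / n with values 1, 2, 1, -1, -2, -1
-- on the successive sixths of the period.  Normalise a₁ = 1 and put
-- ρ(a) = Σ_g u(g) u(a g), summed over units g; then ρ(1) + ρ(a₂) + ρ(a₃) + ρ(a₄) = 0.
--
-- The Fourier frequencies of u are prime to 6, so when y a ≡ ± x (mod n) with x, y small
-- (Thue's lemma gives x, y ≤ √n + 1) the quotient ρ(a) / ρ(1) is, up to a small error,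
-- at most 1 / 5 in absolute value unless x = y = 1: it vanishes if x y is not prime to 6,
-- and otherwise max(x, y) ≥ 5.  Since a_j ≡ - a₁ is excluded by minimality, the sum is at
-- least about (1 - 3/5) ρ(1) > 0.  The sum over units is a Möbius sum over the primes
-- dividing n, which costs an error of order 2^ω(n) √n; this is smaller than φ(n) once
-- n > 10^20, because 64 r⁴ ≤ (r - 1)⁶ for every prime r ≥ 11.
module Submission where

open import Defs
open import Data.Nat
open import Data.Nat.Properties
open import Data.Nat.DivMod
open import Data.Nat.Divisibility
open import Data.Nat.GCD using (gcd; gcd[m,n]∣m; gcd[m,n]∣n; gcd[m,n]≢0; module Bézout)
import Data.Nat.Coprimality as Cop
open import Data.Nat.Coprimality using (Coprime)
open import Data.Nat.Primality using (Prime; prime?; prime⇒irreducible; prime⇒nonZero; ¬prime[1])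
open import Data.Nat.Primality.Factorisation using (factorise)
open import Data.Nat.ListAction using (product)
import Data.Nat.Tactic.RingSolver as ℕ-Ring
import Data.Integer as ℤ
import Data.Integer.Properties as ℤₚ
import Data.Integer.Tactic.RingSolver as ℤ-Ring
open import Data.Integer using (ℤ; +_; -[1+_]; ∣_∣)
open import Data.Fin using (Fin; zero; suc; toℕ; fromℕ<)
import Data.Fin.Properties as Finₚ
open import Data.Fin.Properties using (toℕ-fromℕ<; toℕ<n; toℕ-injective; pigeonhole)
open import Data.Fin.Permutation using (Permutation; permutation)
open import Data.Vec using (Vec; lookup; []; _∷_)
open import Data.Bool using (true; false; if_then_else_)
open import Data.List using (List; []; _∷_; filter; map; upTo; length)
open import Data.List.Properties using (filter-accept; filter-reject)
open import Data.List.Membership.Propositional using (_∈_; find; lose)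
open import Data.List.Membership.Propositional.Properties using (∈-filter⁺; ∈-filter⁻; ∈-map⁺; ∈-map⁻; ∈-upTo⁺)
open import Data.List.Relation.Unary.Any using (Any; here; there; any?)
import Data.List.Relation.Unary.All.Properties as Allₚ
open import Data.List.Relation.Unary.All as All using (All; []; _∷_)
import Data.List.Relation.Unary.AllPairs.Properties as AllPairsₚ
open import Data.List.Relation.Unary.AllPairs using (AllPairs; []; _∷_)
open import Data.List.Relation.Unary.Unique.Propositional using (Unique)
open import Data.List.Relation.Unary.Unique.Propositional.Properties using (filter⁺; upTo⁺)
open import Data.Product using (∃; _×_; _,_; proj₁; proj₂)
open import Data.Sum using (_⊎_; inj₁; inj₂)
open import Data.Empty using (⊥; ⊥-elim)
open import Function using (_∘_; case_of_)
open import Relation.Nullary using (¬_; Dec; yes; no; contradiction)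
open import Relation.Nullary.Decidable using (_×-dec_; does; from-yes)
open import Relation.Binary.PropositionalEquality hiding (J)
import Algebra.Properties.CommutativeMonoid.Sum as CMSum
import Algebra.Properties.AbelianGroup ℤₚ.+-0-abelianGroup as ℤ-Group

-- Finite sums and approximate equality

-- The function u is the sawtooth s(x) = 1/2 - {x} with all frequencies divisible by 2 or 3 removed:
-- inclusion and exclusion give u(x) = 6 s(x) - 3 s(2x) - 2 s(3x) + s(6x), whence the multipliers 1,
-- 2, 3, 6. The removal is essential. For s itself the correlation at x / y is about 1 / (x y) of
-- the diagonal one, and three terms of relative size 1/2 or 1/3 could cancel the diagonal; for u
-- the next ratio is 1/5, and 3/5 < 1. No Fourier series is used. The orthogonality of frequencies
-- is replaced by the finite relation that the sum of u((t + i) / y) over i < y is u(t) if y is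
-- prime to 6 and 0 otherwise, and integrals are replaced by sums over residues with an error
-- controlled by total variation. All quantities are integers, so estimates are multiplied through
-- by x y. The obstacle in the sieve is that x and y may share primes with n. Such primes enlarge
-- the sifted main term, but each of them divides both x and y, so their product q satisfies q ≤ x
-- and q ≤ y, which still leaves 5 q ≤ x y.

∑ : ℕ → (ℕ → ℤ) → ℤ
∑ zero    f = + 0
∑ (suc n) f = ∑ n f ℤ.+ f n

∑-cong< : ∀ n {f g : ℕ → ℤ} → (∀ i → i < n → f i ≡ g i) → ∑ n f ≡ ∑ n g
∑-cong< zero    e = refl
∑-cong< (suc n) e = cong₂ ℤ._+_ (∑-cong< n λ i i<n → e i (m<n⇒m<1+n i<n)) (e n ≤-refl)

∑-cong : ∀ n {f g : ℕ → ℤ} → (∀ i → f i ≡ g i) → ∑ n f ≡ ∑ n g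
∑-cong n e = ∑-cong< n λ i _ → e i

∑-zero : ∀ n → ∑ n (λ _ → + 0) ≡ + 0
∑-zero zero    = refl
∑-zero (suc n) = trans (ℤₚ.+-identityʳ _) (∑-zero n)

∑-add : ∀ n (f g : ℕ → ℤ) → ∑ n (λ i → f i ℤ.+ g i) ≡ ∑ n f ℤ.+ ∑ n g
∑-add zero    f g = refl
∑-add (suc n) f g rewrite ∑-add n f g = lem (∑ n f) (∑ n g) (f n) (g n)
  where
  lem : ∀ a b c d → (a ℤ.+ b) ℤ.+ (c ℤ.+ d) ≡ (a ℤ.+ c) ℤ.+ (b ℤ.+ d)
  lem = ℤ-Ring.solve-∀

∑-scale : ∀ n c (f : ℕ → ℤ) → ∑ n (λ i → c ℤ.* f i) ≡ c ℤ.* ∑ n f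
∑-scale zero    c f = sym (ℤₚ.*-zeroʳ c)
∑-scale (suc n) c f rewrite ∑-scale n c f = sym (ℤₚ.*-distribˡ-+ c _ _)

∑-const : ∀ n c → ∑ n (λ _ → c) ≡ + n ℤ.* c
∑-const zero    c = sym (ℤₚ.*-zeroˡ c)
∑-const (suc n) c rewrite ∑-const n c = lem (+ n) c
  where
  lem : ∀ a c → a ℤ.* c ℤ.+ c ≡ (+ 1 ℤ.+ a) ℤ.* c
  lem = ℤ-Ring.solve-∀

∑-split : ∀ m n (f : ℕ → ℤ) → ∑ (m + n) f ≡ ∑ m f ℤ.+ ∑ n (λ i → f (m + i))
∑-split m zero    f rewrite +-identityʳ m = sym (ℤₚ.+-identityʳ _)
∑-split m (suc n) f rewrite +-suc m n | ∑-split m n f = ℤₚ.+-assoc (∑ m f) (∑ n (λ i → f (m + i))) (f (m + n))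

∑-block : ∀ n y (f : ℕ → ℤ) → ∑ (n * y) f ≡ ∑ n (λ k → ∑ y (λ i → f (k * y + i)))
∑-block zero    y f = refl
∑-block (suc n) y f rewrite +-comm y (n * y) | ∑-split (n * y) y f | ∑-block n y f = refl

∑-swap : ∀ m n (f : ℕ → ℕ → ℤ) → ∑ m (λ i → ∑ n (f i)) ≡ ∑ n (λ j → ∑ m (λ i → f i j))
∑-swap zero    n f = sym (∑-zero n)
∑-swap (suc m) n f rewrite ∑-swap m n f = sym (∑-add n _ _)

∑-head : ∀ n (f : ℕ → ℤ) → ∑ (suc n) f ≡ f 0 ℤ.+ ∑ n (f ∘ suc)
∑-head n f = trans (∑-split 1 n f) (cong (ℤ._+ ∑ n (f ∘ suc)) (ℤₚ.+-identityˡ (f 0)))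

-- A record instead of a bare inequality, so that `a`, `b` and `e` can be recovered by unification.
record Near (a b : ℤ) (e : ℕ) : Set where
  constructor near
  field bound : ∣ a ℤ.- b ∣ ≤ e

open Near

near-≡ : ∀ {a b} → a ≡ b → Near a b 0
near-≡ {a} refl = near (≤-reflexive (cong ∣_∣ (ℤₚ.+-inverseʳ a)))

near-weaken : ∀ {a b e e′} → e ≤ e′ → Near a b e → Near a b e′
near-weaken h (near p) = near (≤-trans p h)

near-sym : ∀ {a b e} → Near a b e → Near b a e
near-sym {a} {b} (near p) = near (≤-trans (≤-reflexive (ℤₚ.∣i-j∣≡∣j-i∣ b a)) p)

∣i+j∣≤ : ∀ {i j e e′} → ∣ i ∣ ≤ e → ∣ j ∣ ≤ e′ → ∣ i ℤ.+ j ∣ ≤ e + e′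
∣i+j∣≤ {i} {j} p q = ≤-trans (ℤₚ.∣i+j∣≤∣i∣+∣j∣ i j) (+-mono-≤ p q)

near-+ : ∀ {a b c d e e′} → Near a b e → Near c d e′ → Near (a ℤ.+ c) (b ℤ.+ d) (e + e′)
near-+ {a} {b} {c} {d} (near p) (near q) =
  near (subst (λ z → ∣ z ∣ ≤ _) (lem a b c d) (∣i+j∣≤ {a ℤ.- b} {c ℤ.- d} p q))
  where
  lem : ∀ a b c d → (a ℤ.- b) ℤ.+ (c ℤ.- d) ≡ (a ℤ.+ c) ℤ.- (b ℤ.+ d)
  lem = ℤ-Ring.solve-∀

near-- : ∀ {a b c d e e′} → Near a b e → Near c d e′ → Near (a ℤ.- c) (b ℤ.- d) (e + e′)
near-- {a} {b} {c} {d} (near p) q =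
  near (subst (λ z → ∣ z ∣ ≤ _) (lem a b c d) (∣i+j∣≤ {a ℤ.- b} {d ℤ.- c} p (bound (near-sym q))))
  where
  lem : ∀ a b c d → (a ℤ.- b) ℤ.+ (d ℤ.- c) ≡ (a ℤ.- c) ℤ.- (b ℤ.- d)
  lem = ℤ-Ring.solve-∀

near-trans : ∀ {a b c e e′} → Near a b e → Near b c e′ → Near a c (e + e′)
near-trans {a} {b} {c} (near p) (near q) =
  near (subst (λ z → ∣ z ∣ ≤ _) (lem a b c) (∣i+j∣≤ {a ℤ.- b} {b ℤ.- c} p q))
  where
  lem : ∀ a b c → (a ℤ.- b) ℤ.+ (b ℤ.- c) ≡ a ℤ.- c
  lem = ℤ-Ring.solve-∀

∣c*a-c*b∣ : ∀ c a b → ∣ c ℤ.* a ℤ.- c ℤ.* b ∣ ≡ ∣ c ∣ * ∣ a ℤ.- b ∣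
∣c*a-c*b∣ c a b = trans (cong ∣_∣ (lem c a b)) (ℤₚ.abs-* c (a ℤ.- b))
  where
  lem : ∀ c a b → c ℤ.* a ℤ.- c ℤ.* b ≡ c ℤ.* (a ℤ.- b)
  lem = ℤ-Ring.solve-∀

near-scale : ∀ {a b e} c → Near a b e → Near (c ℤ.* a) (c ℤ.* b) (∣ c ∣ * e)
near-scale {a} {b} c (near p) = near (≤-trans (≤-reflexive (∣c*a-c*b∣ c a b)) (*-monoʳ-≤ ∣ c ∣ p))

near-cancel : ∀ {a b e} k → 0 < k → Near (+ k ℤ.* a) (+ k ℤ.* b) (k * e) → Near a b e
near-cancel {a} {b} (suc k) _ (near p) =
  near (*-cancelˡ-≤ (suc k) (≤-trans (≤-reflexive (sym (∣c*a-c*b∣ (+ suc k) a b))) p))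

near-∑ : ∀ n {f g : ℕ → ℤ} {e} → (∀ i → i < n → Near (f i) (g i) e) → Near (∑ n f) (∑ n g) (n * e)
near-∑ zero    p = near z≤n
near-∑ (suc n) {e = e} p = near-weaken (≤-reflexive (+-comm (n * e) e))
  (near-+ (near-∑ n λ i i<n → p i (m<n⇒m<1+n i<n)) (p n ≤-refl))

near-* : ∀ {a b c d e e′} k → ∣ a ∣ ≤ k → ∣ d ∣ ≤ k → Near a b e → Near c d e′ →
         Near (a ℤ.* c) (b ℤ.* d) (k * e′ + k * e)
near-* {a} {b} {c} {d} k a≤k d≤k (near p) (near q) =
  near (subst (λ z → ∣ z ∣ ≤ _) (lem a b c d) (∣i+j∣≤ {a ℤ.* (c ℤ.- d)} {d ℤ.* (a ℤ.- b)}
    (≤-trans (≤-reflexive (ℤₚ.abs-* a _)) (*-mono-≤ a≤k q))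
    (≤-trans (≤-reflexive (ℤₚ.abs-* d _)) (*-mono-≤ d≤k p))))
  where
  lem : ∀ a b c d → a ℤ.* (c ℤ.- d) ℤ.+ d ℤ.* (a ℤ.- b) ≡ a ℤ.* c ℤ.- b ℤ.* d
  lem = ℤ-Ring.solve-∀

-- M plays the role of the total variation of f on [0, g].
record Lip (f : ℕ → ℤ) (M : ℕ → ℕ) : Set where
  field
    mono : ∀ {g g′} → g ≤ g′ → M g ≤ M g′
    lip  : ∀ {g g′} → g ≤ g′ → Near (f g) (f g′) (M g′ ∸ M g)

open Lip

∸-chain : ∀ {a b c} → a ≤ b → b ≤ c → (b ∸ a) + (c ∸ b) ≡ c ∸ a
∸-chain {a} {b} {c} a≤b b≤c = begin
  (b ∸ a) + (c ∸ b)     ≡⟨ +-comm (b ∸ a) _ ⟩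
  (c ∸ b) + (b ∸ a)     ≡⟨ sym (+-∸-assoc (c ∸ b) a≤b) ⟩
  (c ∸ b) + b ∸ a       ≡⟨ cong (_∸ a) (m∸n+n≡m b≤c) ⟩
  c ∸ a                 ∎
  where open ≡-Reasoning

-- One sample may stand for its whole block, because two points of the block differ by at most the
-- variation over it.
near-block : ∀ {f M} → Lip f M → ∀ {i y} N → i < y →
  Near (+ y ℤ.* f (N + i)) (∑ y (λ j → f (N + j))) (y * (M (N + y) ∸ M N))
near-block {f} {M} L {i} {y} N i<y =
  subst (λ z → Near z (∑ y (λ j → f (N + j))) (y * (M (N + y) ∸ M N))) (∑-const y (f (N + i)))
    (near-∑ y λ j j<y → case ≤-total i j of λ
      { (inj₁ i≤j) → near-weaken
          (∸-mono (mono L (+-monoʳ-≤ N (<⇒≤ j<y))) (mono L (m≤m+n N i)))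
          (lip L (+-monoʳ-≤ N i≤j))
      ; (inj₂ j≤i) → near-sym (near-weaken
          (∸-mono (mono L (+-monoʳ-≤ N (<⇒≤ i<y))) (mono L (m≤m+n N j)))
          (lip L (+-monoʳ-≤ N j≤i))) })

-- The variations over consecutive blocks telescope, so the error is `y` times the total variation,
-- however many blocks there are.
sampling : ∀ {f M} → Lip f M → ∀ {i y} → i < y → ∀ N →
  Near (+ y ℤ.* ∑ N (λ k → f (k * y + i))) (∑ (N * y) f) (y * (M (N * y) ∸ M 0))
sampling {f} {M} L {i} {y} i<y zero = near-weaken z≤n (near-≡ (ℤₚ.*-zeroʳ (+ y)))
sampling {f} {M} L {i} {y} i<y (suc N) =
  subst₂ (λ a b → Near a b (y * (M (suc N * y) ∸ M 0)))
    (sym (ℤₚ.*-distribˡ-+ (+ y) (∑ N (λ k → f (k * y + i))) (f (N * y + i)))) (sym eq)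
    (near-weaken (≤-reflexive err)
      (near-+ (sampling L i<y N) (near-block L (N * y) i<y)))
  where
  eq : ∑ (suc N * y) f ≡ ∑ (N * y) f ℤ.+ ∑ y (λ j → f (N * y + j))
  eq rewrite +-comm y (N * y) = ∑-split (N * y) y f
  err : y * (M (N * y) ∸ M 0) + y * (M (N * y + y) ∸ M (N * y)) ≡ y * (M (suc N * y) ∸ M 0)
  err rewrite +-comm y (N * y) = trans (sym (*-distribˡ-+ y (M (N * y) ∸ M 0) (M (N * y + y) ∸ M (N * y))))
    (cong (y *_) (∸-chain (mono L z≤n) (mono L (m≤m+n (N * y) y))))

-- The step function and its distribution relation

infixl 7 _÷_

-- Division made total, so that denominators such as `m * y` need no `NonZero` instance.
_÷_ : ℕ → ℕ → ℕ
a ÷ zero  = 0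
a ÷ suc m = a / suc m

÷-mono : ∀ {a b} m → a ≤ b → a ÷ m ≤ b ÷ m
÷-mono zero    p = z≤n
÷-mono (suc m) p = /-monoˡ-≤ (suc m) p

÷-+* : ∀ a k {m} → 0 < m → (a + k * m) ÷ m ≡ k + a ÷ m
÷-+* a k {suc m} _ = begin
  (a + k * suc m) / suc m              ≡⟨ +-distrib-/-∣ʳ a (n∣m*n k) ⟩
  a / suc m + k * suc m / suc m        ≡⟨ cong (λ w → a / suc m + w) (m*n/n≡m k (suc m)) ⟩
  a / suc m + k                        ≡⟨ +-comm _ k ⟩
  k + a / suc m                        ∎
  where open ≡-Reasoning

÷-unique : ∀ c {b y} → b < y → (c * y + b) ÷ y ≡ c
÷-unique c {b} {suc y} b<y = begin
  (c * suc y + b) ÷ suc y     ≡⟨ cong (_÷ suc y) (+-comm (c * suc y) b) ⟩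
  (b + c * suc y) ÷ suc y     ≡⟨ ÷-+* b c {suc y} z<s ⟩
  c + b / suc y               ≡⟨ cong (λ w → c + w) (m<n⇒m/n≡0 b<y) ⟩
  c + 0                       ≡⟨ +-identityʳ c ⟩
  c                           ∎
  where open ≡-Reasoning

÷-cancel : ∀ r a m → 0 < r → (r * a) ÷ (r * m) ≡ a ÷ m
÷-cancel (suc r) a zero    _ rewrite *-zeroʳ r = refl
÷-cancel (suc r) a (suc m) _ = m*n/m*o≡n/o (suc r) a (suc m)

÷-÷ : ∀ a m y → a ÷ m ÷ y ≡ a ÷ (m * y)
÷-÷ a zero    zero    = refl
÷-÷ a zero    (suc y) = 0/n≡0 (suc y)
÷-÷ a (suc m) zero rewrite *-zeroʳ m = refl
÷-÷ a (suc m) (suc y) = m/n/o≡m/[n*o] a (suc m) (suc y)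

-- The argument is the floor of 6x. The recursive last clause makes one period hold by computation.
wave : ℕ → ℤ
wave 0 = + 1
wave 1 = + 2
wave 2 = + 1
wave 3 = -[1+ 0 ]
wave 4 = -[1+ 1 ]
wave 5 = -[1+ 0 ]
wave (suc (suc (suc (suc (suc (suc c)))))) = wave c

wave-period : ∀ k c → wave (k * 6 + c) ≡ wave c
wave-period zero    c = refl
wave-period (suc k) c = wave-period k c

∣wave∣≤2 : ∀ c → ∣ wave c ∣ ≤ 2
∣wave∣≤2 0 = s≤s z≤n
∣wave∣≤2 1 = ≤-refl
∣wave∣≤2 2 = s≤s z≤n
∣wave∣≤2 3 = s≤s z≤n
∣wave∣≤2 4 = ≤-refl
∣wave∣≤2 5 = s≤s z≤n
∣wave∣≤2 (suc (suc (suc (suc (suc (suc c)))))) = ∣wave∣≤2 c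

wave-step : ∀ c → Near (wave c) (wave (suc c)) 2
wave-step 0 = near (s≤s z≤n)
wave-step 1 = near (s≤s z≤n)
wave-step 2 = near ≤-refl
wave-step 3 = near (s≤s z≤n)
wave-step 4 = near (s≤s z≤n)
wave-step 5 = near ≤-refl
wave-step (suc (suc (suc (suc (suc (suc c)))))) = wave-step c

wave-near : ∀ {c c′} → c ≤ c′ → Near (wave c) (wave c′) (2 * (c′ ∸ c))
wave-near {c} {c′} c≤c′ = subst (λ z → Near (wave c) (wave z) (2 * (c′ ∸ c))) (m+[n∸m]≡n c≤c′) (go (c′ ∸ c))
  where
  go : ∀ d → Near (wave c) (wave (c + d)) (2 * d)
  go zero    rewrite +-identityʳ c = near-≡ refl
  go (suc d) rewrite +-suc c d = near-weaken (≤-reflexive (trans (+-comm (2 * d) 2) (sym (*-suc 2 d))))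
    (near-trans (go d) (wave-step (c + d)))

-- The indicator of gcd c 6 = 1.
unit6 : ℕ → ℤ
unit6 0 = + 0
unit6 1 = + 1
unit6 2 = + 0
unit6 3 = + 0
unit6 4 = + 0
unit6 5 = + 1
unit6 (suc (suc (suc (suc (suc (suc c)))))) = unit6 c

unit6-period : ∀ k c → unit6 (k * 6 + c) ≡ unit6 c
unit6-period zero    c = refl
unit6-period (suc k) c = unit6-period k c

δ : ℕ → ℕ → ℤ
δ σ w = if w % 6 ≡ᵇ σ then + 1 else + 0

∑-pick : ∀ n {σ} → σ < n → (f : ℕ → ℤ) → ∑ n (λ j → (if j ≡ᵇ σ then + 1 else + 0) ℤ.* f j) ≡ f σ
∑-pick (suc n) {zero}  _ f = begin
  ∑ (suc n) g                       ≡⟨ ∑-head n g ⟩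
  + 1 ℤ.* f 0 ℤ.+ ∑ n (g ∘ suc)     ≡⟨ cong₂ ℤ._+_ (ℤₚ.*-identityˡ (f 0)) (trans (∑-cong n λ j → ℤₚ.*-zeroˡ (f (suc j))) (∑-zero n)) ⟩
  f 0 ℤ.+ + 0                       ≡⟨ ℤₚ.+-identityʳ (f 0) ⟩
  f 0                               ∎
  where
  open ≡-Reasoning
  g : ℕ → ℤ
  g j = (if j ≡ᵇ 0 then + 1 else + 0) ℤ.* f j
∑-pick (suc n) {suc σ} (s≤s σ<n) f = begin
  ∑ (suc n) g                       ≡⟨ ∑-head n g ⟩
  + 0 ℤ.* f 0 ℤ.+ ∑ n (g ∘ suc)     ≡⟨ cong₂ ℤ._+_ (ℤₚ.*-zeroˡ (f 0)) (∑-pick n σ<n (f ∘ suc)) ⟩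
  + 0 ℤ.+ f (suc σ)                 ≡⟨ ℤₚ.+-identityˡ (f (suc σ)) ⟩
  f (suc σ)                         ∎
  where
  open ≡-Reasoning
  g : ℕ → ℤ
  g j = (if j ≡ᵇ suc σ then + 1 else + 0) ℤ.* f j

%6-period : ∀ i j → (i * 6 + j) % 6 ≡ j % 6
%6-period zero    j = refl
%6-period (suc i) j = %6-period i j

count : ℕ → ℕ → ℕ → ℤ
count σ z n = ∑ n (λ b → δ σ (z + b))

count-period : ∀ σ k z n → count σ (k * 6 + z) n ≡ count σ z n
count-period σ k z n = ∑-cong n λ b → cong (λ w → if w ≡ᵇ σ then + 1 else + 0)
  (trans (cong (_% 6) (+-assoc (k * 6) z b)) (%6-period k (z + b)))

∑-shift : ∀ n (f : ℕ → ℤ) → f n ≡ f 0 → ∑ n (f ∘ suc) ≡ ∑ n f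
∑-shift n f e = ℤ-Group.∙-cancelˡ (f 0) (∑ n (f ∘ suc)) (∑ n f) (begin
  f 0 ℤ.+ ∑ n (f ∘ suc)     ≡⟨ sym (∑-head n f) ⟩
  ∑ n f ℤ.+ f n             ≡⟨ cong (λ w → ∑ n f ℤ.+ w) e ⟩
  ∑ n f ℤ.+ f 0             ≡⟨ ℤₚ.+-comm (∑ n f) (f 0) ⟩
  f 0 ℤ.+ ∑ n f             ∎)
  where open ≡-Reasoning

count-6 : ∀ {σ} → σ < 6 → ∀ z → count σ z 6 ≡ + 1
count-6 {σ} σ<6 zero = trans (sym (trans (∑-cong< 6 eq) refl)) (∑-pick 6 σ<6 (λ _ → + 1))
  where
  eq : ∀ j → j < 6 → (if j ≡ᵇ σ then + 1 else + 0) ℤ.* + 1 ≡ δ σ j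
  eq j j<6 = trans (ℤₚ.*-identityʳ (if j ≡ᵇ σ then + 1 else + 0))
    (cong (λ w → if w ≡ᵇ σ then + 1 else + 0) (sym (m<n⇒m%n≡m j<6)))
count-6 {σ} σ<6 (suc z) = trans (∑-cong 6 λ b → cong (δ σ) (sym (+-suc z b)))
  (trans (∑-shift 6 (λ b → δ σ (z + b)) eq) (count-6 σ<6 z))
  where
  eq : δ σ (z + 6) ≡ δ σ (z + 0)
  eq rewrite +-comm z 6 | +-identityʳ z = refl

count-+ : ∀ {σ} → σ < 6 → ∀ k z ρ → count σ z (k * 6 + ρ) ≡ + k ℤ.+ count σ z ρ
count-+ σ<6 zero    z ρ = sym (ℤₚ.+-identityˡ _)
count-+ {σ} σ<6 (suc k) z ρ = begin
  count σ z (6 + (k * 6 + ρ))                                       ≡⟨ ∑-split 6 (k * 6 + ρ) (λ b → δ σ (z + b)) ⟩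
  count σ z 6 ℤ.+ ∑ (k * 6 + ρ) (λ b → δ σ (z + (6 + b)))           ≡⟨ cong₂ ℤ._+_ (count-6 σ<6 z) (∑-cong (k * 6 + ρ) eq) ⟩
  + 1 ℤ.+ count σ z (k * 6 + ρ)                                     ≡⟨ cong (λ w → + 1 ℤ.+ w) (count-+ σ<6 k z ρ) ⟩
  + 1 ℤ.+ (+ k ℤ.+ count σ z ρ)                                     ≡⟨ sym (ℤₚ.+-assoc (+ 1) (+ k) (count σ z ρ)) ⟩
  + suc k ℤ.+ count σ z ρ                                           ∎
  where
  open ≡-Reasoning
  eq : ∀ b → δ σ (z + (6 + b)) ≡ δ σ (z + b)
  eq b = cong (δ σ) (trans (sym (+-assoc z 6 b)) (cong (_+ b) (+-comm z 6)))

-- Once `y` is reduced modulo 6 only 36 cases of the distribution relation remain, and evaluation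
-- decides them.
distribution-table : ∀ (σ ρ : Fin 6) →
  ∑ 6 (λ c → wave c ℤ.* count (toℕ σ) (c * toℕ ρ) (toℕ ρ)) ≡ unit6 (toℕ ρ) ℤ.* wave (toℕ σ)
distribution-table = from-yes (Finₚ.all? {n = 6} λ σ → Finₚ.all? {n = 6} λ ρ →
  ∑ 6 (λ c → wave c ℤ.* count (toℕ σ) (c * toℕ ρ) (toℕ ρ)) ℤ.≟ unit6 (toℕ ρ) ℤ.* wave (toℕ σ))

-- Sum `wave (w ÷ y)` over all w < 6 y in the class σ modulo 6. Cutting the range into blocks of
-- length 6 gives the left side. Cutting it into blocks of length y, on which `w ÷ y` is constant,
-- gives the values of `wave` weighted by the size of the class in each block. These sizes depend
-- only on y modulo 6, up to the common summand y / 6, which drops out because the six values of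
-- `wave` add up to 0.
distribution<6 : ∀ {y σ} → σ < 6 → 0 < y → ∑ y (λ i → wave ((σ + 6 * i) ÷ y)) ≡ unit6 y ℤ.* wave σ
distribution<6 {y} {σ} σ<6 y>0 = begin
  ∑ y (λ i → wave ((σ + 6 * i) ÷ y))                                        ≡⟨ ∑-cong y (λ i → sym (by-residue i)) ⟩
  ∑ y (λ i → ∑ 6 (λ j → δ σ (i * 6 + j) ℤ.* wave ((i * 6 + j) ÷ y)))        ≡⟨ sym (∑-block y 6 F) ⟩
  ∑ (y * 6) F                                                               ≡⟨ cong (λ N → ∑ N F) (*-comm y 6) ⟩
  ∑ (6 * y) F                                                               ≡⟨ ∑-block 6 y F ⟩
  ∑ 6 (λ c → ∑ y (λ b → F (c * y + b)))                                     ≡⟨ ∑-cong 6 by-quotient ⟩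
  ∑ 6 (λ c → wave c ℤ.* count σ (c * y) y)                                  ≡⟨ ∑-cong 6 (λ c → cong (wave c ℤ.*_) (reduce c)) ⟩
  ∑ 6 (λ c → wave c ℤ.* (+ k ℤ.+ count σ (c * ρ) ρ))                        ≡⟨ lem (+ k) (T 0) (T 1) (T 2) (T 3) (T 4) (T 5) ⟩
  ∑ 6 (λ c → wave c ℤ.* count σ (c * ρ) ρ)                                  ≡⟨ table ⟩
  unit6 ρ ℤ.* wave σ                                                        ≡⟨ cong (ℤ._* wave σ) (trans (sym (unit6-period k ρ)) (cong unit6 (sym y≡))) ⟩
  unit6 y ℤ.* wave σ                                                        ∎
  where
  open ≡-Reasoning
  k ρ : ℕ
  k = y / 6
  ρ = y % 6
  F : ℕ → ℤ
  F w = δ σ w ℤ.* wave (w ÷ y)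
  T : ℕ → ℤ
  T c = count σ (c * ρ) ρ
  y≡ : y ≡ k * 6 + ρ
  y≡ = trans (m≡m%n+[m/n]*n y 6) (+-comm ρ (k * 6))
  by-residue : ∀ i → ∑ 6 (λ j → F (i * 6 + j)) ≡ wave ((σ + 6 * i) ÷ y)
  by-residue i = trans (∑-cong< 6 λ j j<6 → cong (λ w → (if w ≡ᵇ σ then + 1 else + 0) ℤ.* wave ((i * 6 + j) ÷ y))
      (trans (%6-period i j) (m<n⇒m%n≡m j<6)))
    (trans (∑-pick 6 σ<6 (λ j → wave ((i * 6 + j) ÷ y)))
      (cong (λ w → wave (w ÷ y)) (trans (+-comm (i * 6) σ) (cong (λ w → σ + w) (*-comm i 6)))))
  by-quotient : ∀ c → ∑ y (λ b → F (c * y + b)) ≡ wave c ℤ.* count σ (c * y) y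
  by-quotient c = trans (∑-cong< y λ b b<y → trans (cong (λ w → δ σ (c * y + b) ℤ.* wave w) (÷-unique c b<y)) (ℤₚ.*-comm (δ σ (c * y + b)) (wave c)))
    (∑-scale y (wave c) (λ b → δ σ (c * y + b)))
  reduce : ∀ c → count σ (c * y) y ≡ + k ℤ.+ count σ (c * ρ) ρ
  reduce c = begin
    count σ (c * y) y                        ≡⟨ cong₂ (count σ) (trans (cong (c *_) y≡) (eq c k ρ)) y≡ ⟩
    count σ (c * k * 6 + c * ρ) (k * 6 + ρ)  ≡⟨ count-period σ (c * k) (c * ρ) (k * 6 + ρ) ⟩
    count σ (c * ρ) (k * 6 + ρ)              ≡⟨ count-+ σ<6 k (c * ρ) ρ ⟩
    + k ℤ.+ count σ (c * ρ) ρ                ∎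
    where
    eq : ∀ c k ρ → c * (k * 6 + ρ) ≡ c * k * 6 + c * ρ
    eq = ℕ-Ring.solve-∀
  lem : ∀ k a b c d e f →
    + 0 ℤ.+ + 1 ℤ.* (k ℤ.+ a) ℤ.+ + 2 ℤ.* (k ℤ.+ b) ℤ.+ + 1 ℤ.* (k ℤ.+ c) ℤ.+ -[1+ 0 ] ℤ.* (k ℤ.+ d) ℤ.+ -[1+ 1 ] ℤ.* (k ℤ.+ e) ℤ.+ -[1+ 0 ] ℤ.* (k ℤ.+ f)
    ≡ + 0 ℤ.+ + 1 ℤ.* a ℤ.+ + 2 ℤ.* b ℤ.+ + 1 ℤ.* c ℤ.+ -[1+ 0 ] ℤ.* d ℤ.+ -[1+ 1 ] ℤ.* e ℤ.+ -[1+ 0 ] ℤ.* f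
  lem = ℤ-Ring.solve-∀
  table : ∑ 6 (λ c → wave c ℤ.* count σ (c * ρ) ρ) ≡ unit6 ρ ℤ.* wave σ
  table = subst₂ (λ s r → ∑ 6 (λ c → wave c ℤ.* count s (c * r) r) ≡ unit6 r ℤ.* wave s)
    (toℕ-fromℕ< σ<6) (toℕ-fromℕ< (m%n<n y 6)) (distribution-table (fromℕ< σ<6) (fromℕ< (m%n<n y 6)))

wave-÷-period : ∀ s {y} → 0 < y → ∀ i k → wave ((s + 6 * (i + k * y)) ÷ y) ≡ wave ((s + 6 * i) ÷ y)
wave-÷-period s {y} y>0 i k = begin
  wave ((s + 6 * (i + k * y)) ÷ y)      ≡⟨ cong (λ w → wave (w ÷ y)) (eq s i k y) ⟩
  wave ((s + 6 * i + k * 6 * y) ÷ y)    ≡⟨ cong wave (÷-+* (s + 6 * i) (k * 6) y>0) ⟩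
  wave (k * 6 + (s + 6 * i) ÷ y)        ≡⟨ wave-period k _ ⟩
  wave ((s + 6 * i) ÷ y)                ∎
  where
  open ≡-Reasoning
  eq : ∀ s i k y → s + 6 * (i + k * y) ≡ s + 6 * i + k * 6 * y
  eq = ℕ-Ring.solve-∀

-- Averaging over the translates by 1 / y keeps only the frequencies divisible by y, and u has none
-- of these unless y is prime to 6. To reach every `s`, note that adding 6 to `s` shifts `i` by one
-- around its period.
distribution : ∀ {y} s → 0 < y → ∑ y (λ i → wave ((s + 6 * i) ÷ y)) ≡ unit6 y ℤ.* wave s
distribution {y} s y>0 = subst (λ s → ∑ y (λ i → wave ((s + 6 * i) ÷ y)) ≡ unit6 y ℤ.* wave s)
  (sym (trans (m≡m%n+[m/n]*n s 6) (+-comm (s % 6) _))) (go (s / 6))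
  where
  σ = s % 6
  go : ∀ k → ∑ y (λ i → wave ((k * 6 + σ + 6 * i) ÷ y)) ≡ unit6 y ℤ.* wave (k * 6 + σ)
  go zero    = distribution<6 (m%n<n s 6) y>0
  go (suc k) = trans (∑-cong y λ i → cong (λ w → wave (w ÷ y)) (eq (k * 6 + σ) i))
    (trans (∑-shift y (λ i → wave ((k * 6 + σ + 6 * i) ÷ y))
      (trans (cong (λ w → wave ((k * 6 + σ + 6 * w) ÷ y)) (sym (*-identityˡ y))) (wave-÷-period (k * 6 + σ) y>0 0 1)))
      (go k))
    where
    eq : ∀ t i → 6 + t + 6 * i ≡ t + 6 * suc i
    eq = ℕ-Ring.solve-∀

-- Dilation of periodic sums by a unit

coprime-inverse : ∀ {l y} .{{_ : NonZero y}} → Coprime l y → ∃ λ l′ → (l * l′) % y ≡ 1 % y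
coprime-inverse {l} {y} c with Cop.coprime-Bézout c
... | Bézout.+- a b eq = a , (begin
  (l * a) % y        ≡⟨ cong (_% y) (trans (*-comm l a) (sym eq)) ⟩
  (1 + b * y) % y    ≡⟨ [m+kn]%n≡m%n 1 b y ⟩
  1 % y              ∎)
  where open ≡-Reasoning
-- Here a l ≡ -1, so the inverse -a is written `a * l * a`, which avoids subtraction.
... | Bézout.-+ a b eq = a * l * a , (begin
  (l * (a * l * a)) % y                          ≡⟨ sym ([m+kn]%n≡m%n (l * (a * l * a)) b y) ⟩
  (l * (a * l * a) + b * y) % y                  ≡⟨ cong (_% y) (begin
     l * (a * l * a) + b * y         ≡⟨ cong (λ w → l * (a * l * a) + w) (sym eq) ⟩
     l * (a * l * a) + (1 + a * l)   ≡⟨ lem l a ⟩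
     1 + a * l * (1 + a * l)         ≡⟨ cong (λ w → 1 + a * l * w) eq ⟩
     1 + a * l * (b * y)             ≡⟨ cong (λ w → 1 + w) (sym (*-assoc (a * l) b y)) ⟩
     1 + a * l * b * y               ∎) ⟩
  (1 + a * l * b * y) % y                        ≡⟨ [m+kn]%n≡m%n 1 (a * l * b) y ⟩
  1 % y                                          ∎)
  where
  open ≡-Reasoning
  lem : ∀ l a → l * (a * l * a) + (1 + a * l) ≡ 1 + a * l * (1 + a * l)
  lem = ℕ-Ring.solve-∀

∑≡sum : ∀ n (f : ℕ → ℤ) → ∑ n f ≡ CMSum.sum ℤₚ.+-0-commutativeMonoid {n} (f ∘ toℕ)
∑≡sum zero    f = refl
∑≡sum (suc n) f = trans (∑-head n f) (cong (λ w → f 0 ℤ.+ w) (∑≡sum n (f ∘ suc)))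

Periodic : ℕ → (ℕ → ℤ) → Set
Periodic y f = ∀ i k → f (i + k * y) ≡ f i

periodic-% : ∀ {y f} .{{_ : NonZero y}} → Periodic y f → ∀ i → f (i % y) ≡ f i
periodic-% {y} {f} p i = trans (sym (p (i % y) (i / y))) (cong f (sym (m≡m%n+[m/n]*n i y)))

-- Multiplication by `l` permutes the residues modulo `y`; the sum passes through `Fin y` to use
-- invariance under permutations.
∑-dilate : ∀ {l y f} → 0 < y → Coprime l y → Periodic y f → ∑ y (λ i → f (l * i)) ≡ ∑ y f
∑-dilate {l} {y@(suc _)} {f} _ c p = begin
  ∑ y (λ i → f (l * i))                  ≡⟨ ∑-cong y (λ i → sym (periodic-% p (l * i))) ⟩
  ∑ y (λ i → f ((l * i) % y))            ≡⟨ ∑≡sum y (λ i → f ((l * i) % y)) ⟩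
  sum {y} (λ i → f ((l * toℕ i) % y))        ≡⟨ sum-cong-≗ {y} (λ i → cong f (sym (toℕ-mul l i))) ⟩
  sum {y} (λ i → f (toℕ (mul l i)))          ≡⟨ sym (sum-permute (f ∘ toℕ) π) ⟩
  sum {y} (f ∘ toℕ)                      ≡⟨ sym (∑≡sum y f) ⟩
  ∑ y f                                  ∎
  where
  open ≡-Reasoning
  open CMSum ℤₚ.+-0-commutativeMonoid
  mul : ℕ → Fin y → Fin y
  mul k i = fromℕ< (m%n<n (k * toℕ i) y)
  toℕ-mul : ∀ k i → toℕ (mul k i) ≡ (k * toℕ i) % y
  toℕ-mul k i = toℕ-fromℕ< (m%n<n (k * toℕ i) y)
  l′ : ℕ
  l′ = proj₁ (coprime-inverse c)
  cancel : ∀ a b → (a * b) % y ≡ 1 % y → ∀ i → mul a (mul b i) ≡ i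
  cancel a b ab i = toℕ-injective (begin
    toℕ (mul a (mul b i))                    ≡⟨ toℕ-mul a (mul b i) ⟩
    (a * toℕ (mul b i)) % y                  ≡⟨ cong (λ w → (a * w) % y) (toℕ-mul b i) ⟩
    (a * ((b * toℕ i) % y)) % y              ≡⟨ %-distribˡ-* a _ y ⟩
    (a % y * ((b * toℕ i) % y % y)) % y      ≡⟨ cong (λ w → (a % y * w) % y) (m%n%n≡m%n (b * toℕ i) y) ⟩
    (a % y * ((b * toℕ i) % y)) % y          ≡⟨ sym (%-distribˡ-* a (b * toℕ i) y) ⟩
    (a * (b * toℕ i)) % y                    ≡⟨ cong (_% y) (sym (*-assoc a b (toℕ i))) ⟩
    (a * b * toℕ i) % y                      ≡⟨ %-distribˡ-* (a * b) (toℕ i) y ⟩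
    ((a * b) % y * (toℕ i % y)) % y          ≡⟨ cong (λ w → (w * (toℕ i % y)) % y) ab ⟩
    (1 % y * (toℕ i % y)) % y                ≡⟨ sym (%-distribˡ-* 1 (toℕ i) y) ⟩
    (1 * toℕ i) % y                          ≡⟨ cong (_% y) (*-identityˡ (toℕ i)) ⟩
    toℕ i % y                                ≡⟨ m<n⇒m%n≡m (toℕ<n i) ⟩
    toℕ i                                    ∎)
  π : Permutation y y
  π = permutation (mul l) (mul l′)
    (cancel l l′ (proj₂ (coprime-inverse c)))
    (cancel l′ l (trans (cong (_% y) (*-comm l′ l)) (proj₂ (coprime-inverse c))))

-- Correlations over all residues

-- Each factor is at most 2 in absolute value and changes by at most 2 when its index grows by one,
-- so the product changes by at most 2 · 2 = 4 per unit of either index.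
lip-wave-product : ∀ (A B : ℕ → ℕ) → (∀ {g g′} → g ≤ g′ → A g ≤ A g′) → (∀ {g g′} → g ≤ g′ → B g ≤ B g′) →
  Lip (λ g → wave (A g) ℤ.* wave (B g)) (λ g → 4 * A g + 4 * B g)
lip-wave-product A B A-mono B-mono = record
  { mono = λ p → +-mono-≤ (*-monoʳ-≤ 4 (A-mono p)) (*-monoʳ-≤ 4 (B-mono p))
  ; lip  = λ {g} {g′} p → near-weaken
      (≤-reflexive (increment (A-mono p) (B-mono p)))
      (near-* 2 (∣wave∣≤2 (A g)) (∣wave∣≤2 (B g′)) (wave-near (A-mono p)) (wave-near (B-mono p)))
  }
  where
  lem : ∀ a p b q → 4 * (a + p) + 4 * (b + q) ≡ 2 * (2 * q) + 2 * (2 * p) + (4 * a + 4 * b)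
  lem = ℕ-Ring.solve-∀
  shifted : ∀ a p b q → 2 * (2 * (b + q ∸ b)) + 2 * (2 * (a + p ∸ a)) ≡ 4 * (a + p) + 4 * (b + q) ∸ (4 * a + 4 * b)
  shifted a p b q rewrite m+n∸m≡n b q | m+n∸m≡n a p | lem a p b q = sym (m+n∸n≡m _ (4 * a + 4 * b))
  increment : ∀ {a a′ b b′} → a ≤ a′ → b ≤ b′ →
    2 * (2 * (b′ ∸ b)) + 2 * (2 * (a′ ∸ a)) ≡ 4 * a′ + 4 * b′ ∸ (4 * a + 4 * b)
  increment {a} {a′} {b} {b′} p q = subst₂
    (λ v w → 2 * (2 * (w ∸ b)) + 2 * (2 * (v ∸ a)) ≡ 4 * v + 4 * w ∸ (4 * a + 4 * b))
    (m+[n∸m]≡n p) (m+[n∸m]≡n q) (shifted a (a′ ∸ a) b (b′ ∸ b))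

-- u m g is the value at g / m of the odd step function of period 1 whose Fourier
-- series only has frequencies prime to 6.
u : ℕ → ℕ → ℤ
u m g = wave ((6 * g) ÷ m)

u-period : ∀ {m} → 0 < m → Periodic m (u m)
u-period {m} m>0 g k = begin
  wave ((6 * (g + k * m)) ÷ m)        ≡⟨ cong (λ w → wave (w ÷ m)) (eq g k m) ⟩
  wave ((6 * g + k * 6 * m) ÷ m)      ≡⟨ cong wave (÷-+* (6 * g) (k * 6) m>0) ⟩
  wave (k * 6 + (6 * g) ÷ m)          ≡⟨ wave-period k _ ⟩
  u m g                               ∎
  where
  open ≡-Reasoning
  eq : ∀ g k m → 6 * (g + k * m) ≡ 6 * g + k * 6 * m
  eq = ℕ-Ring.solve-∀

u-dilate : ∀ {r} → 0 < r → ∀ m g → u (r * m) (r * g) ≡ u m g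
u-dilate {r} r>0 m g = cong wave (trans (cong (_÷ (r * m)) (eq r g)) (÷-cancel r (6 * g) m r>0))
  where
  eq : ∀ r g → 6 * (r * g) ≡ r * (6 * g)
  eq = ℕ-Ring.solve-∀

-- If y a = x + l m with l prime to y, this is about 2 m unit6(x) unit6(y) / (x y). The next three
-- estimates produce the factors unit6(y) / y, unit6(x) / x and 2 m in turn.
full : ℕ → ℕ → ℤ
full m a = ∑ m (λ g → u m g ℤ.* u m (a * g))

∑-periods : ∀ {m f} → Periodic m f → ∀ y → ∑ (y * m) f ≡ + y ℤ.* ∑ m f
∑-periods {m} {f} p y = begin
  ∑ (y * m) f                              ≡⟨ ∑-block y m f ⟩
  ∑ y (λ k → ∑ m (λ j → f (k * m + j)))    ≡⟨ ∑-cong y (λ k → ∑-cong m λ j → trans (cong f (+-comm (k * m) j)) (p j k)) ⟩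
  ∑ y (λ _ → ∑ m f)                        ≡⟨ ∑-const y (∑ m f) ⟩
  + y ℤ.* ∑ m f                            ∎
  where open ≡-Reasoning

uu-period : ∀ {m} → 0 < m → ∀ a → Periodic m (λ g → u m g ℤ.* u m (a * g))
uu-period {m} m>0 a g k = cong₂ ℤ._*_ (u-period m>0 g k)
  (trans (cong (u m) (eq a g k m)) (u-period m>0 (a * g) (a * k)))
  where
  eq : ∀ a g k m → a * (g + k * m) ≡ a * g + a * k * m
  eq = ℕ-Ring.solve-∀

-- Along g ≡ i (mod y) the pair (g, a g) / m moves on a segment of slope x / y;
-- sampling replaces the points of this class by all g, and averaging over i
-- replaces the second factor by u m (x g) up to the factor unit6 y.
full-reduce-y : ∀ {m a x y l} → 0 < m → 0 < y → y * a ≡ x + l * m → Coprime l y →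
  Near (+ y ℤ.* full m a) (unit6 y ℤ.* full m x) (24 * y * (x + y))
full-reduce-y {m} {a} {x} {y} {l} m>0 y>0 rel cop = near-cancel y y>0
  (subst₂ (λ p q → Near p q (y * (24 * y * (x + y)))) lhs rhs
    (near-∑ y λ i i<y → near-weaken (≤-reflexive (err i)) (sampling (L i) i<y m)))
  where
  open ≡-Reasoning
  A : ℕ → ℕ
  A g = (6 * g) ÷ m
  -- For g ≡ i modulo y, l g / y and l i / y differ by an integer, so a g / m ≡ (x g / m + l i) / y
  -- modulo 1. `B i` is the floor of six times the right side, and it makes sense for every g.
  B : ℕ → ℕ → ℕ
  B i g = ((6 * (x * g)) ÷ m + 6 * (l * i)) ÷ y
  H : ℕ → ℕ → ℤ
  H i g = wave (A g) ℤ.* wave (B i g)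
  L : ∀ i → Lip (H i) (λ g → 4 * A g + 4 * B i g)
  L i = lip-wave-product A (B i) (λ p → ÷-mono m (*-monoʳ-≤ 6 p))
    (λ p → ÷-mono y (+-monoˡ-≤ (6 * (l * i)) (÷-mono m (*-monoʳ-≤ 6 (*-monoʳ-≤ x p)))))
  A-end : A (m * y) ≡ y * 6 + A 0
  A-end = trans (cong (_÷ m) (eq m y)) (÷-+* (6 * 0) (y * 6) m>0)
    where
    eq : ∀ m y → 6 * (m * y) ≡ 6 * 0 + y * 6 * m
    eq = ℕ-Ring.solve-∀
  B-end : ∀ i → B i (m * y) ≡ x * 6 + B i 0
  B-end i = trans (cong (_÷ y) (begin
      (6 * (x * (m * y))) ÷ m + 6 * (l * i)                ≡⟨ cong (λ w → w ÷ m + 6 * (l * i)) (eq x m y) ⟩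
      (6 * (x * 0) + x * 6 * y * m) ÷ m + 6 * (l * i)      ≡⟨ cong (λ w → w + 6 * (l * i)) (÷-+* (6 * (x * 0)) (x * 6 * y) m>0) ⟩
      x * 6 * y + (6 * (x * 0)) ÷ m + 6 * (l * i)          ≡⟨ eq₂ (x * 6 * y) _ (6 * (l * i)) ⟩
      (6 * (x * 0)) ÷ m + 6 * (l * i) + x * 6 * y          ∎))
    (÷-+* _ (x * 6) y>0)
    where
    eq : ∀ x m y → 6 * (x * (m * y)) ≡ 6 * (x * 0) + x * 6 * y * m
    eq = ℕ-Ring.solve-∀
    eq₂ : ∀ a b c → a + b + c ≡ b + c + a
    eq₂ = ℕ-Ring.solve-∀
  err : ∀ i → y * (4 * A (m * y) + 4 * B i (m * y) ∸ (4 * A 0 + 4 * B i 0)) ≡ 24 * y * (x + y)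
  err i rewrite A-end | B-end i = begin
    y * (4 * (y * 6 + A 0) + 4 * (x * 6 + B i 0) ∸ (4 * A 0 + 4 * B i 0))   ≡⟨ cong (λ w → y * (w ∸ (4 * A 0 + 4 * B i 0))) (eq x y (A 0) (B i 0)) ⟩
    y * (24 * (x + y) + (4 * A 0 + 4 * B i 0) ∸ (4 * A 0 + 4 * B i 0))      ≡⟨ cong (y *_) (m+n∸n≡m (24 * (x + y)) (4 * A 0 + 4 * B i 0)) ⟩
    y * (24 * (x + y))                                                      ≡⟨ eq₂ y (x + y) ⟩
    24 * y * (x + y)                                                        ∎
    where
    eq : ∀ x y a b → 4 * (y * 6 + a) + 4 * (x * 6 + b) ≡ 24 * (x + y) + (4 * a + 4 * b)
    eq = ℕ-Ring.solve-∀
    eq₂ : ∀ y z → y * (24 * z) ≡ 24 * y * z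
    eq₂ = ℕ-Ring.solve-∀
  H-diag : ∀ k i → H i (k * y + i) ≡ u m (k * y + i) ℤ.* u m (a * (k * y + i))
  H-diag k i = cong (wave (A g) ℤ.*_) (sym (begin
    wave ((6 * (a * g)) ÷ m)                                         ≡⟨ cong wave (sym (÷-cancel y (6 * (a * g)) m y>0)) ⟩
    wave ((y * (6 * (a * g))) ÷ (y * m))                             ≡⟨ cong₂ (λ v w → wave (v ÷ w)) num (*-comm y m) ⟩
    wave ((6 * (x * g) + 6 * (l * g) * m) ÷ (m * y))                 ≡⟨ cong wave (sym (÷-÷ _ m y)) ⟩
    wave ((6 * (x * g) + 6 * (l * g) * m) ÷ m ÷ y)                   ≡⟨ cong (λ w → wave (w ÷ y)) (÷-+* (6 * (x * g)) (6 * (l * g)) m>0) ⟩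
    wave ((6 * (l * g) + (6 * (x * g)) ÷ m) ÷ y)                     ≡⟨ cong (λ w → wave (w ÷ y)) (eq l k y i s) ⟩
    wave ((s + 6 * (l * i + l * k * y)) ÷ y)                         ≡⟨ wave-÷-period s y>0 (l * i) (l * k) ⟩
    wave ((s + 6 * (l * i)) ÷ y)                                     ∎))
    where
    g s : ℕ
    g = k * y + i
    s = (6 * (x * g)) ÷ m
    num : y * (6 * (a * g)) ≡ 6 * (x * g) + 6 * (l * g) * m
    num = begin
      y * (6 * (a * g))                   ≡⟨ e₁ y a g ⟩
      6 * (y * a * g)                     ≡⟨ cong (λ w → 6 * (w * g)) rel ⟩
      6 * ((x + l * m) * g)               ≡⟨ e₂ x l m g ⟩
      6 * (x * g) + 6 * (l * g) * m       ∎
      where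
      e₁ : ∀ y a g → y * (6 * (a * g)) ≡ 6 * (y * a * g)
      e₁ = ℕ-Ring.solve-∀
      e₂ : ∀ x l m g → 6 * ((x + l * m) * g) ≡ 6 * (x * g) + 6 * (l * g) * m
      e₂ = ℕ-Ring.solve-∀
    eq : ∀ l k y i s → 6 * (l * (k * y + i)) + s ≡ s + 6 * (l * i + l * k * y)
    eq = ℕ-Ring.solve-∀
  G : ℕ → ℤ
  G g = u m g ℤ.* u m (a * g)
  lhs : ∑ y (λ i → + y ℤ.* ∑ m (λ k → H i (k * y + i))) ≡ + y ℤ.* (+ y ℤ.* full m a)
  lhs = begin
    ∑ y (λ i → + y ℤ.* ∑ m (λ k → H i (k * y + i)))     ≡⟨ ∑-scale y (+ y) (λ i → ∑ m (λ k → H i (k * y + i))) ⟩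
    + y ℤ.* ∑ y (λ i → ∑ m (λ k → H i (k * y + i)))     ≡⟨ cong (+ y ℤ.*_) (∑-cong y λ i → ∑-cong m λ k → H-diag k i) ⟩
    + y ℤ.* ∑ y (λ i → ∑ m (λ k → G (k * y + i)))       ≡⟨ cong (+ y ℤ.*_) (∑-swap y m (λ i k → G (k * y + i))) ⟩
    + y ℤ.* ∑ m (λ k → ∑ y (λ i → G (k * y + i)))       ≡⟨ cong (+ y ℤ.*_) (sym (∑-block m y G)) ⟩
    + y ℤ.* ∑ (m * y) G                                 ≡⟨ cong (λ N → + y ℤ.* ∑ N G) (*-comm m y) ⟩
    + y ℤ.* ∑ (y * m) G                                 ≡⟨ cong (+ y ℤ.*_) (∑-periods (uu-period m>0 a) y) ⟩
    + y ℤ.* (+ y ℤ.* full m a)                          ∎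
  -- As `l` is prime to `y`, the products l i meet every residue once, and the distribution relation
  -- applies.
  average : ∀ g → ∑ y (λ i → H i g) ≡ unit6 y ℤ.* (u m g ℤ.* u m (x * g))
  average g = begin
    ∑ y (λ i → wave (A g) ℤ.* wave (B i g))             ≡⟨ ∑-scale y (wave (A g)) (λ i → wave (B i g)) ⟩
    wave (A g) ℤ.* ∑ y (λ i → wave (B i g))             ≡⟨ cong (wave (A g) ℤ.*_) (∑-dilate y>0 cop (wave-÷-period s y>0)) ⟩
    wave (A g) ℤ.* ∑ y (λ i → wave ((s + 6 * i) ÷ y))   ≡⟨ cong (wave (A g) ℤ.*_) (distribution s y>0) ⟩
    wave (A g) ℤ.* (unit6 y ℤ.* wave s)                 ≡⟨ eq (wave (A g)) (unit6 y) (wave s) ⟩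
    unit6 y ℤ.* (wave (A g) ℤ.* wave s)                 ∎
    where
    s = (6 * (x * g)) ÷ m
    eq : ∀ a b c → a ℤ.* (b ℤ.* c) ≡ b ℤ.* (a ℤ.* c)
    eq = ℤ-Ring.solve-∀
  rhs : ∑ y (λ i → ∑ (m * y) (H i)) ≡ + y ℤ.* (unit6 y ℤ.* full m x)
  rhs = begin
    ∑ y (λ i → ∑ (m * y) (H i))                                     ≡⟨ ∑-swap y (m * y) H ⟩
    ∑ (m * y) (λ g → ∑ y (λ i → H i g))                             ≡⟨ ∑-cong (m * y) average ⟩
    ∑ (m * y) (λ g → unit6 y ℤ.* (u m g ℤ.* u m (x * g)))           ≡⟨ ∑-scale (m * y) (unit6 y) (λ g → u m g ℤ.* u m (x * g)) ⟩
    unit6 y ℤ.* ∑ (m * y) (λ g → u m g ℤ.* u m (x * g))             ≡⟨ cong (λ N → unit6 y ℤ.* ∑ N (λ g → u m g ℤ.* u m (x * g))) (*-comm m y) ⟩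
    unit6 y ℤ.* ∑ (y * m) (λ g → u m g ℤ.* u m (x * g))             ≡⟨ cong (unit6 y ℤ.*_) (∑-periods (uu-period m>0 x) y) ⟩
    unit6 y ℤ.* (+ y ℤ.* full m x)                                  ≡⟨ eq (unit6 y) (+ y) (full m x) ⟩
    + y ℤ.* (unit6 y ℤ.* full m x)                                  ∎
    where
    eq : ∀ a b c → a ℤ.* (b ℤ.* c) ≡ b ℤ.* (a ℤ.* c)
    eq = ℤ-Ring.solve-∀

-- The summand is read as the value at t = k x of a function `K` on a grid x times finer, and
-- sampling replaces these points by all t < m x. Writing t = j m + τ, one factor of `K` depends on
-- τ alone, while the other is summed over j by the distribution relation.
full-reduce-x : ∀ {m x} → 0 < m → 0 < x →
  Near (+ x ℤ.* full m x) (unit6 x ℤ.* full m 1) (24 * x * (x + 1))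
full-reduce-x {m} {x} m>0 x>0 = near-weaken (≤-reflexive err)
  (subst₂ (λ p q → Near p q (x * (4 * A (m * x) + 4 * B (m * x) ∸ (4 * A 0 + 4 * B 0)))) lhs rhs (sampling L x>0 m))
  where
  open ≡-Reasoning
  A B : ℕ → ℕ
  A g = (6 * g) ÷ (m * x)
  B g = (6 * g) ÷ m
  K : ℕ → ℤ
  K g = wave (A g) ℤ.* wave (B g)
  L : Lip K (λ g → 4 * A g + 4 * B g)
  L = lip-wave-product A B (λ p → ÷-mono (m * x) (*-monoʳ-≤ 6 p)) (λ p → ÷-mono m (*-monoʳ-≤ 6 p))
  A-end : A (m * x) ≡ 6 + A 0
  A-end = ÷-+* 0 6 (*-mono-≤ m>0 x>0)
  B-end : B (m * x) ≡ x * 6 + B 0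
  B-end = trans (cong (_÷ m) (eq m x)) (÷-+* (6 * 0) (x * 6) m>0)
    where
    eq : ∀ m y → 6 * (m * y) ≡ 6 * 0 + y * 6 * m
    eq = ℕ-Ring.solve-∀
  err : x * (4 * A (m * x) + 4 * B (m * x) ∸ (4 * A 0 + 4 * B 0)) ≡ 24 * x * (x + 1)
  err rewrite A-end | B-end = begin
    x * (4 * (6 + A 0) + 4 * (x * 6 + B 0) ∸ (4 * A 0 + 4 * B 0))       ≡⟨ cong (λ w → x * (w ∸ (4 * A 0 + 4 * B 0))) (eq x (A 0) (B 0)) ⟩
    x * (24 * (x + 1) + (4 * A 0 + 4 * B 0) ∸ (4 * A 0 + 4 * B 0))      ≡⟨ cong (x *_) (m+n∸n≡m (24 * (x + 1)) (4 * A 0 + 4 * B 0)) ⟩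
    x * (24 * (x + 1))                                                  ≡⟨ eq₂ x (x + 1) ⟩
    24 * x * (x + 1)                                                    ∎
    where
    eq : ∀ x a b → 4 * (6 + a) + 4 * (x * 6 + b) ≡ 24 * (x + 1) + (4 * a + 4 * b)
    eq = ℕ-Ring.solve-∀
    eq₂ : ∀ y z → y * (24 * z) ≡ 24 * y * z
    eq₂ = ℕ-Ring.solve-∀
  lhs : + x ℤ.* ∑ m (λ k → K (k * x + 0)) ≡ + x ℤ.* full m x
  lhs = cong (+ x ℤ.*_) (∑-cong m λ k → cong₂ ℤ._*_
    (cong wave (trans (cong₂ _÷_ (eq k x) (*-comm m x)) (÷-cancel x (6 * k) m x>0)))
    (cong (u m) (trans (+-identityʳ (k * x)) (*-comm k x))))
    where
    eq : ∀ k x → 6 * (k * x + 0) ≡ x * (6 * k)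
    eq = ℕ-Ring.solve-∀
  K-class : ∀ j τ → K (j * m + τ) ≡ wave (B τ) ℤ.* wave ((B τ + 6 * j) ÷ x)
  K-class j τ = trans (ℤₚ.*-comm (wave (A (j * m + τ))) (wave (B (j * m + τ)))) (cong₂ ℤ._*_
      (trans (cong wave B-shift) (wave-period j (B τ)))
      (cong wave (trans (sym (÷-÷ _ m x)) (cong (_÷ x) (trans B-shift (eq₂ j (B τ)))))))
    where
    eq₂ : ∀ j b → j * 6 + b ≡ b + 6 * j
    eq₂ = ℕ-Ring.solve-∀
    B-shift : B (j * m + τ) ≡ j * 6 + B τ
    B-shift = trans (cong (_÷ m) (eq j m τ)) (÷-+* (6 * τ) (j * 6) m>0)
      where
      eq : ∀ j m τ → 6 * (j * m + τ) ≡ 6 * τ + j * 6 * m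
      eq = ℕ-Ring.solve-∀
  rhs : ∑ (m * x) K ≡ unit6 x ℤ.* full m 1
  rhs = begin
    ∑ (m * x) K                                                                 ≡⟨ cong (λ N → ∑ N K) (*-comm m x) ⟩
    ∑ (x * m) K                                                                 ≡⟨ ∑-block x m K ⟩
    ∑ x (λ j → ∑ m (λ τ → K (j * m + τ)))                                       ≡⟨ ∑-cong x (λ j → ∑-cong m (K-class j)) ⟩
    ∑ x (λ j → ∑ m (λ τ → wave (B τ) ℤ.* wave ((B τ + 6 * j) ÷ x)))             ≡⟨ ∑-swap x m (λ j τ → wave (B τ) ℤ.* wave ((B τ + 6 * j) ÷ x)) ⟩
    ∑ m (λ τ → ∑ x (λ j → wave (B τ) ℤ.* wave ((B τ + 6 * j) ÷ x)))             ≡⟨ ∑-cong m (λ τ → ∑-scale x (wave (B τ)) (λ j → wave ((B τ + 6 * j) ÷ x))) ⟩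
    ∑ m (λ τ → wave (B τ) ℤ.* ∑ x (λ j → wave ((B τ + 6 * j) ÷ x)))             ≡⟨ ∑-cong m (λ τ → cong (wave (B τ) ℤ.*_) (distribution (B τ) x>0)) ⟩
    ∑ m (λ τ → wave (B τ) ℤ.* (unit6 x ℤ.* wave (B τ)))                         ≡⟨ ∑-cong m (λ τ → trans (eq (wave (B τ)) (unit6 x)) (cong (λ w → unit6 x ℤ.* (u m τ ℤ.* u m w)) (sym (*-identityˡ τ)))) ⟩
    ∑ m (λ τ → unit6 x ℤ.* (u m τ ℤ.* u m (1 * τ)))                             ≡⟨ ∑-scale m (unit6 x) (λ τ → u m τ ℤ.* u m (1 * τ)) ⟩
    unit6 x ℤ.* full m 1                                                        ∎
    where
    eq : ∀ a b → a ℤ.* (b ℤ.* a) ≡ b ℤ.* (a ℤ.* a)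
    eq = ℤ-Ring.solve-∀

-- The mean square of u is (1 + 4 + 1 + 1 + 4 + 1) / 6 = 2. On a grid six times finer it is computed
-- exactly, because u is constant on blocks of length `m`.
full-one : ∀ {m} → 0 < m → Near (full m 1) (+ (2 * m)) 48
full-one {m} m>0 = near-cancel 6 z<s
  (subst₂ (λ p q → Near p q (6 * 48)) lhs rhs
    (near-weaken (≤-reflexive err) (sampling L z<s m)))
  where
  open ≡-Reasoning
  K : ℕ → ℤ
  K t = wave (t ÷ m) ℤ.* wave (t ÷ m)
  L : Lip K (λ t → 4 * (t ÷ m) + 4 * (t ÷ m))
  L = lip-wave-product (_÷ m) (_÷ m) (÷-mono m) (÷-mono m)
  end : (m * 6) ÷ m ≡ 6 + 0 ÷ m
  end = trans (cong (_÷ m) (*-comm m 6)) (÷-+* 0 6 m>0)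
  err : 6 * (4 * ((m * 6) ÷ m) + 4 * ((m * 6) ÷ m) ∸ (4 * (0 ÷ m) + 4 * (0 ÷ m))) ≡ 6 * 48
  err rewrite end = cong (6 *_) (trans (cong (_∸ (4 * (0 ÷ m) + 4 * (0 ÷ m))) (eq (0 ÷ m))) (m+n∸n≡m 48 (4 * (0 ÷ m) + 4 * (0 ÷ m))))
    where
    eq : ∀ z → 4 * (6 + z) + 4 * (6 + z) ≡ 48 + (4 * z + 4 * z)
    eq = ℕ-Ring.solve-∀
  lhs : + 6 ℤ.* ∑ m (λ k → K (k * 6 + 0)) ≡ + 6 ℤ.* full m 1
  lhs = cong (+ 6 ℤ.*_) (∑-cong m λ k → cong₂ (λ v w → wave (v ÷ m) ℤ.* wave (w ÷ m)) (eq k) (eq₂ k))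
    where
    eq : ∀ k → k * 6 + 0 ≡ 6 * k
    eq = ℕ-Ring.solve-∀
    eq₂ : ∀ k → k * 6 + 0 ≡ 6 * (1 * k)
    eq₂ = ℕ-Ring.solve-∀
  rhs : ∑ (m * 6) K ≡ + 6 ℤ.* + (2 * m)
  rhs = begin
    ∑ (m * 6) K                                        ≡⟨ cong (λ N → ∑ N K) (*-comm m 6) ⟩
    ∑ (6 * m) K                                        ≡⟨ ∑-block 6 m K ⟩
    ∑ 6 (λ c → ∑ m (λ b → K (c * m + b)))              ≡⟨ ∑-cong 6 (λ c → ∑-cong< m λ b b<m → cong (λ w → wave w ℤ.* wave w) (÷-unique c b<m)) ⟩
    ∑ 6 (λ c → ∑ m (λ _ → wave c ℤ.* wave c))          ≡⟨ ∑-cong 6 (λ c → ∑-const m (wave c ℤ.* wave c)) ⟩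
    ∑ 6 (λ c → + m ℤ.* (wave c ℤ.* wave c))            ≡⟨ ∑-scale 6 (+ m) (λ c → wave c ℤ.* wave c) ⟩
    + m ℤ.* + 12                                       ≡⟨ eq (+ m) ⟩
    + 6 ℤ.* (+ 2 ℤ.* + m)                              ≡⟨ cong (+ 6 ℤ.*_) (sym (ℤₚ.pos-* 2 m)) ⟩
    + 6 ℤ.* + (2 * m)                                  ∎
    where
    eq : ∀ z → z ℤ.* + 12 ≡ + 6 ℤ.* (+ 2 ℤ.* z)
    eq = ℤ-Ring.solve-∀

-- Sieving by the primes dividing the modulus

unit6-table : ∀ (ρ σ : Fin 6) → unit6 (toℕ ρ * toℕ σ) ≡ unit6 (toℕ ρ) ℤ.* unit6 (toℕ σ)
unit6-table = from-yes (Finₚ.all? {n = 6} λ ρ → Finₚ.all? {n = 6} λ σ →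
  unit6 (toℕ ρ * toℕ σ) ℤ.≟ unit6 (toℕ ρ) ℤ.* unit6 (toℕ σ))

unit6-% : ∀ a → unit6 a ≡ unit6 (a % 6)
unit6-% a = trans (cong unit6 (trans (m≡m%n+[m/n]*n a 6) (+-comm (a % 6) _))) (unit6-period (a / 6) (a % 6))

unit6-* : ∀ a b → unit6 (a * b) ≡ unit6 a ℤ.* unit6 b
unit6-* a b = begin
  unit6 (a * b)                      ≡⟨ unit6-% (a * b) ⟩
  unit6 ((a * b) % 6)                ≡⟨ cong unit6 (%-distribˡ-* a b 6) ⟩
  unit6 ((a % 6 * (b % 6)) % 6)      ≡⟨ sym (unit6-% (a % 6 * (b % 6))) ⟩
  unit6 (a % 6 * (b % 6))            ≡⟨ subst₂ (λ p q → unit6 (p * q) ≡ unit6 p ℤ.* unit6 q)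
                                          (toℕ-fromℕ< (m%n<n a 6)) (toℕ-fromℕ< (m%n<n b 6))
                                          (unit6-table (fromℕ< (m%n<n a 6)) (fromℕ< (m%n<n b 6))) ⟩
  unit6 (a % 6) ℤ.* unit6 (b % 6)    ≡⟨ sym (cong₂ ℤ._*_ (unit6-% a) (unit6-% b)) ⟩
  unit6 a ℤ.* unit6 b                ∎
  where open ≡-Reasoning

∣unit6∣≤1 : ∀ c → ∣ unit6 c ∣ ≤ 1
∣unit6∣≤1 0 = z≤n
∣unit6∣≤1 1 = ≤-refl
∣unit6∣≤1 2 = z≤n
∣unit6∣≤1 3 = z≤n
∣unit6∣≤1 4 = z≤n
∣unit6∣≤1 5 = ≤-refl
∣unit6∣≤1 (suc (suc (suc (suc (suc (suc c)))))) = ∣unit6∣≤1 c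

-- The three reductions contribute at most x y times 48 B, 24 (B + 1) and 48, which add up to 72 (B
-- + 1).
full-near : ∀ {m a x y l B} → 0 < m → 0 < x → 0 < y → x ≤ B → y ≤ B → y * a ≡ x + l * m → Coprime l y →
  Near (+ (x * y) ℤ.* full m a) (unit6 x ℤ.* unit6 y ℤ.* + (2 * m)) (x * y * (72 * suc B))
full-near {m} {a} {x} {y} {l} {B} m>0 x>0 y>0 x≤B y≤B rel cop = near-weaken err
  (subst₂ (λ p q → Near p q (x * (24 * y * (x + y)) + ∣ uy ∣ * (24 * x * (x + 1)) + ∣ ux ℤ.* uy ∣ * 48)) eq₀ refl
    (near-trans (near-trans (near-scale (+ x) (full-reduce-y m>0 y>0 rel cop))
      (subst (λ p → Near p (ux ℤ.* uy ℤ.* full m 1) (∣ uy ∣ * (24 * x * (x + 1)))) (eq₁ uy (+ x) (full m x))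
        (subst (λ q → Near (uy ℤ.* (+ x ℤ.* full m x)) q (∣ uy ∣ * (24 * x * (x + 1)))) (eq₂ uy ux (full m 1))
          (near-scale uy (full-reduce-x m>0 x>0)))))
      (near-scale (ux ℤ.* uy) (full-one m>0))))
  where
  ux uy : ℤ
  ux = unit6 x
  uy = unit6 y
  eq₀ : + x ℤ.* (+ y ℤ.* full m a) ≡ + (x * y) ℤ.* full m a
  eq₀ = trans (sym (ℤₚ.*-assoc (+ x) (+ y) (full m a))) (cong (ℤ._* full m a) (sym (ℤₚ.pos-* x y)))
  eq₁ : ∀ a b c → a ℤ.* (b ℤ.* c) ≡ b ℤ.* (a ℤ.* c)
  eq₁ = ℤ-Ring.solve-∀
  eq₂ : ∀ a b c → a ℤ.* (b ℤ.* c) ≡ b ℤ.* a ℤ.* c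
  eq₂ = ℤ-Ring.solve-∀
  err : x * (24 * y * (x + y)) + ∣ uy ∣ * (24 * x * (x + 1)) + ∣ ux ℤ.* uy ∣ * 48 ≤ x * y * (72 * suc B)
  err = begin
    x * (24 * y * (x + y)) + ∣ uy ∣ * (24 * x * (x + 1)) + ∣ ux ℤ.* uy ∣ * 48
      ≤⟨ +-mono-≤ (+-mono-≤
          (*-monoʳ-≤ x (*-monoʳ-≤ (24 * y) (+-mono-≤ x≤B y≤B)))
          (*-mono-≤ (∣unit6∣≤1 y) (*-monoʳ-≤ (24 * x) (+-monoˡ-≤ 1 x≤B))))
          (*-monoˡ-≤ 48 (≤-trans (≤-reflexive (ℤₚ.abs-* ux uy)) (*-mono-≤ (∣unit6∣≤1 x) (∣unit6∣≤1 y)))) ⟩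
    x * (24 * y * (B + B)) + 1 * (24 * x * (B + 1)) + 1 * 48                     ≤⟨ +-mono-≤ (+-monoʳ-≤ (x * (24 * y * (B + B))) h₁) (*-monoˡ-≤ 48 (*-mono-≤ x>0 y>0)) ⟩
    x * (24 * y * (B + B)) + x * y * (24 * (B + 1)) + x * y * 48                 ≡⟨ eq₃ x y B ⟩
    x * y * (72 * (1 + B))                                                       ∎
    where
    open ≤-Reasoning
    h₁ : 1 * (24 * x * (B + 1)) ≤ x * y * (24 * (B + 1))
    h₁ = begin
      1 * (24 * x * (B + 1))          ≤⟨ *-monoˡ-≤ (24 * x * (B + 1)) y>0 ⟩
      y * (24 * x * (B + 1))          ≡⟨ e x y (B + 1) ⟩
      x * y * (24 * (B + 1))          ∎
      where
      e : ∀ x y b → y * (24 * x * b) ≡ x * y * (24 * b)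
      e = ℕ-Ring.solve-∀
    eq₃ : ∀ x y b → x * (24 * y * (b + b)) + x * y * (24 * (b + 1)) + x * y * 48 ≡ x * y * (72 * (1 + b))
    eq₃ = ℕ-Ring.solve-∀

hit : ℕ → ℕ → ℤ
hit r g = if does (r ∣? g) then + 1 else + 0

if-yes : ∀ {a p} {A : Set a} {P : Set p} (d : Dec P) {s t : A} → P → (if does d then s else t) ≡ s
if-yes (yes _) _ = refl
if-yes (no ¬p) p = contradiction p ¬p

if-no : ∀ {a p} {A : Set a} {P : Set p} (d : Dec P) {s t : A} → ¬ P → (if does d then s else t) ≡ t
if-no (yes p) ¬p = contradiction p ¬p
if-no (no _)  _  = refl

if-⇔ : ∀ {a p q} {A : Set a} {P : Set p} {Q : Set q} (d : Dec P) (e : Dec Q) {s t : A} →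
  (P → Q) → (Q → P) → (if does d then s else t) ≡ (if does e then s else t)
if-⇔ (yes p) e f g = sym (if-yes e (f p))
if-⇔ (no ¬p) e f g = sym (if-no e (¬p ∘ g))

-- The indicator of being divisible by no listed number, kept as a product so that the Möbius sum
-- unfolds one prime at a time.
χ : List ℕ → ℕ → ℤ
χ []       g = + 1
χ (r ∷ ps) g = (+ 1 ℤ.- hit r g) ℤ.* χ ps g

χ-dilate : ∀ {r ps} → All (λ p → Coprime p r) ps → ∀ g → χ ps (r * g) ≡ χ ps g
χ-dilate []       g = refl
χ-dilate {r} {p ∷ ps} (c ∷ cs) g = cong₂ (λ v w → (+ 1 ℤ.- v) ℤ.* w)
  (if-⇔ (p ∣? r * g) (p ∣? g) (Cop.coprime-divisor c) (∣n⇒∣m*n r)) (χ-dilate cs g)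

∑-hit : ∀ {r} → 0 < r → ∀ M (f : ℕ → ℤ) → ∑ (r * M) (λ g → hit r g ℤ.* f g) ≡ ∑ M (λ k → f (r * k))
∑-hit {r} r>0 M f = begin
  ∑ (r * M) (λ g → hit r g ℤ.* f g)                                       ≡⟨ cong (λ N → ∑ N (λ g → hit r g ℤ.* f g)) (*-comm r M) ⟩
  ∑ (M * r) (λ g → hit r g ℤ.* f g)                                       ≡⟨ ∑-block M r (λ g → hit r g ℤ.* f g) ⟩
  ∑ M (λ k → ∑ r (λ j → hit r (k * r + j) ℤ.* f (k * r + j)))             ≡⟨ ∑-cong M (λ k → trans (∑-cong< r (at k)) (∑-pick r r>0 (λ j → f (k * r + j)))) ⟩
  ∑ M (λ k → f (k * r + 0))                                               ≡⟨ ∑-cong M (λ k → cong f (trans (+-identityʳ (k * r)) (*-comm k r))) ⟩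
  ∑ M (λ k → f (r * k))                                                   ∎
  where
  open ≡-Reasoning
  at : ∀ k j → j < r → hit r (k * r + j) ℤ.* f (k * r + j) ≡ (if j ≡ᵇ 0 then + 1 else + 0) ℤ.* f (k * r + j)
  at k zero    _   = cong (ℤ._* f (k * r + 0)) (if-yes (r ∣? k * r + 0) (∣m∣n⇒∣m+n (n∣m*n k) (r ∣0)))
  at k (suc j) j<r = cong (ℤ._* f (k * r + suc j))
    (if-no (r ∣? k * r + suc j) λ d → <⇒≱ j<r (∣⇒≤ (∣m+n∣m⇒∣n d (n∣m*n k))))

sifted : ℕ → List ℕ → ℕ → ℤ
sifted m ps a = ∑ m (λ g → χ ps g ℤ.* (u m g ℤ.* u m (a * g)))

-- The removed terms are those with g = r k. There u at modulus r M and argument r k is u at modulus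
-- M and argument k, and the other primes divide r k exactly when they divide k, so what is removed
-- is the same sum at modulus M.
sifted-∷ : ∀ {r ps} → 0 < r → All (λ p → Coprime p r) ps → ∀ M a →
  sifted (r * M) (r ∷ ps) a ≡ sifted (r * M) ps a ℤ.- sifted M ps a
sifted-∷ {r} {ps} r>0 cs M a = begin
  ∑ (r * M) (λ g → (+ 1 ℤ.- hit r g) ℤ.* χ ps g ℤ.* w g)                    ≡⟨ ∑-cong (r * M) (λ g → eq (hit r g) (χ ps g) (w g)) ⟩
  ∑ (r * M) (λ g → F g ℤ.+ -[1+ 0 ] ℤ.* (hit r g ℤ.* F g))                  ≡⟨ ∑-add (r * M) F (λ g → -[1+ 0 ] ℤ.* (hit r g ℤ.* F g)) ⟩
  ∑ (r * M) F ℤ.+ ∑ (r * M) (λ g → -[1+ 0 ] ℤ.* (hit r g ℤ.* F g))          ≡⟨ cong (λ w → ∑ (r * M) F ℤ.+ w) (trans (∑-scale (r * M) -[1+ 0 ] (λ g → hit r g ℤ.* F g)) (ℤₚ.-1*i≡-i _)) ⟩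
  ∑ (r * M) F ℤ.- ∑ (r * M) (λ g → hit r g ℤ.* F g)                         ≡⟨ cong (λ w → ∑ (r * M) F ℤ.- w) (trans (∑-hit r>0 M F) (∑-cong M at)) ⟩
  ∑ (r * M) F ℤ.- sifted M ps a                                             ∎
  where
  open ≡-Reasoning
  w F : ℕ → ℤ
  w g = u (r * M) g ℤ.* u (r * M) (a * g)
  F g = χ ps g ℤ.* w g
  eq : ∀ h c w → (+ 1 ℤ.- h) ℤ.* c ℤ.* w ≡ c ℤ.* w ℤ.+ -[1+ 0 ] ℤ.* (h ℤ.* (c ℤ.* w))
  eq = ℤ-Ring.solve-∀
  eq₂ : ∀ a r k → a * (r * k) ≡ r * (a * k)
  eq₂ = ℕ-Ring.solve-∀
  at : ∀ k → F (r * k) ≡ χ ps k ℤ.* (u M k ℤ.* u M (a * k))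
  at k = cong₂ ℤ._*_ (χ-dilate cs k) (cong₂ ℤ._*_ (u-dilate r>0 M k)
    (trans (cong (u (r * M)) (eq₂ a r k)) (u-dilate r>0 M (a * k))))

-- Passing from the modulus m to m / r scales the main term m / (x y) by 1 / r if r ∤ y,
-- and by r if r ∣ y, since then x and y are also divided by r.
φ : ℕ → List ℕ → ℤ
φ y []       = + 1
φ y (r ∷ ps) = (if does (r ∣? y) then + r ℤ.* (+ 1 ℤ.- + r) else (+ r ℤ.- + 1)) ℤ.* φ y ps

φ-dilate : ∀ {r ps} → All (λ p → Coprime p r) ps → ∀ y → φ (y * r) ps ≡ φ y ps
φ-dilate []       y = refl
φ-dilate {r} {p ∷ ps} (c ∷ cs) y = cong₂ ℤ._*_
  (if-⇔ (p ∣? y * r) (p ∣? y) (λ d → Cop.coprime-divisor c (subst (p ∣_) (*-comm y r) d)) (∣m⇒∣m*n r)) (φ-dilate cs y)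

coprime-* : ∀ {a b c} → Coprime a c → Coprime b c → Coprime (a * b) c
coprime-* ac bc (d∣ab , d∣c) =
  bc (Cop.coprime-divisor (λ (e∣d , e∣a) → ac (e∣a , ∣-trans e∣d d∣c)) d∣ab , d∣c)

prime-coprime : ∀ {p} → Prime p → ∀ {n} → ¬ p ∣ n → Coprime p n
prime-coprime pr p∤n (d∣p , d∣n) with prime⇒irreducible pr d∣p
... | inj₁ d≡1 = d≡1
... | inj₂ refl = contradiction d∣n p∤n

PairwiseCoprime : List ℕ → Set
PairwiseCoprime = AllPairs (λ r p → Coprime p r)

Sieving : ℕ → Set
Sieving r = Prime r × unit6 r ≡ + 1

prime>0 : ∀ {p} → Prime p → 0 < p
prime>0 pr = >-nonZero⁻¹ _ {{prime⇒nonZero pr}}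

product>0 : ∀ {ps} → All Sieving ps → 0 < product ps
product>0 []             = z<s
product>0 ((pr , _) ∷ q) = *-mono-≤ (prime>0 pr) (product>0 q)

-- Induction on the primes with a free cofactor `M`: one call moves r into the cofactor, the other
-- drops r from the modulus. Each prime doubles the error, hence the power of 2.
sifted-near : ∀ {ps a B} → PairwiseCoprime ps → All Sieving ps → ∀ {M x y l} →
  0 < M → 0 < x → 0 < y → x ≤ B → y ≤ B → y * a ≡ x + l * (product ps * M) → Coprime l y →
  Near (+ (x * y) ℤ.* sifted (product ps * M) ps a)
       (unit6 x ℤ.* unit6 y ℤ.* (+ (2 * M) ℤ.* φ y ps))
       (x * y * (2 ^ length ps * (72 * suc B)))
sifted-near {[]} {a} {B} [] [] {M} {x} {y} M>0 x>0 y>0 x≤B y≤B rel cop =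
  near-weaken (≤-reflexive (cong (x * y *_) (sym (*-identityˡ (72 * suc B)))))
    (subst₂ (λ p q → Near p q (x * y * (72 * suc B)))
      (cong (+ (x * y) ℤ.*_) (∑-cong (1 * M) λ g → sym (ℤₚ.*-identityˡ _)))
      (cong (unit6 x ℤ.* unit6 y ℤ.*_) (trans (cong (λ w → + (2 * w)) (*-identityˡ M)) (sym (ℤₚ.*-identityʳ (+ (2 * M))))))
      (full-near (subst (0 <_) (sym (*-identityˡ M)) M>0) x>0 y>0 x≤B y≤B rel cop))
sifted-near {r ∷ ps} {a} {B} (cs ∷ pc) ((pr , r6) ∷ sv) {M} {x} {y} {l} M>0 x>0 y>0 x≤B y≤B rel cop
  = near-weaken (≤-reflexive err) (subst (λ p → Near p main (E + E)) (sym lhs) (step (r ∣? y)))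
  where
  open ≡-Reasoning
  P T E : ℕ
  P = product ps
  T = 2 ^ length ps * (72 * suc B)
  E = x * y * T
  main : ℤ
  main = unit6 x ℤ.* unit6 y ℤ.* (+ (2 * M) ℤ.* φ y (r ∷ ps))
  r>0 : 0 < r
  r>0 = prime>0 pr
  lhs : + (x * y) ℤ.* sifted (r * P * M) (r ∷ ps) a
      ≡ + (x * y) ℤ.* sifted (P * (r * M)) ps a ℤ.- + (x * y) ℤ.* sifted (P * M) ps a
  lhs = begin
    + (x * y) ℤ.* sifted (r * P * M) (r ∷ ps) a                                              ≡⟨ cong (λ N → + (x * y) ℤ.* sifted N (r ∷ ps) a) (*-assoc r P M) ⟩
    + (x * y) ℤ.* sifted (r * (P * M)) (r ∷ ps) a                                            ≡⟨ cong (+ (x * y) ℤ.*_) (sifted-∷ r>0 cs (P * M) a) ⟩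
    + (x * y) ℤ.* (sifted (r * (P * M)) ps a ℤ.- sifted (P * M) ps a)                        ≡⟨ eq (+ (x * y)) _ (sifted (P * M) ps a) ⟩
    + (x * y) ℤ.* sifted (r * (P * M)) ps a ℤ.- + (x * y) ℤ.* sifted (P * M) ps a            ≡⟨ cong (λ N → + (x * y) ℤ.* sifted N ps a ℤ.- + (x * y) ℤ.* sifted (P * M) ps a) (eqN r P M) ⟩
    + (x * y) ℤ.* sifted (P * (r * M)) ps a ℤ.- + (x * y) ℤ.* sifted (P * M) ps a            ∎
    where
    eq : ∀ c s t → c ℤ.* (s ℤ.- t) ≡ c ℤ.* s ℤ.- c ℤ.* t
    eq = ℤ-Ring.solve-∀
    eqN : ∀ r P M → r * (P * M) ≡ P * (r * M)
    eqN = ℕ-Ring.solve-∀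
  err : E + E ≡ x * y * (2 ^ length (r ∷ ps) * (72 * suc B))
  err = eq x y (2 ^ length ps) (72 * suc B)
    where
    eq : ∀ x y t b → x * y * (t * b) + x * y * (t * b) ≡ x * y * (2 * t * b)
    eq = ℕ-Ring.solve-∀
  rel₁ : y * a ≡ x + l * (P * (r * M))
  rel₁ = trans rel (eq x l r P M)
    where
    eq : ∀ x l r P M → x + l * (r * P * M) ≡ x + l * (P * (r * M))
    eq = ℕ-Ring.solve-∀
  first : Near (+ (x * y) ℤ.* sifted (P * (r * M)) ps a) (unit6 x ℤ.* unit6 y ℤ.* (+ (2 * (r * M)) ℤ.* φ y ps)) E
  first = sifted-near pc sv (*-mono-≤ r>0 M>0) x>0 y>0 x≤B y≤B rel₁ cop
  +2M : ∀ z → + (2 * z) ≡ + 2 ℤ.* + z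
  +2M z = ℤₚ.pos-* 2 z
  target : ℤ
  target = + (x * y) ℤ.* sifted (P * (r * M)) ps a ℤ.- + (x * y) ℤ.* sifted (P * M) ps a
  step : Dec (r ∣ y) → Near target main (E + E)
  -- The ratio x / y survives at the smaller modulus with quotient `l * r`, which is still prime to
  -- `y`.
  step (no r∤y) = subst (λ q → Near target q (E + E)) eq (near-- first second)
    where
    second : Near (+ (x * y) ℤ.* sifted (P * M) ps a) (unit6 x ℤ.* unit6 y ℤ.* (+ (2 * M) ℤ.* φ y ps)) E
    second = sifted-near pc sv {l = l * r} M>0 x>0 y>0 x≤B y≤B (trans rel (e x l r P M)) (coprime-* cop (prime-coprime pr r∤y))
      where
      e : ∀ x l r P M → x + l * (r * P * M) ≡ x + l * r * (P * M)
      e = ℕ-Ring.solve-∀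
    eq : unit6 x ℤ.* unit6 y ℤ.* (+ (2 * (r * M)) ℤ.* φ y ps) ℤ.- unit6 x ℤ.* unit6 y ℤ.* (+ (2 * M) ℤ.* φ y ps) ≡ main
    eq = begin
      c ℤ.* (+ (2 * (r * M)) ℤ.* φ y ps) ℤ.- c ℤ.* (+ (2 * M) ℤ.* φ y ps)
        ≡⟨ cong₂ (λ v w → c ℤ.* (v ℤ.* φ y ps) ℤ.- c ℤ.* (w ℤ.* φ y ps)) (trans (+2M (r * M)) (cong (+ 2 ℤ.*_) (ℤₚ.pos-* r M))) (+2M M) ⟩
      c ℤ.* (+ 2 ℤ.* (+ r ℤ.* + M) ℤ.* φ y ps) ℤ.- c ℤ.* (+ 2 ℤ.* + M ℤ.* φ y ps)
        ≡⟨ e c (+ r) (+ M) (φ y ps) ⟩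
      c ℤ.* (+ 2 ℤ.* + M ℤ.* ((+ r ℤ.- + 1) ℤ.* φ y ps))
        ≡⟨ cong₂ (λ v w → c ℤ.* (v ℤ.* (w ℤ.* φ y ps))) (sym (+2M M)) (sym (if-no (r ∣? y) r∤y)) ⟩
      main ∎
      where
      c : ℤ
      c = unit6 x ℤ.* unit6 y
      e : ∀ c r M p → c ℤ.* (+ 2 ℤ.* (r ℤ.* M) ℤ.* p) ℤ.- c ℤ.* (+ 2 ℤ.* M ℤ.* p) ≡ c ℤ.* (+ 2 ℤ.* M ℤ.* ((r ℤ.- + 1) ℤ.* p))
      e = ℤ-Ring.solve-∀
  -- Since r divides the modulus and y, it divides x. The ratio becomes (x / r) / (y / r) with the
  -- same `l`, and normalising by x y instead of x y / r² costs the factor r². The `unit6` factors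
  -- do not change because unit6(r) = 1.
  step (yes r∣y) = subst (λ q → Near target q (E + E)) eq (near-- first second)
    where
    r∣x : r ∣ x
    r∣x = ∣m+n∣m⇒∣n (subst (r ∣_) (trans rel (+-comm x _)) (∣m⇒∣m*n a r∣y)) (∣n⇒∣m*n l (∣m⇒∣m*n M (m∣m*n P)))
    x′ : ℕ
    x′ = quotient r∣x
    y′ : ℕ
    y′ = quotient r∣y
    y≡ : y ≡ y′ * r
    y≡ = m∣n⇒n≡quotient*m r∣y
    x≡ : x ≡ x′ * r
    x≡ = m∣n⇒n≡quotient*m r∣x
    cancel>0 : ∀ k → 0 < k * r → 0 < k
    cancel>0 (suc k) _ = z<s
    ≤B : ∀ k → k * r ≤ B → k ≤ B
    ≤B k = ≤-trans (m≤m*n k r {{prime⇒nonZero pr}})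
    unit6-r : ∀ k → unit6 (k * r) ≡ unit6 k
    unit6-r k = trans (unit6-* k r) (trans (cong (unit6 k ℤ.*_) r6) (ℤₚ.*-identityʳ (unit6 k)))
    rel₂ : y′ * a ≡ x′ + l * (P * M)
    rel₂ = *-cancelˡ-≡ _ _ r {{prime⇒nonZero pr}} (begin
      r * (y′ * a)                       ≡⟨ e₁ r y′ a ⟩
      y′ * r * a                         ≡⟨ cong (_* a) (sym y≡) ⟩
      y * a                              ≡⟨ rel ⟩
      x + l * (r * P * M)                ≡⟨ cong (λ v → v + l * (r * P * M)) x≡ ⟩
      x′ * r + l * (r * P * M)           ≡⟨ e₂ x′ r l P M ⟩
      r * (x′ + l * (P * M))             ∎)
      where
      e₁ : ∀ r y a → r * (y * a) ≡ y * r * a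
      e₁ = ℕ-Ring.solve-∀
      e₂ : ∀ x r l P M → x * r + l * (r * P * M) ≡ r * (x + l * (P * M))
      e₂ = ℕ-Ring.solve-∀
    ih : Near (+ (x′ * y′) ℤ.* sifted (P * M) ps a) (unit6 x′ ℤ.* unit6 y′ ℤ.* (+ (2 * M) ℤ.* φ y′ ps)) (x′ * y′ * T)
    ih = sifted-near pc sv M>0 (cancel>0 x′ (subst (0 <_) x≡ x>0)) (cancel>0 y′ (subst (0 <_) y≡ y>0))
      (≤B x′ (subst (_≤ B) x≡ x≤B)) (≤B y′ (subst (_≤ B) y≡ y≤B)) rel₂ (λ (d∣l , d∣y′) → cop (d∣l , subst (_ ∣_) (sym y≡) (∣m⇒∣m*n r d∣y′)))
    xy : r * r * (x′ * y′) ≡ x * y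
    xy = trans (e r x′ y′) (sym (cong₂ _*_ x≡ y≡))
      where
      e : ∀ r x y → r * r * (x * y) ≡ x * r * (y * r)
      e = ℕ-Ring.solve-∀
    c : ℤ
    c = unit6 x ℤ.* unit6 y
    second : Near (+ (x * y) ℤ.* sifted (P * M) ps a) (c ℤ.* (+ (r * r) ℤ.* (+ (2 * M) ℤ.* φ y ps))) E
    second = near-weaken (≤-reflexive (trans (sym (*-assoc (r * r) (x′ * y′) T)) (cong (_* T) xy)))
      (subst₂ (λ p q → Near p q (r * r * (x′ * y′ * T)))
        (trans (sym (ℤₚ.*-assoc (+ (r * r)) (+ (x′ * y′)) (sifted (P * M) ps a)))
          (cong (ℤ._* sifted (P * M) ps a) (trans (sym (ℤₚ.pos-* (r * r) (x′ * y′))) (cong +_ xy))))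
        (trans (e (+ (r * r)) (unit6 x′ ℤ.* unit6 y′) (+ (2 * M) ℤ.* φ y′ ps))
          (cong₂ (λ v w → v ℤ.* (+ (r * r) ℤ.* (+ (2 * M) ℤ.* w)))
            (sym (cong₂ ℤ._*_ (trans (cong unit6 x≡) (unit6-r x′)) (trans (cong unit6 y≡) (unit6-r y′))))
            (trans (sym (φ-dilate cs y′)) (cong (λ v → φ v ps) (sym y≡)))))
        (near-scale (+ (r * r)) ih))
      where
      e : ∀ a b c → a ℤ.* (b ℤ.* c) ≡ b ℤ.* (a ℤ.* c)
      e = ℤ-Ring.solve-∀
    eq : c ℤ.* (+ (2 * (r * M)) ℤ.* φ y ps) ℤ.- c ℤ.* (+ (r * r) ℤ.* (+ (2 * M) ℤ.* φ y ps)) ≡ main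
    eq = begin
      c ℤ.* (+ (2 * (r * M)) ℤ.* p) ℤ.- c ℤ.* (+ (r * r) ℤ.* (+ (2 * M) ℤ.* p))
        ≡⟨ cong₂ (λ v w → c ℤ.* (v ℤ.* p) ℤ.- c ℤ.* (w ℤ.* (+ (2 * M) ℤ.* p))) (trans (+2M (r * M)) (cong (+ 2 ℤ.*_) (ℤₚ.pos-* r M))) (ℤₚ.pos-* r r) ⟩
      c ℤ.* (+ 2 ℤ.* (+ r ℤ.* + M) ℤ.* p) ℤ.- c ℤ.* (+ r ℤ.* + r ℤ.* (+ (2 * M) ℤ.* p))
        ≡⟨ cong (λ v → c ℤ.* (+ 2 ℤ.* (+ r ℤ.* + M) ℤ.* p) ℤ.- c ℤ.* (+ r ℤ.* + r ℤ.* (v ℤ.* p))) (+2M M) ⟩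
      c ℤ.* (+ 2 ℤ.* (+ r ℤ.* + M) ℤ.* p) ℤ.- c ℤ.* (+ r ℤ.* + r ℤ.* (+ 2 ℤ.* + M ℤ.* p))
        ≡⟨ e c (+ r) (+ M) p ⟩
      c ℤ.* (+ 2 ℤ.* + M ℤ.* (+ r ℤ.* (+ 1 ℤ.- + r) ℤ.* p))
        ≡⟨ cong₂ (λ v w → c ℤ.* (v ℤ.* (w ℤ.* p))) (sym (+2M M)) (sym (if-yes (r ∣? y) r∣y)) ⟩
      main ∎
      where
      p : ℤ
      p = φ y ps
      e : ∀ c r M p → c ℤ.* (+ 2 ℤ.* (r ℤ.* M) ℤ.* p) ℤ.- c ℤ.* (r ℤ.* r ℤ.* (+ 2 ℤ.* M ℤ.* p)) ≡ c ℤ.* (+ 2 ℤ.* M ℤ.* (r ℤ.* (+ 1 ℤ.- r) ℤ.* p))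
      e = ℤ-Ring.solve-∀

-- The size of the main term

^-distribʳ-* : ∀ o m n → (m * n) ^ o ≡ m ^ o * n ^ o
^-distribʳ-* zero    m n = refl
^-distribʳ-* (suc o) m n = trans (cong (m * n *_) (^-distribʳ-* o m n)) (eq m n (m ^ o) (n ^ o))
  where
  eq : ∀ m n a b → m * n * (a * b) ≡ m * a * (n * b)
  eq = ℕ-Ring.solve-∀

-- If `ps` lists the primes dividing n and n = `product ps * M`, the Euler totient of n is
-- `M * totient ps`.
totient : List ℕ → ℕ
totient []       = 1
totient (r ∷ ps) = (r ∸ 1) * totient ps

product-∣ : ∀ {ps z} → PairwiseCoprime ps → All (_∣ z) ps → product ps ∣ z
product-∣ {z = z} [] [] = 1∣ z
product-∣ {r ∷ ps} {z} (cs ∷ pc) (r∣z ∷ ds) =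
  subst (r * product ps ∣_) (sym z≡) (*-monoʳ-∣ r (product-∣ pc (quotients cs ds)))
  where
  z≡ : z ≡ r * quotient r∣z
  z≡ = m∣n⇒n≡m*quotient r∣z
  quotients : ∀ {qs} → All (λ p → Coprime p r) qs → All (_∣ z) qs → All (_∣ quotient r∣z) qs
  quotients []       []       = []
  quotients (c ∷ cs) (d ∷ ds) = Cop.coprime-divisor c (subst (_ ∣_) z≡ d) ∷ quotients cs ds

-- A prime dividing `y` contributes r (r - 1) and any other prime r - 1, so the surplus over
-- `totient` is the product of the primes dividing `y`.
∣φ∣ : ∀ y {ps} → All Sieving ps → ∣ φ y ps ∣ ≡ product (filter (_∣? y) ps) * totient ps
∣φ∣ y [] = refl
∣φ∣ y {zero ∷ ps} ((pr , _) ∷ sv) = contradiction (prime>0 pr) λ ()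
∣φ∣ y {suc r ∷ ps} (_ ∷ sv) = by-cases (suc r ∣? y)
  where
  open ≡-Reasoning
  q t : ℕ
  q = product (filter (_∣? y) ps)
  t = totient ps
  ∣1-suc∣ : ∀ r → ∣ + 1 ℤ.- + suc r ∣ ≡ r
  ∣1-suc∣ zero    = refl
  ∣1-suc∣ (suc r) = refl
  eq₁ : ∀ a b c d → a * b * (c * d) ≡ a * c * (b * d)
  eq₁ = ℕ-Ring.solve-∀
  eq₂ : ∀ a c d → a * (c * d) ≡ c * (a * d)
  eq₂ = ℕ-Ring.solve-∀
  by-cases : Dec (suc r ∣ y) → ∣ φ y (suc r ∷ ps) ∣ ≡ product (filter (_∣? y) (suc r ∷ ps)) * (r * t)
  by-cases (yes d) = begin
    ∣ φ y (suc r ∷ ps) ∣                               ≡⟨ cong (λ w → ∣ w ℤ.* φ y ps ∣) (if-yes (suc r ∣? y) d) ⟩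
    ∣ + suc r ℤ.* (+ 1 ℤ.- + suc r) ℤ.* φ y ps ∣       ≡⟨ ℤₚ.abs-* (+ suc r ℤ.* (+ 1 ℤ.- + suc r)) (φ y ps) ⟩
    ∣ + suc r ℤ.* (+ 1 ℤ.- + suc r) ∣ * ∣ φ y ps ∣     ≡⟨ cong₂ _*_ (trans (ℤₚ.abs-* (+ suc r) (+ 1 ℤ.- + suc r)) (cong (suc r *_) (∣1-suc∣ r))) (∣φ∣ y sv) ⟩
    suc r * r * (q * t)                                ≡⟨ eq₁ (suc r) r q t ⟩
    suc r * q * (r * t)                                ≡⟨ cong (λ qs → product qs * (r * t)) (sym (filter-accept (_∣? y) d)) ⟩
    product (filter (_∣? y) (suc r ∷ ps)) * (r * t)    ∎
  by-cases (no ¬d) = begin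
    ∣ φ y (suc r ∷ ps) ∣                               ≡⟨ cong (λ w → ∣ w ℤ.* φ y ps ∣) (if-no (suc r ∣? y) ¬d) ⟩
    ∣ (+ suc r ℤ.- + 1) ℤ.* φ y ps ∣                   ≡⟨ ℤₚ.abs-* (+ suc r ℤ.- + 1) (φ y ps) ⟩
    r * ∣ φ y ps ∣                                     ≡⟨ cong (r *_) (∣φ∣ y sv) ⟩
    r * (q * t)                                        ≡⟨ eq₂ r q t ⟩
    q * (r * t)                                        ≡⟨ cong (λ qs → product qs * (r * t)) (sym (filter-reject (_∣? y) ¬d)) ⟩
    product (filter (_∣? y) (suc r ∷ ps)) * (r * t)    ∎

unit6-cases : ∀ c → unit6 c ≡ + 0 ⊎ c ≡ 1 ⊎ 5 ≤ c
unit6-cases 0 = inj₁ refl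
unit6-cases 1 = inj₂ (inj₁ refl)
unit6-cases 2 = inj₁ refl
unit6-cases 3 = inj₁ refl
unit6-cases 4 = inj₁ refl
unit6-cases (suc (suc (suc (suc (suc c))))) = inj₂ (inj₂ (m≤m+n 5 c))

near-abs : ∀ {a b e} → Near a b e → ∣ a ∣ ≤ ∣ b ∣ + e
near-abs {a} {b} {e} (near p) = begin
  ∣ a ∣                     ≡⟨ cong ∣_∣ (eq a b) ⟩
  ∣ b ℤ.+ (a ℤ.- b) ∣       ≤⟨ ∣i+j∣≤ {b} {a ℤ.- b} ≤-refl p ⟩
  ∣ b ∣ + e                 ∎
  where
  open ≤-Reasoning
  eq : ∀ a b → a ≡ b ℤ.+ (a ℤ.- b)
  eq = ℤ-Ring.solve-∀

-- The surplus q, the product of the sieving primes dividing y, divides y and also x, because these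
-- primes divide the modulus. If the main term does not vanish, x and y are each 1 or at least 5 and
-- not both 1; one is then at least 5 and the other at least q, so 5 q ≤ x y.
sifted-bound : ∀ {ps a B} → PairwiseCoprime ps → All Sieving ps → ∀ {M x y l} →
  0 < M → 0 < x → 0 < y → x ≤ B → y ≤ B → y * a ≡ x + l * (product ps * M) → Coprime l y →
  ¬ (x ≡ 1 × y ≡ 1) →
  5 * ∣ sifted (product ps * M) ps a ∣ ≤ 2 * M * totient ps + 5 * (2 ^ length ps * (72 * suc B))
sifted-bound {ps} {a} {B} pc sv {M} {x} {y} {l} M>0 x>0 y>0 x≤B y≤B rel cop xy≢1 =
  *-cancelˡ-≤ (x * y) {{>-nonZero (*-mono-≤ x>0 y>0)}} (begin
    x * y * (5 * ∣ S ∣)                     ≡⟨ eq₁ (x * y) ∣ S ∣ ⟩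
    5 * (x * y * ∣ S ∣)                     ≡⟨ cong (5 *_) (sym (ℤₚ.abs-* (+ (x * y)) S)) ⟩
    5 * ∣ + (x * y) ℤ.* S ∣                 ≤⟨ *-monoʳ-≤ 5 (near-abs (sifted-near pc sv M>0 x>0 y>0 x≤B y≤B rel cop)) ⟩
    5 * (∣ main ∣ + x * y * T)              ≡⟨ *-distribˡ-+ 5 ∣ main ∣ (x * y * T) ⟩
    5 * ∣ main ∣ + 5 * (x * y * T)          ≤⟨ +-monoˡ-≤ (5 * (x * y * T)) main-bound ⟩
    x * y * D + 5 * (x * y * T)             ≡⟨ eq₂ (x * y) D T ⟩
    x * y * (D + 5 * T)                     ∎)
  where
  open ≤-Reasoning
  T D q : ℕ
  T = 2 ^ length ps * (72 * suc B)
  D = 2 * M * totient ps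
  q = product (filter (_∣? y) ps)
  S main : ℤ
  S = sifted (product ps * M) ps a
  main = unit6 x ℤ.* unit6 y ℤ.* (+ (2 * M) ℤ.* φ y ps)
  eq₁ : ∀ a b → a * (5 * b) ≡ 5 * (a * b)
  eq₁ = ℕ-Ring.solve-∀
  eq₂ : ∀ a d t → a * d + 5 * (a * t) ≡ a * (d + 5 * t)
  eq₂ = ℕ-Ring.solve-∀
  pc′ : PairwiseCoprime (filter (_∣? y) ps)
  pc′ = AllPairsₚ.filter⁺ (_∣? y) pc
  q≤y : q ≤ y
  q≤y = ∣⇒≤ {{>-nonZero y>0}} (product-∣ pc′ (Allₚ.all-filter (_∣? y) ps))
  divides-x : ∀ {r} → r ∣ y → r ∣ product ps → r ∣ x
  divides-x {r} r∣y r∣P = ∣m+n∣m⇒∣n (subst (r ∣_) (trans rel (+-comm x (l * (product ps * M)))) (∣m⇒∣m*n a r∣y))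
    (∣n⇒∣m*n l (∣m⇒∣m*n M r∣P))
  members : ∀ qs → All (_∣ product qs) qs
  members []       = []
  members (r ∷ qs) = m∣m*n (product qs) ∷ All.map (∣n⇒∣m*n r) (members qs)
  q≤x : q ≤ x
  q≤x = ∣⇒≤ {{>-nonZero x>0}} (product-∣ pc′ (All.zipWith (λ (r∣P , r∣y) → divides-x r∣y r∣P)
    (Allₚ.filter⁺ (_∣? y) (members ps) , Allₚ.all-filter (_∣? y) ps)))
  main-abs : ∣ main ∣ ≤ q * D
  main-abs = begin
    ∣ main ∣                                                     ≡⟨ ℤₚ.abs-* (unit6 x ℤ.* unit6 y) (+ (2 * M) ℤ.* φ y ps) ⟩
    ∣ unit6 x ℤ.* unit6 y ∣ * ∣ + (2 * M) ℤ.* φ y ps ∣           ≡⟨ cong₂ _*_ (ℤₚ.abs-* (unit6 x) (unit6 y)) (trans (ℤₚ.abs-* (+ (2 * M)) (φ y ps)) (cong (2 * M *_) (∣φ∣ y sv))) ⟩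
    ∣ unit6 x ∣ * ∣ unit6 y ∣ * (2 * M * (q * totient ps))       ≤⟨ *-monoˡ-≤ (2 * M * (q * totient ps)) (*-mono-≤ (∣unit6∣≤1 x) (∣unit6∣≤1 y)) ⟩
    1 * (2 * M * (q * totient ps))                               ≡⟨ eq M q (totient ps) ⟩
    q * D                                                        ∎
    where
    eq : ∀ M q t → 1 * (2 * M * (q * t)) ≡ q * (2 * M * t)
    eq = ℕ-Ring.solve-∀
  by-size : 5 * q ≤ x * y → 5 * ∣ main ∣ ≤ x * y * D
  by-size h = begin
    5 * ∣ main ∣     ≤⟨ *-monoʳ-≤ 5 main-abs ⟩
    5 * (q * D)      ≡⟨ sym (*-assoc 5 q D) ⟩
    5 * q * D        ≤⟨ *-monoˡ-≤ D h ⟩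
    x * y * D        ∎
  vanishing : unit6 x ℤ.* unit6 y ≡ + 0 → 5 * ∣ main ∣ ≤ x * y * D
  vanishing h = ≤-trans (≤-reflexive (cong (λ w → 5 * ∣ w ℤ.* (+ (2 * M) ℤ.* φ y ps) ∣) h)) z≤n
  main-bound : 5 * ∣ main ∣ ≤ x * y * D
  main-bound with unit6-cases x | unit6-cases y
  ... | inj₁ h | _ = vanishing (trans (cong (ℤ._* unit6 y) h) (ℤₚ.*-zeroˡ (unit6 y)))
  ... | inj₂ _ | inj₁ h = vanishing (trans (cong (unit6 x ℤ.*_) h) (ℤₚ.*-zeroʳ (unit6 x)))
  ... | inj₂ (inj₁ x≡1) | inj₂ (inj₁ y≡1) = contradiction (x≡1 , y≡1) xy≢1
  ... | inj₂ (inj₂ 5≤x) | inj₂ _ = by-size (*-mono-≤ 5≤x q≤y)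
  ... | inj₂ (inj₁ _) | inj₂ (inj₂ 5≤y) = by-size (≤-trans (*-mono-≤ 5≤y q≤x) (≤-reflexive (*-comm y x)))

-- For a prime r ≥ 11 already 64 r⁴ ≤ (r - 1)⁶; the primes 5 and 7 need an extra factor.
excess : ℕ → ℕ → List ℕ → ℕ
excess p k []       = 1
excess p k (r ∷ ps) = (if does (r ≟ p) then k else 1) * excess p k ps

excess-absent : ∀ {p k ps} → 1 < p → All (λ r → Coprime r p) ps → excess p k ps ≡ 1
excess-absent 1<p [] = refl
excess-absent {p} {k} {r ∷ ps} 1<p (c ∷ cs) = trans
  (cong₂ _*_ (if-no (r ≟ p) λ { refl → <⇒≢ 1<p (sym (c (∣-refl , ∣-refl))) }) (excess-absent 1<p cs)) (*-identityˡ 1)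

excess≤ : ∀ {p k ps} → 1 < p → 0 < k → PairwiseCoprime ps → excess p k ps ≤ k
excess≤ 1<p k>0 [] = k>0
excess≤ {p} {k} {r ∷ ps} 1<p k>0 (cs ∷ pc) = by-cases (r ≟ p)
  where
  by-cases : Dec (r ≡ p) → excess p k (r ∷ ps) ≤ k
  by-cases (yes refl) = ≤-reflexive (trans (cong₂ _*_ (if-yes (r ≟ r) refl) (excess-absent 1<p cs)) (*-identityʳ k))
  by-cases (no r≢p)   = ≤-trans
    (≤-reflexive (trans (cong (_* excess p k ps) (if-no (r ≟ p) r≢p)) (*-identityˡ _)))
    (excess≤ 1<p k>0 pc)

-- Both sides are squares, so it suffices that 8 r² ≤ (r - 1)³ for r = 11 + t. At r = 11 this reads
-- 968 ≤ 1000, and the difference `c` has positive coefficients in t.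
large-prime : ∀ t → 64 * (11 + t) ^ 4 ≤ (10 + t) ^ 6
large-prime t = begin
  64 * (11 + t) ^ 4                                     ≡⟨ e₁ t ⟩
  s * s                                                 ≤⟨ *-mono-≤ (m≤m+n s c) (m≤m+n s c) ⟩
  (s + c) * (s + c)                                     ≡⟨ cong (λ w → w * w) (e₂ t) ⟩
  (10 + t) ^ 3 * (10 + t) ^ 3                           ≡⟨ sym (^-distribˡ-+-* (10 + t) 3 3) ⟩
  (10 + t) ^ 6                                          ∎
  where
  open ≤-Reasoning
  s c : ℕ
  s = 8 * ((11 + t) * (11 + t))
  c = 32 + 124 * t + 22 * (t * t) + t * t * t
  e₁ : ∀ t → 64 * ((11 + t) * ((11 + t) * ((11 + t) * ((11 + t) * 1)))) ≡ 8 * ((11 + t) * (11 + t)) * (8 * ((11 + t) * (11 + t)))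
  e₁ = ℕ-Ring.solve-∀
  e₂ : ∀ t → 8 * ((11 + t) * (11 + t)) + (32 + 124 * t + 22 * (t * t) + t * t * t) ≡ (10 + t) * ((10 + t) * ((10 + t) * 1))
  e₂ = ℕ-Ring.solve-∀

-- The factors 10 and 4 are the least integers that serve: 64 · 5⁴ = 40000 ≤ 40960 = 10 · 4⁶ and 64
-- · 7⁴ = 153664 ≤ 186624 = 4 · 6⁶.
prime-size : ∀ r → unit6 r ≡ + 1 → r ≢ 1 →
  64 * r ^ 4 ≤ (if does (r ≟ 5) then 10 else 1) * (if does (r ≟ 7) then 4 else 1) * (r ∸ 1) ^ 6
prime-size 1 _ h = contradiction refl h
prime-size 5 _ _ = ≤ᵇ⇒≤ (64 * 5 ^ 4) (10 * 1 * 4 ^ 6) _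
prime-size 7 _ _ = ≤ᵇ⇒≤ (64 * 7 ^ 4) (1 * 4 * 6 ^ 6) _
prime-size (suc (suc (suc (suc (suc (suc (suc (suc (suc (suc (suc t))))))))))) _ _ =
  ≤-trans (large-prime t) (≤-reflexive (sym (*-identityˡ ((10 + t) ^ 6))))

product-size : ∀ {ps} → All Sieving ps →
  64 ^ length ps * product ps ^ 4 ≤ excess 5 10 ps * excess 7 4 ps * totient ps ^ 6
product-size [] = ≤-refl
product-size {r ∷ ps} ((pr , r6) ∷ sv) = begin
  64 * 64 ^ length ps * (r * P) ^ 4                ≡⟨ cong (64 * 64 ^ length ps *_) (^-distribʳ-* 4 r P) ⟩
  64 * 64 ^ length ps * (r ^ 4 * P ^ 4)            ≡⟨ eq₁ 64 (64 ^ length ps) (r ^ 4) (P ^ 4) ⟩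
  64 * r ^ 4 * (64 ^ length ps * P ^ 4)            ≤⟨ *-mono-≤ (prime-size r r6 λ { refl → ¬prime[1] pr }) (product-size sv) ⟩
  a * b * (r ∸ 1) ^ 6 * (c * d * t ^ 6)            ≡⟨ eq₂ a b ((r ∸ 1) ^ 6) c d (t ^ 6) ⟩
  a * c * (b * d) * ((r ∸ 1) ^ 6 * t ^ 6)          ≡⟨ cong (a * c * (b * d) *_) (sym (^-distribʳ-* 6 (r ∸ 1) t)) ⟩
  a * c * (b * d) * ((r ∸ 1) * t) ^ 6              ∎
  where
  open ≤-Reasoning
  P a b c d t : ℕ
  P = product ps
  a = if does (r ≟ 5) then 10 else 1
  b = if does (r ≟ 7) then 4 else 1
  c = excess 5 10 ps
  d = excess 7 4 ps
  t = totient ps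
  eq₁ : ∀ s k x y → s * k * (x * y) ≡ s * x * (k * y)
  eq₁ = ℕ-Ring.solve-∀
  eq₂ : ∀ a b r c d t → a * b * r * (c * d * t) ≡ a * c * (b * d) * (r * t)
  eq₂ = ℕ-Ring.solve-∀

-- Sixth powers turn 2^k into the 64^k of `product-size` and the square root b into b⁶ ≤ n³. With t
-- the totient of `ps`, 64^k n⁴ ≤ A (M t)⁶ ≤ A c⁶ 64^k n³, and the common factors cancel.
size-core : ∀ {ps M b A c} → All Sieving ps → 0 < M → b * b ≤ product ps * M →
  excess 5 10 ps * excess 7 4 ps ≤ A → M * totient ps ≤ c * (2 ^ length ps * b) → product ps * M ≤ A * c ^ 6
size-core {ps} {M} {b} {A} {c} sv M>0 b²≤n ex≤A small =
  *-cancelʳ-≤ n (A * c ^ 6) (n ^ 3) {{m^n≢0 n 3}} (*-cancelˡ-≤ (64 ^ k) {{m^n≢0 64 k}} main)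
  where
  open ≤-Reasoning
  n k t : ℕ
  n = product ps * M
  k = length ps
  t = totient ps
  instance
    n≢0 : NonZero n
    n≢0 = >-nonZero (*-mono-≤ (product>0 sv) M>0)
  b⁶ : b ^ 6 ≤ n ^ 3
  b⁶ = begin
    b ^ 6            ≡⟨ sym (^-*-assoc b 2 3) ⟩
    (b ^ 2) ^ 3      ≡⟨ cong (λ w → (b * w) ^ 3) (*-identityʳ b) ⟩
    (b * b) ^ 3      ≤⟨ ^-monoˡ-≤ 3 b²≤n ⟩
    n ^ 3            ∎
  2^k⁶ : (2 ^ k) ^ 6 ≡ 64 ^ k
  2^k⁶ = trans (^-*-assoc 2 k 6) (trans (cong (2 ^_) (*-comm k 6)) (sym (^-*-assoc 2 6 k)))
  sixth : M ^ 6 * t ^ 6 ≤ c ^ 6 * (64 ^ k * n ^ 3)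
  sixth = begin
    M ^ 6 * t ^ 6                        ≡⟨ sym (^-distribʳ-* 6 M t) ⟩
    (M * t) ^ 6                          ≤⟨ ^-monoˡ-≤ 6 small ⟩
    (c * (2 ^ k * b)) ^ 6                ≡⟨ ^-distribʳ-* 6 c (2 ^ k * b) ⟩
    c ^ 6 * (2 ^ k * b) ^ 6              ≡⟨ cong (c ^ 6 *_) (trans (^-distribʳ-* 6 (2 ^ k) b) (cong (_* b ^ 6) 2^k⁶)) ⟩
    c ^ 6 * (64 ^ k * b ^ 6)             ≤⟨ *-monoʳ-≤ (c ^ 6) (*-monoʳ-≤ (64 ^ k) b⁶) ⟩
    c ^ 6 * (64 ^ k * n ^ 3)             ∎
  eq₁ : ∀ s p m → s * (p * m) ≡ m * (s * p)
  eq₁ = ℕ-Ring.solve-∀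
  eq₂ : ∀ m c t → m * (c * t) ≡ c * (m * t)
  eq₂ = ℕ-Ring.solve-∀
  eq₃ : ∀ f c s n → f * (c * (s * n)) ≡ s * (f * c * n)
  eq₃ = ℕ-Ring.solve-∀
  main : 64 ^ k * (n * n ^ 3) ≤ 64 ^ k * (A * c ^ 6 * n ^ 3)
  main = begin
    64 ^ k * n ^ 4                                         ≡⟨ cong (64 ^ k *_) (^-distribʳ-* 4 (product ps) M) ⟩
    64 ^ k * (product ps ^ 4 * M ^ 4)                      ≤⟨ *-monoʳ-≤ (64 ^ k) (*-monoʳ-≤ (product ps ^ 4) (^-monoʳ-≤ M {{>-nonZero M>0}} (m≤m+n 4 2))) ⟩
    64 ^ k * (product ps ^ 4 * M ^ 6)                      ≡⟨ eq₁ (64 ^ k) (product ps ^ 4) (M ^ 6) ⟩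
    M ^ 6 * (64 ^ k * product ps ^ 4)                      ≤⟨ *-monoʳ-≤ (M ^ 6) (product-size sv) ⟩
    M ^ 6 * (excess 5 10 ps * excess 7 4 ps * t ^ 6)       ≤⟨ *-monoʳ-≤ (M ^ 6) (*-monoˡ-≤ (t ^ 6) ex≤A) ⟩
    M ^ 6 * (A * t ^ 6)                                    ≡⟨ eq₂ (M ^ 6) A (t ^ 6) ⟩
    A * (M ^ 6 * t ^ 6)                                    ≤⟨ *-monoʳ-≤ A sixth ⟩
    A * (c ^ 6 * (64 ^ k * n ^ 3))                         ≡⟨ eq₃ A (c ^ 6) (64 ^ k) (n ^ 3) ⟩
    64 ^ k * (A * c ^ 6 * n ^ 3)                           ∎

-- Failure would force n ≤ 40 · 720⁶, which is below 10²⁰. Here 40 = 10 · 4 pays for the primes 5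
-- and 7, and 720 = 5 · 72 · 2 uses b + 2 ≤ 2 b.
totient-large : ∀ {ps M b} → PairwiseCoprime ps → All Sieving ps → 0 < M → 1 < b → b * b ≤ product ps * M →
  10 ^ 20 < product ps * M → 5 * (2 ^ length ps * (72 * suc (suc b))) < M * totient ps
totient-large {ps} {M} {b} pc sv M>0 b>1 b²≤n n-large = ≰⇒> λ small → <⇒≱ n-large
  (≤-trans (size-core {c = 720} sv M>0 b²≤n
      (*-mono-≤ (excess≤ {5} (s≤s (s≤s z≤n)) z<s pc) (excess≤ {7} (s≤s (s≤s z≤n)) z<s pc))
      (≤-trans small (≤-trans (*-monoʳ-≤ 5 (*-monoʳ-≤ s (*-monoʳ-≤ 72 b+2≤2b))) (≤-reflexive (eq s b)))))
    (≤ᵇ⇒≤ (40 * 720 ^ 6) (10 ^ 20) _))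
  where
  s : ℕ
  s = 2 ^ length ps
  b+2≤2b : suc (suc b) ≤ 2 * b
  b+2≤2b = ≤-trans (+-monoˡ-≤ b b>1) (≤-reflexive (cong (λ w → b + w) (sym (+-identityʳ b))))
  eq : ∀ s b → 5 * (s * (72 * (2 * b))) ≡ 720 * (s * b)
  eq s b = begin-equality
    5 * (s * (72 * (2 * b)))     ≡⟨ cong (λ w → 5 * (s * w)) (sym (*-assoc 72 2 b)) ⟩
    5 * (s * (144 * b))          ≡⟨ cong (5 *_) (x∙yz≈y∙xz s 144 b) ⟩
    5 * (144 * (s * b))          ≡⟨ sym (*-assoc 5 144 (s * b)) ⟩
    720 * (s * b)                ∎
    where
    open ≤-Reasoning
    x∙yz≈y∙xz : ∀ x y z → x * (y * z) ≡ y * (x * z)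
    x∙yz≈y∙xz = ℕ-Ring.solve-∀

-- Residues and small ratios

-- If c is the floor of 6x, then c / 6, c / 3 and c / 2 are the floors of x, 2x and 3x. This is the
-- expression of u by four sawtooth functions, whose linear parts cancel.
wave-floor : ∀ c → wave c ≡ + 1 ℤ.+ + c ℤ.+ (+ 6 ℤ.* + (c / 6) ℤ.- + 3 ℤ.* + (c / 3)) ℤ.- + 2 ℤ.* + (c / 2)
wave-floor 0 = refl
wave-floor 1 = refl
wave-floor 2 = refl
wave-floor 3 = refl
wave-floor 4 = refl
wave-floor 5 = refl
wave-floor (suc (suc (suc (suc (suc (suc c)))))) = begin
  wave c
    ≡⟨ wave-floor c ⟩
  + 1 ℤ.+ + c ℤ.+ (+ 6 ℤ.* + (c / 6) ℤ.- + 3 ℤ.* + (c / 3)) ℤ.- + 2 ℤ.* + (c / 2)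
    ≡⟨ eq (+ c) (+ (c / 6)) (+ (c / 3)) (+ (c / 2)) ⟩
  + 1 ℤ.+ (+ 6 ℤ.+ + c) ℤ.+ (+ 6 ℤ.* (+ 1 ℤ.+ + (c / 6)) ℤ.- + 3 ℤ.* (+ 2 ℤ.+ + (c / 3))) ℤ.- + 2 ℤ.* (+ 3 ℤ.+ + (c / 2))
    ≡⟨ sym (cong₂ (λ p q → + 1 ℤ.+ + (6 + c) ℤ.+ p ℤ.- + 2 ℤ.* + q)
         (cong₂ (λ p q → + 6 ℤ.* + p ℤ.- + 3 ℤ.* + q) (+-distrib-/-∣ˡ c {6} (divides 1 refl)) (+-distrib-/-∣ˡ c {3} (divides 2 refl)))
         (+-distrib-/-∣ˡ c {2} (divides 3 refl))) ⟩
  + 1 ℤ.+ + (6 + c) ℤ.+ (+ 6 ℤ.* + ((6 + c) / 6) ℤ.- + 3 ℤ.* + ((6 + c) / 3)) ℤ.- + 2 ℤ.* + ((6 + c) / 2) ∎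
  where
  open ≡-Reasoning
  eq : ∀ c p q r → + 1 ℤ.+ c ℤ.+ (+ 6 ℤ.* p ℤ.- + 3 ℤ.* q) ℤ.- + 2 ℤ.* r
    ≡ + 1 ℤ.+ (+ 6 ℤ.+ c) ℤ.+ (+ 6 ℤ.* (+ 1 ℤ.+ p) ℤ.- + 3 ℤ.* (+ 2 ℤ.+ q)) ℤ.- + 2 ℤ.* (+ 3 ℤ.+ r)
  eq = ℤ-Ring.solve-∀

+% : ∀ m n .{{_ : NonZero n}} → + (m % n) ≡ + m ℤ.- + (m / n) ℤ.* + n
+% m n = begin
  + (m % n)                                                  ≡⟨ eq (+ (m % n)) (+ (m / n) ℤ.* + n) ⟩
  + (m % n) ℤ.+ + (m / n) ℤ.* + n ℤ.- + (m / n) ℤ.* + n      ≡⟨ cong (λ w → + (m % n) ℤ.+ w ℤ.- + (m / n) ℤ.* + n) (sym (ℤₚ.pos-* (m / n) n)) ⟩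
  + (m % n + m / n * n) ℤ.- + (m / n) ℤ.* + n                ≡⟨ cong (λ w → + w ℤ.- + (m / n) ℤ.* + n) (sym (m≡m%n+[m/n]*n m n)) ⟩
  + m ℤ.- + (m / n) ℤ.* + n                                  ∎
  where
  open ≡-Reasoning
  eq : ∀ a b → a ≡ a ℤ.+ b ℤ.- b
  eq = ℤ-Ring.solve-∀

wave-residues : ℕ → ℕ → ℕ → ℕ → ℕ → ℤ
wave-residues n a b c d = + n ℤ.- + 6 ℤ.* + a ℤ.+ + 3 ℤ.* + b ℤ.+ + 2 ℤ.* + c ℤ.- + d

-- The bridge from the index to the correlations: u is expressed by the residues of z, 2z, 3z and
-- 6z, the quantities that the index adds up.
u-residues : ∀ n .{{_ : NonZero n}} z →
  + n ℤ.* u n z ≡ wave-residues n (z % n) ((2 * z) % n) ((3 * z) % n) ((6 * z) % n)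
u-residues n@(suc _) z = begin
  + n ℤ.* wave C
    ≡⟨ cong (+ n ℤ.*_) (wave-floor C) ⟩
  + n ℤ.* (+ 1 ℤ.+ + C ℤ.+ (+ 6 ℤ.* + (C / 6) ℤ.- + 3 ℤ.* + (C / 3)) ℤ.- + 2 ℤ.* + (C / 2))
    ≡⟨ eq (+ n) (+ z) (+ C) (+ (C / 6)) (+ (C / 3)) (+ (C / 2)) ⟩
  + n ℤ.- + 6 ℤ.* (+ 1 ℤ.* + z ℤ.- + (C / 6) ℤ.* + n) ℤ.+ + 3 ℤ.* (+ 2 ℤ.* + z ℤ.- + (C / 3) ℤ.* + n)
      ℤ.+ + 2 ℤ.* (+ 3 ℤ.* + z ℤ.- + (C / 2) ℤ.* + n) ℤ.- (+ 6 ℤ.* + z ℤ.- + C ℤ.* + n)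
    ≡⟨ cong₂ (λ p q → + n ℤ.- + 6 ℤ.* p ℤ.+ + 3 ℤ.* q ℤ.+ + 2 ℤ.* (+ 3 ℤ.* + z ℤ.- + (C / 2) ℤ.* + n) ℤ.- (+ 6 ℤ.* + z ℤ.- + C ℤ.* + n))
         (sym (residue 1 6 refl)) (sym (residue 2 3 refl)) ⟩
  + n ℤ.- + 6 ℤ.* + ((1 * z) % n) ℤ.+ + 3 ℤ.* + ((2 * z) % n)
      ℤ.+ + 2 ℤ.* (+ 3 ℤ.* + z ℤ.- + (C / 2) ℤ.* + n) ℤ.- (+ 6 ℤ.* + z ℤ.- + C ℤ.* + n)
    ≡⟨ cong₂ (λ p q → + n ℤ.- + 6 ℤ.* + ((1 * z) % n) ℤ.+ + 3 ℤ.* + ((2 * z) % n) ℤ.+ + 2 ℤ.* p ℤ.- q)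
         (sym (residue 3 2 refl)) (sym (trans (+% (6 * z) n) (cong (ℤ._- + C ℤ.* + n) (ℤₚ.pos-* 6 z)))) ⟩
  wave-residues n ((1 * z) % n) ((2 * z) % n) ((3 * z) % n) ((6 * z) % n)
    ≡⟨ cong (λ w → wave-residues n (w % n) ((2 * z) % n) ((3 * z) % n) ((6 * z) % n)) (*-identityˡ z) ⟩
  wave-residues n (z % n) ((2 * z) % n) ((3 * z) % n) ((6 * z) % n) ∎
  where
  open ≡-Reasoning
  C : ℕ
  C = (6 * z) / n
  eq : ∀ n z C p q r → n ℤ.* (+ 1 ℤ.+ C ℤ.+ (+ 6 ℤ.* p ℤ.- + 3 ℤ.* q) ℤ.- + 2 ℤ.* r)
    ≡ n ℤ.- + 6 ℤ.* (+ 1 ℤ.* z ℤ.- p ℤ.* n) ℤ.+ + 3 ℤ.* (+ 2 ℤ.* z ℤ.- q ℤ.* n) ℤ.+ + 2 ℤ.* (+ 3 ℤ.* z ℤ.- r ℤ.* n) ℤ.- (+ 6 ℤ.* z ℤ.- C ℤ.* n)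
  eq = ℤ-Ring.solve-∀
  quotient-floor : ∀ j k .{{_ : NonZero k}} → k * j ≡ 6 → (j * z) / n ≡ C / k
  quotient-floor j k@(suc _) kj = begin
    (j * z) ÷ n                ≡⟨ sym (÷-cancel k (j * z) n z<s) ⟩
    (k * (j * z)) ÷ (k * n)    ≡⟨ cong₂ _÷_ (trans (sym (*-assoc k j z)) (cong (_* z) kj)) (*-comm k n) ⟩
    (6 * z) ÷ (n * k)          ≡⟨ sym (÷-÷ (6 * z) n k) ⟩
    C / k                      ∎
  residue : ∀ j k .{{_ : NonZero k}} → k * j ≡ 6 → + ((j * z) % n) ≡ + j ℤ.* + z ℤ.- + (C / k) ℤ.* + n
  residue j k kj = trans (+% (j * z) n) (cong₂ (λ v w → v ℤ.- + w ℤ.* + n) (ℤₚ.pos-* j z) (quotient-floor j k kj))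

%-neg : ∀ n .{{_ : NonZero n}} z → ¬ n ∣ z → ((n ∸ 1) * z) % n + z % n ≡ n
%-neg n@(suc n-1) z n∤z = begin
  (n-1 * z) % n + z % n     ≡⟨ cong (_+ z % n) rem ⟩
  (n ∸ z % n) + z % n       ≡⟨ m∸n+n≡m (<⇒≤ (m%n<n z n)) ⟩
  n                         ∎
  where
  open ≡-Reasoning
  ρ q : ℕ
  ρ = z % n
  q = z / n
  ρ>0 : 0 < ρ
  ρ>0 = n≢0⇒n>0 λ ρ≡0 → n∤z (m%n≡0⇒n∣m z n ρ≡0)
  rem : (n-1 * z) % n ≡ n ∸ ρ
  rem = begin
    (n-1 * z) % n                            ≡⟨ sym ([m+kn]%n≡m%n (n-1 * z) (suc q) n) ⟩
    (n-1 * z + suc q * n) % n                ≡⟨ cong (_% n) (+-cancelʳ-≡ ρ _ _ (begin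
       n-1 * z + suc q * n + ρ               ≡⟨ eq₁ (n-1 * z) n q ρ ⟩
       n-1 * z + (ρ + q * n) + n             ≡⟨ cong (λ w → n-1 * z + w + n) (sym (m≡m%n+[m/n]*n z n)) ⟩
       n-1 * z + z + n                       ≡⟨ cong (_+ n) (trans (+-comm (n-1 * z) z) (*-comm n z)) ⟩
       z * n + n                             ≡⟨ +-comm (z * n) n ⟩
       n + z * n                             ≡⟨ cong (_+ z * n) (sym (m∸n+n≡m (<⇒≤ (m%n<n z n)))) ⟩
       n ∸ ρ + ρ + z * n                     ≡⟨ eq₂ (n ∸ ρ) ρ (z * n) ⟩
       n ∸ ρ + z * n + ρ                     ∎)) ⟩
    (n ∸ ρ + z * n) % n                      ≡⟨ [m+kn]%n≡m%n (n ∸ ρ) z n ⟩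
    (n ∸ ρ) % n                              ≡⟨ m<n⇒m%n≡m (∸-monoʳ-< ρ>0 (<⇒≤ (m%n<n z n))) ⟩
    n ∸ ρ                                    ∎
    where
    eq₁ : ∀ a n q r → a + suc q * n + r ≡ a + (r + q * n) + n
    eq₁ = ℕ-Ring.solve-∀
    eq₂ : ∀ a b c → a + b + c ≡ a + c + b
    eq₂ = ℕ-Ring.solve-∀

-- The step function takes its right-hand value at the multiples of 1/6, so oddness can fail there;
-- `¬ n ∣ 6 * z` keeps z / n away from these jumps. Negation is multiplication by `n ∸ 1`, to stay
-- in the natural numbers.
u-neg : ∀ n .{{_ : NonZero n}} z → ¬ n ∣ 6 * z → u n ((n ∸ 1) * z) ≡ ℤ.- u n z
u-neg n@(suc n-1) z n∤6z = ℤₚ.*-cancelˡ-≡ (+ n) _ _ (begin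
  + n ℤ.* u n (n-1 * z)                                                                             ≡⟨ u-residues n (n-1 * z) ⟩
  wave-residues n (R (n-1 * z)) (R (2 * (n-1 * z))) (R (3 * (n-1 * z))) (R (6 * (n-1 * z)))         ≡⟨ eq (+ n) _ _ _ _ (+ R z) (+ R (2 * z)) (+ R (3 * z)) (+ R (6 * z))
                                                                                                        (flip z n∤z) (neg 2 (∤ {2} 3 refl)) (neg 3 (∤ {3} 2 refl)) (neg 6 n∤6z) ⟩
  ℤ.- wave-residues n (R z) (R (2 * z)) (R (3 * z)) (R (6 * z))                                     ≡⟨ cong ℤ.-_ (sym (u-residues n z)) ⟩
  ℤ.- (+ n ℤ.* u n z)                                                                               ≡⟨ ℤₚ.neg-distribʳ-* (+ n) (u n z) ⟩
  + n ℤ.* ℤ.- u n z                                                                                 ∎)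
  where
  open ≡-Reasoning
  R : ℕ → ℕ
  R w = w % n
  ∤ : ∀ {j} k → k * j ≡ 6 → ¬ n ∣ j * z
  ∤ {j} k kj d = n∤6z (subst (n ∣_) (trans (sym (*-assoc k j z)) (cong (_* z) kj)) (∣n⇒∣m*n k d))
  n∤z : ¬ n ∣ z
  n∤z d = n∤6z (∣n⇒∣m*n 6 d)
  flip : ∀ w → ¬ n ∣ w → + R (n-1 * w) ≡ + n ℤ.- + R w
  flip w n∤w = trans (e (+ R (n-1 * w)) (+ R w)) (cong (λ v → + v ℤ.- + R w) (%-neg n w n∤w))
    where
    e : ∀ a b → a ≡ a ℤ.+ b ℤ.- b
    e = ℤ-Ring.solve-∀
  neg : ∀ j → ¬ n ∣ j * z → + R (j * (n-1 * z)) ≡ + n ℤ.- + R (j * z)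
  neg j d = trans (cong (λ w → + R w) (e j n-1 z)) (flip (j * z) d)
    where
    e : ∀ j m z → j * (m * z) ≡ m * (j * z)
    e = ℕ-Ring.solve-∀
  eq : ∀ n a b c d a′ b′ c′ d′ → a ≡ n ℤ.- a′ → b ≡ n ℤ.- b′ → c ≡ n ℤ.- c′ → d ≡ n ℤ.- d′ →
    n ℤ.- + 6 ℤ.* a ℤ.+ + 3 ℤ.* b ℤ.+ + 2 ℤ.* c ℤ.- d ≡ ℤ.- (n ℤ.- + 6 ℤ.* a′ ℤ.+ + 3 ℤ.* b′ ℤ.+ + 2 ℤ.* c′ ℤ.- d′)
  eq n a b c d a′ b′ c′ d′ refl refl refl refl = e n a′ b′ c′ d′
    where
    e : ∀ n a b c d → n ℤ.- + 6 ℤ.* (n ℤ.- a) ℤ.+ + 3 ℤ.* (n ℤ.- b) ℤ.+ + 2 ℤ.* (n ℤ.- c) ℤ.- (n ℤ.- d) ≡ ℤ.- (n ℤ.- + 6 ℤ.* a ℤ.+ + 3 ℤ.* b ℤ.+ + 2 ℤ.* c ℤ.- d)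
    e = ℤ-Ring.solve-∀

-- Small ratios from the pigeonhole principle

square-root : ∀ n → ∃ λ b → b * b ≤ n × n < suc b * suc b
square-root zero    = 0 , z≤n , z<s
square-root (suc n) with square-root n
... | b , lo , hi with suc b * suc b ≤? suc n
...   | yes p = suc b , p , ≤-<-trans hi (*-mono-< (n<1+n (suc b)) (n<1+n (suc b)))
...   | no ¬p = b , m≤n⇒m≤1+n lo , ≰⇒> ¬p

-- Coprimality is asked of `l` and `y`, not of `x` and `y`, because `x` and `y` may share primes
-- with `n`. A common divisor of `l` and `y` also divides `x`, so it can be cancelled without
-- touching `n`.
record Ratio (n B a : ℕ) : Set where
  constructor ratio
  field
    {x y l} : ℕ
    x>0 : 0 < x
    y>0 : 0 < y
    x≤B : x ≤ B
    y≤B : y ≤ B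
    relation : y * a ≡ x + l * n
    coprime : Coprime l y

reduce-ratio : ∀ {n B a x y l} → 0 < x → 0 < y → x ≤ B → y ≤ B → y * a ≡ x + l * n → Ratio n B a
reduce-ratio {n} {B} {a} {x} {y} {l} x>0 y>0 x≤B y≤B rel =
  ratio (part>0 x′ x≡ x>0) (part>0 (y / d) y≡ y>0) (≤-trans (part≤ x′ x≡) x≤B) (≤-trans (part≤ (y / d) y≡) y≤B)
    (*-cancelʳ-≡ (y / d * a) (x′ + l / d * n) d (begin
      y / d * a * d                ≡⟨ eq₁ (y / d) a d ⟩
      y / d * d * a                ≡⟨ cong (_* a) (sym y≡) ⟩
      y * a                        ≡⟨ rel ⟩
      x + l * n                    ≡⟨ cong₂ (λ v w → v + w * n) x≡ l≡ ⟩
      x′ * d + l / d * d * n       ≡⟨ eq₂ x′ d (l / d) n ⟩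
      (x′ + l / d * n) * d         ∎))
    (Cop.coprime-/gcd l y)
  where
  open ≡-Reasoning
  d : ℕ
  d = gcd l y
  instance
    d≢0 : NonZero d
    d≢0 = ≢-nonZero (gcd[m,n]≢0 l y (inj₂ (>⇒≢ y>0)))
  y≡ : y ≡ y / d * d
  y≡ = sym (m/n*n≡m (gcd[m,n]∣n l y))
  l≡ : l ≡ l / d * d
  l≡ = sym (m/n*n≡m (gcd[m,n]∣m l y))
  d∣x : d ∣ x
  d∣x = ∣m+n∣m⇒∣n (subst (d ∣_) (trans rel (+-comm x (l * n))) (∣m⇒∣m*n a (gcd[m,n]∣n l y))) (∣m⇒∣m*n n (gcd[m,n]∣m l y))
  x′ : ℕ
  x′ = quotient d∣x
  x≡ : x ≡ x′ * d
  x≡ = m∣n⇒n≡quotient*m d∣x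
  part>0 : ∀ {w} k → w ≡ k * d → 0 < w → 0 < k
  part>0 zero    refl ()
  part>0 (suc k) _ _ = z<s
  part≤ : ∀ {w} k → w ≡ k * d → k ≤ w
  part≤ k w≡ = ≤-trans (m≤m*n k d) (≤-reflexive (sym w≡))
  eq₁ : ∀ y a d → y * a * d ≡ y * d * a
  eq₁ = ℕ-Ring.solve-∀
  eq₂ : ∀ x d l n → x * d + l * d * n ≡ (x + l * n) * d
  eq₂ = ℕ-Ring.solve-∀

-- As n < B², the residues of the B + 1 multiples i a with i ≤ B fall into B buckets of width B. Two
-- in one bucket differ by at most B, and the sign of the difference decides between a and -a.
thue : ∀ {n B a} → Coprime n a → n < B * B → B < n → Ratio n B a ⊎ Ratio n B ((n ∸ 1) * a)
thue {n@(suc n-1)} {B@(suc _)} {a} cop n<B² B<n with pigeonhole (n<1+n B) bucket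
  where
  bucket : Fin (suc B) → Fin B
  bucket i = fromℕ< (m<n*o⇒m/o<n {(toℕ i * a) % n} {B} {B} (<-trans (m%n<n (toℕ i * a) n) n<B²))
... | i , j , i<j , same = by-order (≤-total ρ σ)
  where
  I J y ρ σ : ℕ
  I = toℕ i
  J = toℕ j
  y = J ∸ I
  ρ = (I * a) % n
  σ = (J * a) % n
  y>0 : 0 < y
  y>0 = m<n⇒0<n∸m i<j
  y≤B : y ≤ B
  y≤B = ≤-trans (m∸n≤m J I) (≤-pred (toℕ<n j))
  L : ℕ
  L = (J * a) / n ∸ (I * a) / n
  L≡ : (I * a) / n + L ≡ (J * a) / n
  L≡ = m+[n∸m]≡n (/-monoˡ-≤ n (*-monoˡ-≤ a (<⇒≤ i<j)))
  same-bucket : ρ / B ≡ σ / B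
  same-bucket = trans (sym (toℕ-fromℕ< _)) (trans (cong toℕ same) (toℕ-fromℕ< _))
  balance : y * a + ρ ≡ σ + L * n
  balance = +-cancelʳ-≡ ((I * a) / n * n) (y * a + ρ) (σ + L * n) (begin
    y * a + ρ + (I * a) / n * n            ≡⟨ +-assoc (y * a) ρ _ ⟩
    y * a + (ρ + (I * a) / n * n)          ≡⟨ cong (λ w → y * a + w) (sym (m≡m%n+[m/n]*n (I * a) n)) ⟩
    y * a + I * a                          ≡⟨ sym (*-distribʳ-+ a y I) ⟩
    (y + I) * a                            ≡⟨ cong (_* a) (m∸n+n≡m (<⇒≤ i<j)) ⟩
    J * a                                  ≡⟨ m≡m%n+[m/n]*n (J * a) n ⟩
    σ + (J * a) / n * n                    ≡⟨ cong (λ w → σ + w * n) (sym L≡) ⟩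
    σ + ((I * a) / n + L) * n              ≡⟨ eq σ ((I * a) / n) L n ⟩
    σ + L * n + (I * a) / n * n            ∎)
    where
    open ≡-Reasoning
    eq : ∀ s q l n → s + (q + l) * n ≡ s + l * n + q * n
    eq = ℕ-Ring.solve-∀
  close : ∀ {v w} → v / B ≡ w / B → w ∸ v ≤ B
  close {v} {w} e = m≤n+o⇒m∸n≤o w v (begin
    w                       ≡⟨ m≡m%n+[m/n]*n w B ⟩
    w % B + w / B * B       ≤⟨ +-mono-≤ (m%n≤n w B) (≤-trans (≤-reflexive (cong (_* B) (sym e))) (m/n*n≤m v B)) ⟩
    B + v                   ≡⟨ +-comm B v ⟩
    v + B                   ∎)
    where open ≤-Reasoning
  n∤ya : ¬ n ∣ y * a
  n∤ya d = <⇒≱ (≤-<-trans y≤B B<n) (∣⇒≤ {{>-nonZero y>0}} (Cop.coprime-divisor cop (subst (n ∣_) (*-comm y a) d)))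
  by-order : ρ ≤ σ ⊎ σ ≤ ρ → Ratio n B a ⊎ Ratio n B ((n ∸ 1) * a)
  by-order (inj₁ ρ≤σ) = inj₁ (reduce-ratio {l = L} x>0 y>0 (close {ρ} {σ} same-bucket) y≤B rel)
    where
    rel : y * a ≡ (σ ∸ ρ) + L * n
    rel = +-cancelʳ-≡ ρ (y * a) ((σ ∸ ρ) + L * n) (begin
      y * a + ρ                 ≡⟨ balance ⟩
      σ + L * n                 ≡⟨ cong (_+ L * n) (sym (m∸n+n≡m ρ≤σ)) ⟩
      (σ ∸ ρ) + ρ + L * n       ≡⟨ eq (σ ∸ ρ) ρ (L * n) ⟩
      (σ ∸ ρ) + L * n + ρ       ∎)
      where
      open ≡-Reasoning
      eq : ∀ a b c → a + b + c ≡ a + c + b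
      eq = ℕ-Ring.solve-∀
    x>0 : 0 < σ ∸ ρ
    x>0 = n≢0⇒n>0 λ x≡0 → n∤ya (divides L (trans rel (cong (_+ L * n) x≡0)))
  -- Now y a + x = L n, hence y (n - 1) a = y a n - y a = x + (y a - L) n.
  by-order (inj₂ σ≤ρ) = inj₂ (reduce-ratio {l = y * a ∸ L} x>0 y>0 x≤B y≤B rel)
    where
    open ≡-Reasoning
    x : ℕ
    x = ρ ∸ σ
    x≤B : x ≤ B
    x≤B = close {σ} {ρ} (sym same-bucket)
    sum : y * a + x ≡ L * n
    sum = +-cancelʳ-≡ σ (y * a + x) (L * n) (begin
      y * a + x + σ       ≡⟨ +-assoc (y * a) x σ ⟩
      y * a + (x + σ)     ≡⟨ cong (λ w → y * a + w) (m∸n+n≡m σ≤ρ) ⟩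
      y * a + ρ           ≡⟨ balance ⟩
      σ + L * n           ≡⟨ +-comm σ (L * n) ⟩
      L * n + σ           ∎)
    x>0 : 0 < x
    x>0 = n≢0⇒n>0 λ x≡0 → n∤ya (divides L (trans (sym (trans (cong (λ w → y * a + w) x≡0) (+-identityʳ (y * a)))) sum))
    L≤ya : L ≤ y * a
    L≤ya = ≮⇒≥ λ ya<L → <⇒≱ (≤-<-trans x≤B B<n) (+-cancelˡ-≤ (y * a) n x
      (≤-trans (≤-trans (+-monoˡ-≤ n (m≤m*n (y * a) n)) (≤-reflexive (+-comm (y * a * n) n)))
        (≤-trans (*-monoˡ-≤ n ya<L) (≤-reflexive (sym sum)))))
    rel : y * (n-1 * a) ≡ x + (y * a ∸ L) * n
    rel = +-cancelʳ-≡ (y * a + L * n) (y * (n-1 * a)) (x + (y * a ∸ L) * n) (begin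
      y * (n-1 * a) + (y * a + L * n)              ≡⟨ eq₁ y n-1 a (L * n) ⟩
      y * a * n + L * n                            ≡⟨ cong₂ (λ v w → v * n + w) (sym (m∸n+n≡m L≤ya)) (sym sum) ⟩
      (y * a ∸ L + L) * n + (y * a + x)            ≡⟨ eq₂ (y * a ∸ L) L n (y * a) x ⟩
      x + (y * a ∸ L) * n + (y * a + L * n)        ∎)
      where
      eq₁ : ∀ y m a k → y * (m * a) + (y * a + k) ≡ y * a * suc m + k
      eq₁ = ℕ-Ring.solve-∀
      eq₂ : ∀ d L n v x → (d + L) * n + (v + x) ≡ x + d * n + (v + L * n)
      eq₂ = ℕ-Ring.solve-∀

-- Correlations over the units

-- `upTo (suc n)` ends with n, so a prime n is listed as well.
sifting-primes : ℕ → List ℕ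
sifting-primes n = filter (λ r → prime? r ×-dec r ∣? n) (upTo (suc n))

sifting-primes-all : ∀ n → All (λ r → Prime r × r ∣ n) (sifting-primes n)
sifting-primes-all n = Allₚ.all-filter (λ r → prime? r ×-dec r ∣? n) (upTo (suc n))

distinct-primes : ∀ {ps} → Unique ps → All Prime ps → PairwiseCoprime ps
distinct-primes [] [] = []
distinct-primes {r ∷ ps} (ne ∷ nes) (pr ∷ prs) = All.zipWith coprime (ne , prs) ∷ distinct-primes nes prs
  where
  coprime : ∀ {p} → r ≢ p × Prime p → Coprime p r
  coprime {p} (r≢p , pp) = prime-coprime pp λ p∣r → case prime⇒irreducible pr p∣r of λ
    { (inj₁ refl) → ¬prime[1] pp
    ; (inj₂ refl) → r≢p refl }

sifting-primes-coprime : ∀ n → PairwiseCoprime (sifting-primes n)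
sifting-primes-coprime n = distinct-primes
  (filter⁺ (λ r → prime? r ×-dec r ∣? n) (upTo⁺ (suc n)))
  (All.map proj₁ (sifting-primes-all n))

unit6-one : ∀ c → ¬ 2 ∣ c → ¬ 3 ∣ c → unit6 c ≡ + 1
unit6-one 0 h₂ h₃ = contradiction (2 ∣0) h₂
unit6-one 1 h₂ h₃ = refl
unit6-one 2 h₂ h₃ = contradiction ∣-refl h₂
unit6-one 3 h₂ h₃ = contradiction ∣-refl h₃
unit6-one 4 h₂ h₃ = contradiction (divides 2 refl) h₂
unit6-one 5 h₂ h₃ = refl
unit6-one (suc (suc (suc (suc (suc (suc c)))))) h₂ h₃ =
  unit6-one c (λ d → h₂ (∣m∣n⇒∣m+n {m = 6} (divides 3 refl) d)) (λ d → h₃ (∣m∣n⇒∣m+n {m = 6} (divides 2 refl) d))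

sifting-primes-sieving : ∀ {n} → Coprime n 6 → All Sieving (sifting-primes n)
sifting-primes-sieving {n} cop = All.map (λ {r} (pr , r∣n) → pr , unit6-one r
  (λ d → case cop (∣-trans d r∣n , divides 3 refl) of λ ())
  (λ d → case cop (∣-trans d r∣n , divides 2 refl) of λ ())) (sifting-primes-all n)

χ-cases : ∀ ps g → χ ps g ≡ + 0 ⊎ All (λ p → ¬ p ∣ g) ps
χ-cases [] g = inj₂ []
χ-cases (r ∷ ps) g = by-cases (r ∣? g) (χ-cases ps g)
  where
  by-cases : Dec (r ∣ g) → χ ps g ≡ + 0 ⊎ All (λ p → ¬ p ∣ g) ps → χ (r ∷ ps) g ≡ + 0 ⊎ All (λ p → ¬ p ∣ g) (r ∷ ps)
  by-cases (yes d) _        = inj₁ (trans (cong (λ w → (+ 1 ℤ.- w) ℤ.* χ ps g) (if-yes (r ∣? g) d)) (ℤₚ.*-zeroˡ (χ ps g)))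
  by-cases (no _)  (inj₁ e) = inj₁ (trans (cong ((+ 1 ℤ.- hit r g) ℤ.*_) e) (ℤₚ.*-zeroʳ (+ 1 ℤ.- hit r g)))
  by-cases (no ¬d) (inj₂ h) = inj₂ (¬d ∷ h)

prime-divisor : ∀ d → 0 < d → d ≢ 1 → ∃ λ p → Prime p × p ∣ d
prime-divisor d@(suc _) _ d≢1 with factorise d
... | record { factors = [] ; isFactorisation = eq } = contradiction eq d≢1
... | record { factors = p ∷ ps ; isFactorisation = eq ; factorsPrime = pr ∷ _ } =
  p , pr , subst (p ∣_) (sym eq) (m∣m*n (product ps))

unsifted-coprime : ∀ {n g} → 0 < n → All (λ p → ¬ p ∣ g) (sifting-primes n) → Coprime g n
unsifted-coprime {n} {g} n>0 h = Cop.gcd≡1⇒coprime (case gcd g n ≟ 1 of λ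
  { (yes e) → e
  ; (no ¬e) → contradiction (prime-divisor (gcd g n) (n≢0⇒n>0 (gcd[m,n]≢0 g n (inj₂ (>⇒≢ n>0)))) ¬e) no-prime })
  where
  no-prime : ¬ ∃ λ p → Prime p × p ∣ gcd g n
  no-prime (p , pr , p∣d) = All.lookup h
    (∈-filter⁺ (λ r → prime? r ×-dec r ∣? n) (∈-upTo⁺ (s≤s (∣⇒≤ {{>-nonZero n>0}} p∣n))) (pr , p∣n))
    (∣-trans p∣d (gcd[m,n]∣m g n))
    where
    p∣n : p ∣ n
    p∣n = ∣-trans p∣d (gcd[m,n]∣n g n)

-- The weight vanishes off the units, so an identity known only at units can be used under the sum.
χ-support : ∀ {n} → 0 < n → ∀ {F G : ℕ → ℤ} → (∀ g → Coprime g n → F g ≡ G g) →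
  ∀ g → χ (sifting-primes n) g ℤ.* F g ≡ χ (sifting-primes n) g ℤ.* G g
χ-support {n} n>0 {F} {G} h g with χ-cases (sifting-primes n) g
... | inj₁ e = trans (cong (ℤ._* F g) e) (trans (ℤₚ.*-zeroˡ (F g)) (sym (trans (cong (ℤ._* G g) e) (ℤₚ.*-zeroˡ (G g)))))
... | inj₂ c = cong (χ (sifting-primes n) g ℤ.*_) (h g (unsifted-coprime n>0 c))

-‿≤-abs : ∀ {s K} → ∣ s ∣ ≤ K → ℤ.- + K ℤ.≤ s
-‿≤-abs {+ k}      {K}     _       = ℤₚ.neg-≤-pos
-‿≤-abs { -[1+ k ] } {suc K} (s≤s p) = ℤ.-≤- p

near-lower : ∀ {s d e} → Near s (+ d) e → + d ℤ.- + e ℤ.≤ s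
near-lower {s} {d} {e} (near p) = subst (+ d ℤ.- + e ℤ.≤_) (eq s (+ d)) (ℤₚ.+-monoʳ-≤ (+ d) (-‿≤-abs {s ℤ.- + d} p))
  where
  eq : ∀ s d → d ℤ.+ (s ℤ.- d) ≡ s
  eq = ℤ-Ring.solve-∀

-- Five times the sum is at least 5 (D - T) - 3 (D + 5 T) = 2 D - 20 T, which is positive.
no-cancellation : ∀ {D T} (s₁ s₂ s₃ s₄ : ℤ) → 10 * T < D → + D ℤ.- + T ℤ.≤ s₁ →
  ℤ.- + (D + 5 * T) ℤ.≤ + 5 ℤ.* s₂ → ℤ.- + (D + 5 * T) ℤ.≤ + 5 ℤ.* s₃ → ℤ.- + (D + 5 * T) ℤ.≤ + 5 ℤ.* s₄ →
  s₁ ℤ.+ (s₂ ℤ.+ (s₃ ℤ.+ s₄)) ≢ + 0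
no-cancellation {D} {T} s₁ s₂ s₃ s₄ D-large h₁ h₂ h₃ h₄ sum≡0 =
  <⇒≱ D-large (*-cancelˡ-≤ 2 (≤-trans (ℤₚ.drop‿+≤+ 2D≤20T) (≤-reflexive (*-assoc 2 10 T))))
  where
  open ℤₚ.≤-Reasoning
  eq₁ : ∀ D T → + 2 ℤ.* D ≡ + 20 ℤ.* T ℤ.+ (+ 5 ℤ.* (D ℤ.- T) ℤ.+ (ℤ.- (D ℤ.+ + 5 ℤ.* T) ℤ.+ (ℤ.- (D ℤ.+ + 5 ℤ.* T) ℤ.+ ℤ.- (D ℤ.+ + 5 ℤ.* T))))
  eq₁ = ℤ-Ring.solve-∀
  eq₂ : ∀ t a b c d → + 20 ℤ.* t ℤ.+ (+ 5 ℤ.* a ℤ.+ (+ 5 ℤ.* b ℤ.+ (+ 5 ℤ.* c ℤ.+ + 5 ℤ.* d))) ≡ + 20 ℤ.* t ℤ.+ + 5 ℤ.* (a ℤ.+ (b ℤ.+ (c ℤ.+ d)))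
  eq₂ = ℤ-Ring.solve-∀
  K : ℤ
  K = ℤ.- + (D + 5 * T)
  K≡ : K ≡ ℤ.- (+ D ℤ.+ + 5 ℤ.* + T)
  K≡ = cong (λ w → ℤ.- (+ D ℤ.+ w)) (ℤₚ.pos-* 5 T)
  2D≤20T : + (2 * D) ℤ.≤ + (20 * T)
  2D≤20T = begin
    + (2 * D)                                                                                    ≡⟨ trans (ℤₚ.pos-* 2 D) (eq₁ (+ D) (+ T)) ⟩
    + 20 ℤ.* + T ℤ.+ (+ 5 ℤ.* (+ D ℤ.- + T) ℤ.+ (K₀ ℤ.+ (K₀ ℤ.+ K₀)))                             ≡⟨ cong (λ k → + 20 ℤ.* + T ℤ.+ (+ 5 ℤ.* (+ D ℤ.- + T) ℤ.+ (k ℤ.+ (k ℤ.+ k)))) (sym K≡) ⟩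
    + 20 ℤ.* + T ℤ.+ (+ 5 ℤ.* (+ D ℤ.- + T) ℤ.+ (K ℤ.+ (K ℤ.+ K)))                                ≤⟨ ℤₚ.+-monoʳ-≤ (+ 20 ℤ.* + T) (ℤₚ.+-mono-≤ (ℤₚ.*-monoˡ-≤-nonNeg (+ 5) h₁) (ℤₚ.+-mono-≤ h₂ (ℤₚ.+-mono-≤ h₃ h₄))) ⟩
    + 20 ℤ.* + T ℤ.+ (+ 5 ℤ.* s₁ ℤ.+ (+ 5 ℤ.* s₂ ℤ.+ (+ 5 ℤ.* s₃ ℤ.+ + 5 ℤ.* s₄)))                ≡⟨ eq₂ (+ T) s₁ s₂ s₃ s₄ ⟩
    + 20 ℤ.* + T ℤ.+ + 5 ℤ.* (s₁ ℤ.+ (s₂ ℤ.+ (s₃ ℤ.+ s₄)))                                        ≡⟨ cong (λ w → + 20 ℤ.* + T ℤ.+ + 5 ℤ.* w) sum≡0 ⟩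
    + 20 ℤ.* + T ℤ.+ + 0                                                                         ≡⟨ ℤₚ.+-identityʳ (+ 20 ℤ.* + T) ⟩
    + 20 ℤ.* + T                                                                                 ≡⟨ sym (ℤₚ.pos-* 20 T) ⟩
    + (20 * T)                                                                                   ∎
    where
    K₀ : ℤ
    K₀ = ℤ.- (+ D ℤ.+ + 5 ℤ.* + T)

φ-one : ∀ {ps} → All Sieving ps → φ 1 ps ≡ + totient ps
φ-one [] = refl
φ-one {r ∷ ps} ((pr , _) ∷ sv) = begin
  φ 1 (r ∷ ps)                     ≡⟨ cong (ℤ._* φ 1 ps) (if-no (r ∣? 1) λ d → ¬prime[1] (subst Prime (∣1⇒≡1 d) pr)) ⟩
  (+ r ℤ.- + 1) ℤ.* φ 1 ps         ≡⟨ cong₂ ℤ._*_ (pred≡ r (prime>0 pr)) (φ-one sv) ⟩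
  + (r ∸ 1) ℤ.* + totient ps       ≡⟨ sym (ℤₚ.pos-* (r ∸ 1) (totient ps)) ⟩
  + ((r ∸ 1) * totient ps)         ∎
  where
  open ≡-Reasoning
  pred≡ : ∀ r → 0 < r → + r ℤ.- + 1 ≡ + (r ∸ 1)
  pred≡ (suc r) _ = refl

module Correlation (n : ℕ) .{{n≢0 : NonZero n}} (n-large : 10 ^ 20 < n) (n⊥6 : Coprime n 6) where

  ps : List ℕ
  ps = sifting-primes n

  M : ℕ
  M = quotient (product-∣ (sifting-primes-coprime n) (All.map proj₂ (sifting-primes-all n)))

  n≡ : n ≡ product ps * M
  n≡ = m∣n⇒n≡m*quotient (product-∣ (sifting-primes-coprime n) (All.map proj₂ (sifting-primes-all n)))

  n>0 : 0 < n
  n>0 = >-nonZero⁻¹ n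

  7<n : 7 < n
  7<n = <-trans (≤ᵇ⇒≤ 8 (10 ^ 20) _) n-large

  M>0 : 0 < M
  M>0 = n≢0⇒n>0 λ M≡0 → >⇒≢ n>0 (trans n≡ (trans (cong (product ps *_) M≡0) (*-zeroʳ (product ps))))

  sv : All Sieving ps
  sv = sifting-primes-sieving n⊥6

  b B : ℕ
  b = proj₁ (square-root n)
  B = suc b

  b²≤n : b * b ≤ n
  b²≤n = proj₁ (proj₂ (square-root n))

  n<B² : n < B * B
  n<B² = proj₂ (proj₂ (square-root n))

  b>1 : 1 < b
  b>1 = ≰⇒> λ b≤1 → <⇒≱ (<-trans (≤ᵇ⇒≤ 5 8 _) (<-≤-trans (s≤s 7<n) n<B²)) (*-mono-≤ (s≤s b≤1) (s≤s b≤1))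

  B<n : B < n
  B<n = <-≤-trans (s≤s (s≤s (m≤m+n b 0))) (≤-trans 2+b≤b² b²≤n)
    where
    2<b : 2 < b
    2<b = ≰⇒> λ b≤2 → <⇒≱ (<-≤-trans (s≤s (≤-trans (≤ᵇ⇒≤ 9 (10 ^ 20) _) (<⇒≤ n-large))) n<B²) (*-mono-≤ (s≤s b≤2) (s≤s b≤2))
    2+b≤b² : 2 + (b + 0) ≤ b * b
    2+b≤b² = ≤-trans (+-monoˡ-≤ (b + 0) (<⇒≤ 2<b)) (*-monoˡ-≤ b {2} {b} (<⇒≤ 2<b))

  ρ : ℕ → ℤ
  ρ a = sifted n ps a

  -- `D` is twice the Euler totient of n, the main term of `ρ 1`; `T` is the accumulated sieve
  -- error.
  D T : ℕ
  D = 2 * M * totient ps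
  T = 2 ^ length ps * (72 * suc B)

  10T<D : 10 * T < D
  10T<D = subst₂ _<_ (sym (*-assoc 2 5 T)) (sym (*-assoc 2 M (totient ps)))
    (*-monoʳ-< 2 (totient-large {b = b} (sifting-primes-coprime n) sv M>0 b>1
      (subst (b * b ≤_) n≡ b²≤n) (subst (10 ^ 20 <_) n≡ n-large)))

  u-cong : ∀ {z w} → z % n ≡ w % n → u n z ≡ u n w
  u-cong {z} {w} e = trans (sym (periodic-% (u-period n>0) z)) (trans (cong (u n) e) (periodic-% (u-period n>0) w))

  ρ-cong : ∀ {a c} → a % n ≡ c % n → ρ a ≡ ρ c
  ρ-cong {a} {c} e = ∑-cong n λ g → cong (λ w → χ ps g ℤ.* (u n g ℤ.* w)) (u-cong
    (trans (%-distribˡ-* a g n) (trans (cong (λ w → (w * (g % n)) % n) e) (sym (%-distribˡ-* c g n)))))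

  ∤6* : ∀ {z} → Coprime n z → ¬ n ∣ 6 * z
  ∤6* {z} c d = <⇒≱ (<-trans (≤ᵇ⇒≤ 7 7 _) 7<n) (∣⇒≤ (Cop.coprime-divisor c (subst (n ∣_) (*-comm 6 z) d)))

  ρ-neg : ∀ {a} → Coprime n a → ρ ((n ∸ 1) * a) ≡ ℤ.- ρ a
  ρ-neg {a} c = trans (∑-cong n step) (trans (∑-scale n -[1+ 0 ] (λ g → χ ps g ℤ.* (u n g ℤ.* u n (a * g)))) (ℤₚ.-1*i≡-i (ρ a)))
    where
    eq : ∀ x y z → x ℤ.* (y ℤ.* ℤ.- z) ≡ -[1+ 0 ] ℤ.* (x ℤ.* (y ℤ.* z))
    eq = ℤ-Ring.solve-∀
    step : ∀ g → χ ps g ℤ.* (u n g ℤ.* u n ((n ∸ 1) * a * g)) ≡ -[1+ 0 ] ℤ.* (χ ps g ℤ.* (u n g ℤ.* u n (a * g)))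
    step g = trans (χ-support n>0 {λ g → u n g ℤ.* u n ((n ∸ 1) * a * g)} {λ g → u n g ℤ.* ℤ.- u n (a * g)}
        (λ g g⊥n → cong (u n g ℤ.*_) (trans (cong (u n) (*-assoc (n ∸ 1) a g))
          (u-neg n (a * g) (∤6* (Cop.sym (coprime-* (Cop.sym c) g⊥n)))))) g)
      (eq (χ ps g) (u n g) (u n (a * g)))

  ρ-bound : ∀ {a} (r : Ratio n B a) → ¬ (Ratio.x r ≡ 1 × Ratio.y r ≡ 1) → 5 * ∣ ρ a ∣ ≤ D + 5 * T
  ρ-bound {a} (ratio {x} {y} {l} x>0 y>0 x≤B y≤B rel cop) ≢1 =
    subst (λ N → 5 * ∣ sifted N ps a ∣ ≤ D + 5 * T) (sym n≡)
      (sifted-bound (sifting-primes-coprime n) sv M>0 x>0 y>0 x≤B y≤B (subst (λ N → y * a ≡ x + l * N) n≡ rel) cop ≢1)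

  ρ-one : + D ℤ.- + T ℤ.≤ ρ 1
  ρ-one = near-lower (subst₂ (λ p q → Near p q T) lhs rhs
    (near-weaken (≤-reflexive (*-identityˡ T))
      (sifted-near {ps} {1} {B} (sifting-primes-coprime n) sv {M} {1} {1} {0} M>0 z<s z<s (s≤s z≤n) (s≤s z≤n) refl (λ (_ , d∣1) → ∣1⇒≡1 d∣1))))
    where
    lhs : + 1 ℤ.* sifted (product ps * M) ps 1 ≡ ρ 1
    lhs = trans (ℤₚ.*-identityˡ _) (cong (λ N → sifted N ps 1) (sym n≡))
    rhs : + 1 ℤ.* + 1 ℤ.* (+ (2 * M) ℤ.* φ 1 ps) ≡ + D
    rhs = trans (ℤₚ.*-identityˡ _) (trans (cong (+ (2 * M) ℤ.*_) (φ-one sv)) (sym (ℤₚ.pos-* (2 * M) (totient ps))))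

  -- Only a lower bound is possible: the ratio 1 / 1 for a means a ≡ 1, where ρ is large but
  -- positive. The ratio 1 / 1 for -a would mean a ≡ -1, which the hypothesis excludes.
  ρ-lower : ∀ {a} → Coprime n a → ¬ n ∣ 1 + a → ℤ.- + (D + 5 * T) ℤ.≤ + 5 ℤ.* ρ a
  ρ-lower {a} n⊥a n∤1+a with thue n⊥a n<B² B<n
  ... | inj₁ r = by-cases (Ratio.x r ≟ 1 ×-dec Ratio.y r ≟ 1)
    where
    by-cases : Dec (Ratio.x r ≡ 1 × Ratio.y r ≡ 1) → ℤ.- + (D + 5 * T) ℤ.≤ + 5 ℤ.* ρ a
    by-cases (no ≢1) = -‿≤-abs (≤-trans (≤-reflexive (ℤₚ.abs-* (+ 5) (ρ a))) (ρ-bound r ≢1))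
    by-cases (yes (x≡1 , y≡1)) = subst (λ w → ℤ.- + (D + 5 * T) ℤ.≤ + 5 ℤ.* w) (ρ-cong {1} {a} (sym a≡1)) (begin
      ℤ.- + (D + 5 * T)            ≤⟨ ℤₚ.neg-≤-pos ⟩
      + (5 * (D ∸ T))              ≡⟨ ℤₚ.pos-* 5 (D ∸ T) ⟩
      + 5 ℤ.* + (D ∸ T)            ≡⟨ cong (+ 5 ℤ.*_) (trans (sym (ℤₚ.⊖-≥ T≤D)) (sym (ℤₚ.m-n≡m⊖n D T))) ⟩
      + 5 ℤ.* (+ D ℤ.- + T)        ≤⟨ ℤₚ.*-monoˡ-≤-nonNeg (+ 5) ρ-one ⟩
      + 5 ℤ.* ρ 1                  ∎)
      where
      open ℤₚ.≤-Reasoning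
      T≤D : T ≤ D
      T≤D = <⇒≤ (≤-<-trans (m≤m+n T (9 * T)) 10T<D)
      a≡1 : a % n ≡ 1 % n
      a≡1 = trans (cong (_% n) (trans (sym (*-identityˡ a)) (trans (cong (_* a) (sym y≡1)) (trans (Ratio.relation r) (cong (_+ Ratio.l r * n) x≡1)))))
        ([m+kn]%n≡m%n 1 (Ratio.l r) n)
  ... | inj₂ r = -‿≤-abs (≤-trans (≤-reflexive (trans (ℤₚ.abs-* (+ 5) (ρ a))
      (cong (5 *_) (trans (sym (ℤₚ.∣-i∣≡∣i∣ (ρ a))) (cong ∣_∣ (sym (ρ-neg n⊥a))))))) (ρ-bound r ≢1))
    where
    ≢1 : ¬ (Ratio.x r ≡ 1 × Ratio.y r ≡ 1)
    ≢1 (x≡1 , y≡1) = n∤1+a (∣m+n∣m⇒∣n {m = Ratio.l r * n} (divides a (begin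
      Ratio.l r * n + (1 + a)                ≡⟨ eq (Ratio.l r * n) a ⟩
      1 + Ratio.l r * n + a                  ≡⟨ cong (λ w → w + Ratio.l r * n + a) (sym x≡1) ⟩
      Ratio.x r + Ratio.l r * n + a          ≡⟨ cong (_+ a) (sym (Ratio.relation r)) ⟩
      Ratio.y r * ((n ∸ 1) * a) + a          ≡⟨ cong (λ w → w * ((n ∸ 1) * a) + a) y≡1 ⟩
      1 * ((n ∸ 1) * a) + a                  ≡⟨ eq₂ (n ∸ 1) a ⟩
      a * (n ∸ 1 + 1)                        ≡⟨ cong (a *_) (m∸n+n≡m n>0) ⟩
      a * n                                  ∎)) (n∣m*n (Ratio.l r)))
      where
      open ≡-Reasoning
      eq : ∀ q a → q + (1 + a) ≡ 1 + q + a
      eq = ℕ-Ring.solve-∀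
      eq₂ : ∀ m a → 1 * (m * a) + a ≡ a * (m + 1)
      eq₂ = ℕ-Ring.solve-∀

  -- With k the inverse of a₁, the vanishing sum is taken at the unit g k, weighted by `χ ps g`
  -- times u(g) and summed over g. This gives a relation between the ρ (k a_j) in which k a₁ ≡ 1.
  unbalanced : ∀ {a₁ a₂ a₃ a₄} → Coprime n a₁ → Coprime n a₂ → Coprime n a₃ → Coprime n a₄ →
    ¬ n ∣ a₁ + a₂ → ¬ n ∣ a₁ + a₃ → ¬ n ∣ a₁ + a₄ →
    ¬ (∀ g → Coprime g n → u n (g * a₁) ℤ.+ (u n (g * a₂) ℤ.+ (u n (g * a₃) ℤ.+ u n (g * a₄))) ≡ + 0)
  unbalanced {a₁} {a₂} {a₃} {a₄} c₁ c₂ c₃ c₄ h₂ h₃ h₄ balanced =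
    no-cancellation {D} {T} (ρ (k * a₁)) (ρ (k * a₂)) (ρ (k * a₃)) (ρ (k * a₄)) 10T<D
      (subst (+ D ℤ.- + T ℤ.≤_) (ρ-cong (sym ka₁)) ρ-one)
      (lower c₂ h₂) (lower c₃ h₃) (lower c₄ h₄) sum
    where
    k : ℕ
    k = proj₁ (coprime-inverse (Cop.sym c₁))
    a₁k : (a₁ * k) % n ≡ 1 % n
    a₁k = proj₂ (coprime-inverse (Cop.sym c₁))
    ka₁ : (k * a₁) % n ≡ 1 % n
    ka₁ = trans (cong (_% n) (*-comm k a₁)) a₁k
    n⊥k : Coprime n k
    n⊥k {d} (d∣n , d∣k) = ∣1⇒≡1 (∣n∣m%n⇒∣m d∣n (subst (d ∣_) a₁k (%-presˡ-∣ (∣n⇒∣m*n a₁ d∣k) d∣n)))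
    lower : ∀ {a} → Coprime n a → ¬ n ∣ a₁ + a → ℤ.- + (D + 5 * T) ℤ.≤ + 5 ℤ.* ρ (k * a)
    lower {a} c h = ρ-lower (Cop.sym (coprime-* (Cop.sym n⊥k) (Cop.sym c))) λ d → h (m%n≡0⇒n∣m (a₁ + a) n (begin
      (a₁ + a) % n                             ≡⟨ %-distribˡ-+ a₁ a n ⟩
      (a₁ % n + a % n) % n                     ≡⟨ cong (λ w → (a₁ % n + w) % n) (sym inverse) ⟩
      (a₁ % n + (a₁ * k * a) % n) % n          ≡⟨ sym (%-distribˡ-+ a₁ (a₁ * k * a) n) ⟩
      (a₁ + a₁ * k * a) % n                    ≡⟨ cong (_% n) (eq a₁ k a) ⟩
      (a₁ * (1 + k * a)) % n                   ≡⟨ n∣m⇒m%n≡0 _ n (∣n⇒∣m*n a₁ d) ⟩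
      0                                        ∎))
      where
      open ≡-Reasoning
      eq : ∀ a k b → a + a * k * b ≡ a * (1 + k * b)
      eq = ℕ-Ring.solve-∀
      inverse : (a₁ * k * a) % n ≡ a % n
      inverse = begin
        (a₁ * k * a) % n                 ≡⟨ %-distribˡ-* (a₁ * k) a n ⟩
        ((a₁ * k) % n * (a % n)) % n     ≡⟨ cong (λ w → (w * (a % n)) % n) a₁k ⟩
        (1 % n * (a % n)) % n            ≡⟨ sym (%-distribˡ-* 1 a n) ⟩
        (1 * a) % n                      ≡⟨ cong (_% n) (*-identityˡ a) ⟩
        a % n                            ∎
    sum : ρ (k * a₁) ℤ.+ (ρ (k * a₂) ℤ.+ (ρ (k * a₃) ℤ.+ ρ (k * a₄))) ≡ + 0
    sum = begin
      ρ (k * a₁) ℤ.+ (ρ (k * a₂) ℤ.+ (ρ (k * a₃) ℤ.+ ρ (k * a₄)))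
        ≡⟨ cong (λ w → ρ (k * a₁) ℤ.+ (ρ (k * a₂) ℤ.+ w)) (sym (∑-add n (F a₃) (F a₄))) ⟩
      ρ (k * a₁) ℤ.+ (ρ (k * a₂) ℤ.+ ∑ n (λ g → F a₃ g ℤ.+ F a₄ g))
        ≡⟨ cong (λ w → ρ (k * a₁) ℤ.+ w) (sym (∑-add n (F a₂) (λ g → F a₃ g ℤ.+ F a₄ g))) ⟩
      ρ (k * a₁) ℤ.+ ∑ n (λ g → F a₂ g ℤ.+ (F a₃ g ℤ.+ F a₄ g))
        ≡⟨ sym (∑-add n (F a₁) (λ g → F a₂ g ℤ.+ (F a₃ g ℤ.+ F a₄ g))) ⟩
      ∑ n (λ g → F a₁ g ℤ.+ (F a₂ g ℤ.+ (F a₃ g ℤ.+ F a₄ g)))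
        ≡⟨ ∑-cong n term ⟩
      ∑ n (λ _ → + 0)
        ≡⟨ ∑-zero n ⟩
      + 0 ∎
      where
      open ≡-Reasoning
      F : ℕ → ℕ → ℤ
      F a g = χ ps g ℤ.* (u n g ℤ.* u n (k * a * g))
      V : ℕ → ℤ
      V g = u n (k * a₁ * g) ℤ.+ (u n (k * a₂ * g) ℤ.+ (u n (k * a₃ * g) ℤ.+ u n (k * a₄ * g)))
      factor : ∀ c v p q r s → c ℤ.* (v ℤ.* p) ℤ.+ (c ℤ.* (v ℤ.* q) ℤ.+ (c ℤ.* (v ℤ.* r) ℤ.+ c ℤ.* (v ℤ.* s)))
        ≡ c ℤ.* (v ℤ.* (p ℤ.+ (q ℤ.+ (r ℤ.+ s))))
      factor = ℤ-Ring.solve-∀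
      swap : ∀ k a g → k * a * g ≡ g * k * a
      swap = ℕ-Ring.solve-∀
      V≡0 : ∀ g → Coprime g n → V g ≡ + 0
      V≡0 g g⊥n = trans
        (cong₂ ℤ._+_ (cong (u n) (swap k a₁ g)) (cong₂ ℤ._+_ (cong (u n) (swap k a₂ g)) (cong₂ ℤ._+_ (cong (u n) (swap k a₃ g)) (cong (u n) (swap k a₄ g)))))
        (balanced (g * k) (coprime-* g⊥n (Cop.sym n⊥k)))
      term : ∀ g → F a₁ g ℤ.+ (F a₂ g ℤ.+ (F a₃ g ℤ.+ F a₄ g)) ≡ + 0
      term g = trans (factor (χ ps g) (u n g) (u n (k * a₁ * g)) (u n (k * a₂ * g)) (u n (k * a₃ * g)) (u n (k * a₄ * g)))
        (trans (χ-support n>0 {λ g → u n g ℤ.* V g} {λ _ → + 0} (λ g c → trans (cong (u n g ℤ.*_) (V≡0 g c)) (ℤₚ.*-zeroʳ (u n g))) g)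
          (ℤₚ.*-zeroʳ (χ ps g)))

-- The index

wave-residues-+ : ∀ n a b c d n′ a′ b′ c′ d′ → wave-residues n a b c d ℤ.+ wave-residues n′ a′ b′ c′ d′ ≡
  wave-residues (n + n′) (a + a′) (b + b′) (c + c′) (d + d′)
wave-residues-+ n a b c d n′ a′ b′ c′ d′ = eq (+ n) (+ a) (+ b) (+ c) (+ d) (+ n′) (+ a′) (+ b′) (+ c′) (+ d′)
  where
  eq : ∀ n a b c d n′ a′ b′ c′ d′ →
    (n ℤ.- + 6 ℤ.* a ℤ.+ + 3 ℤ.* b ℤ.+ + 2 ℤ.* c ℤ.- d) ℤ.+ (n′ ℤ.- + 6 ℤ.* a′ ℤ.+ + 3 ℤ.* b′ ℤ.+ + 2 ℤ.* c′ ℤ.- d′)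
    ≡ (n ℤ.+ n′) ℤ.- + 6 ℤ.* (a ℤ.+ a′) ℤ.+ + 3 ℤ.* (b ℤ.+ b′) ℤ.+ + 2 ℤ.* (c ℤ.+ c′) ℤ.- (d ℤ.+ d′)
  eq = ℤ-Ring.solve-∀

uSum : ∀ {k} → ℕ → ℕ → Vec ℕ k → ℤ
uSum n g []       = + 0
uSum n g (a ∷ as) = u n (g * a) ℤ.+ uSum n g as

uSum-residues : ∀ {k} n .{{_ : NonZero n}} g (S : Vec ℕ k) →
  + n ℤ.* uSum n g S ≡ wave-residues (k * n) (gSum n g S) (gSum n (2 * g) S) (gSum n (3 * g) S) (gSum n (6 * g) S)
uSum-residues n g [] = ℤₚ.*-zeroʳ (+ n)
uSum-residues {suc k} n g (a ∷ S) = begin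
  + n ℤ.* (u n (g * a) ℤ.+ uSum n g S)
    ≡⟨ ℤₚ.*-distribˡ-+ (+ n) (u n (g * a)) (uSum n g S) ⟩
  + n ℤ.* u n (g * a) ℤ.+ + n ℤ.* uSum n g S
    ≡⟨ cong₂ ℤ._+_ head (uSum-residues n g S) ⟩
  wave-residues n ((g * a) % n) ((2 * g * a) % n) ((3 * g * a) % n) ((6 * g * a) % n)
    ℤ.+ wave-residues (k * n) (gSum n g S) (gSum n (2 * g) S) (gSum n (3 * g) S) (gSum n (6 * g) S)
    ≡⟨ wave-residues-+ n ((g * a) % n) ((2 * g * a) % n) ((3 * g * a) % n) ((6 * g * a) % n) (k * n) (gSum n g S) (gSum n (2 * g) S) (gSum n (3 * g) S) (gSum n (6 * g) S) ⟩
  wave-residues (suc k * n) (gSum n g (a ∷ S)) (gSum n (2 * g) (a ∷ S)) (gSum n (3 * g) (a ∷ S)) (gSum n (6 * g) (a ∷ S)) ∎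
  where
  open ≡-Reasoning
  head : + n ℤ.* u n (g * a) ≡ wave-residues n ((g * a) % n) ((2 * g * a) % n) ((3 * g * a) % n) ((6 * g * a) % n)
  head rewrite *-assoc 2 g a | *-assoc 3 g a | *-assoc 6 g a = u-residues n (g * a)

gSum-∣ : ∀ {k} n .{{_ : NonZero n}} g (S : Vec ℕ k) → n ∣ seqSum S → n ∣ gSum n g S
gSum-∣ {k} n g S d = ∣m+n∣m⇒∣n {m = proj₁ (lift S) * n}
  (subst (n ∣_) (trans (sym (proj₂ (lift S))) (+-comm (gSum n g S) _)) (∣n⇒∣m*n g d)) (n∣m*n (proj₁ (lift S)))
  where
  open ≡-Reasoning
  lift : ∀ {k} (S : Vec ℕ k) → ∃ λ q → gSum n g S + q * n ≡ g * seqSum S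
  lift []      = 0 , sym (*-zeroʳ g)
  lift (a ∷ S) with lift S
  ... | q , e = (g * a) / n + q , (begin
    (g * a) % n + gSum n g S + ((g * a) / n + q) * n          ≡⟨ eq ((g * a) % n) (gSum n g S) ((g * a) / n) q n ⟩
    (g * a) % n + (g * a) / n * n + (gSum n g S + q * n)      ≡⟨ cong₂ _+_ (sym (m≡m%n+[m/n]*n (g * a) n)) e ⟩
    g * a + g * seqSum S                                      ≡⟨ sym (*-distribˡ-+ g a (seqSum S)) ⟩
    g * (a + seqSum S)                                        ∎)
    where
    eq : ∀ r s p q n → r + s + (p + q) * n ≡ r + p * n + (s + q * n)
    eq = ℕ-Ring.solve-∀

gSum-neg : ∀ {k} n .{{_ : NonZero n}} g (S : Vec ℕ k) → (∀ i → ¬ n ∣ g * lookup S i) →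
  gSum n ((n ∸ 1) * g) S + gSum n g S ≡ k * n
gSum-neg n g []      h = refl
gSum-neg n g (a ∷ S) h = trans (eq (((n ∸ 1) * g * a) % n) (gSum n ((n ∸ 1) * g) S) ((g * a) % n) (gSum n g S))
  (cong₂ _+_ (trans (cong (λ w → w % n + (g * a) % n) (*-assoc (n ∸ 1) g a)) (%-neg n (g * a) (h zero))) (gSum-neg n g S (h ∘ suc)))
  where
  eq : ∀ a b c d → a + b + (c + d) ≡ a + c + (b + d)
  eq = ℕ-Ring.solve-∀

gSum-% : ∀ {k} n .{{_ : NonZero n}} g (S : Vec ℕ k) → gSum n (g % n) S ≡ gSum n g S
gSum-% n g []      = refl
gSum-% n g (a ∷ S) = cong₂ _+_ (begin
  (g % n * a) % n                  ≡⟨ %-distribˡ-* (g % n) a n ⟩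
  (g % n % n * (a % n)) % n        ≡⟨ cong (λ w → (w * (a % n)) % n) (m%n%n≡m%n g n) ⟩
  (g % n * (a % n)) % n            ≡⟨ sym (%-distribˡ-* g a n) ⟩
  (g * a) % n                      ∎) (gSum-% n g S)
  where open ≡-Reasoning

gSum>0 : ∀ {k} n .{{_ : NonZero n}} g (S : Vec ℕ (suc k)) → (∀ i → ¬ n ∣ g * lookup S i) → 0 < gSum n g S
gSum>0 n g (a ∷ S) h = ≤-trans (n≢0⇒n>0 λ e → h zero (m%n≡0⇒n∣m (g * a) n e)) (m≤m+n _ (gSum n g S))

-- The list runs over 1, ..., n. Since 1 < n, the residue of a unit is not 0, so the reduced
-- representative is listed.
∈-units : ∀ {n g} .{{_ : NonZero n}} → 1 < n → Coprime g n → g % n ∈ units n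
∈-units {n} {g} 1<n c = ∈-filter⁺ (λ g → gcd g n ≟ 1) (positive (g % n) (m%n<n g n) g%n≢0) (Cop.coprime⇒gcd≡1 g%n⊥n)
  where
  g%n⊥n : Coprime (g % n) n
  g%n⊥n (d∣g%n , d∣n) = c (∣n∣m%n⇒∣m d∣n d∣g%n , d∣n)
  g%n≢0 : g % n ≢ 0
  g%n≢0 e = <⇒≢ 1<n (sym (g%n⊥n (subst (n ∣_) (sym e) (n ∣0) , ∣-refl)))
  positive : ∀ r → r < n → r ≢ 0 → r ∈ map suc (upTo n)
  positive zero    _   r≢0 = contradiction refl r≢0
  positive (suc r) r<n _   = ∈-map⁺ suc (∈-upTo⁺ (<⇒≤ r<n))

minWith-≤ : ∀ d {x xs} → x ∈ xs → minWith d xs ≤ x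
minWith-≤ d {xs = y ∷ []}     (here refl) = ≤-refl
minWith-≤ d {xs = y ∷ z ∷ zs} (here refl) = m⊓n≤m y _
minWith-≤ d {xs = y ∷ z ∷ zs} (there p)   = ≤-trans (m⊓n≤n y _) (minWith-≤ d p)

≤-minWith : ∀ d {x y xs} → y ∈ xs → (∀ {z} → z ∈ xs → x ≤ z) → x ≤ minWith d xs
≤-minWith d {xs = y ∷ []}     _ h = h (here refl)
≤-minWith d {xs = y ∷ z ∷ zs} _ h = ⊓-glb (h (here refl)) (≤-minWith d {xs = z ∷ zs} (here refl) (h ∘ there))

theorem1 : (n : ℕ) .{{_ : NonZero n}} → 10 ^ 20 < n → gcd n 6 ≡ 1 →
    (S : Vec ℕ 4) → InRange n S → MinimalZeroSum n S →
    ((i : Fin 4) → gcd n (lookup S i) ≡ 1) →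
    IndexOne n S
theorem1 n n-large gcd6 S@(a₁ ∷ a₂ ∷ a₃ ∷ a₄ ∷ []) _ (zero-sum , minimal) gcdS = by-search (any? (_≟ n) values)
  where
  values : List ℕ
  values = map (λ g → gSum n g S) (units n)
  n⊥S : ∀ i → Coprime n (lookup S i)
  n⊥S i = Cop.gcd≡1⇒coprime (gcdS i)
  1<n : 1 < n
  1<n = ≤-<-trans (≤ᵇ⇒≤ 1 (10 ^ 20) _) n-large
  nonzero : ∀ {g} → Coprime g n → ∀ i → ¬ n ∣ g * lookup S i
  nonzero c i d = <⇒≢ 1<n (sym (coprime-* c (Cop.sym (n⊥S i)) (d , ∣-refl)))
  -- Every value is a positive multiple of n, so the minimum equals n as soon as n occurs among the
  -- values.
  values≥n : ∀ {v} → v ∈ values → n ≤ v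
  values≥n v∈ with ∈-map⁻ (λ g → gSum n g S) v∈
  ... | g , g∈ , refl = ∣⇒≤ {{>-nonZero (gSum>0 n g S (nonzero {g} (Cop.gcd≡1⇒coprime (proj₂ (∈-filter⁻ (λ g → gcd g n ≟ 1) {xs = map suc (upTo n)} g∈)))))}}
    (gSum-∣ n g S zero-sum)
  unpaired : (T : Vec _ 4) → card T ≡ 2 → ∀ {s} → selSum T S ≡ s → ¬ n ∣ s
  unpaired T two refl = minimal T (subst (0 <_) (sym two) z<s) (subst (_< 4) (sym two) (s≤s (s≤s (s≤s z≤n))))
  module _ (avoided : ¬ Any (_≡ n) values) where
    gSum≢n : ∀ {g} → Coprime g n → gSum n g S ≢ n
    gSum≢n {g} c e = avoided (lose (∈-map⁺ (λ g → gSum n g S) (∈-units 1<n c)) (trans (gSum-% n g S) e))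
    -- Multiples p n and q n with p + q = 4, both positive and neither equal to n, leave only p = q
    -- = 2.
    middle : ∀ {s t} → n ∣ s → n ∣ t → 0 < s → 0 < t → s ≢ n → t ≢ n → t + s ≡ 4 * n → s ≡ 2 * n
    middle (divides p refl) (divides q refl) s>0 t>0 s≢n t≢n e = go p q s>0 t>0 s≢n t≢n
      (*-cancelʳ-≡ (q + p) 4 n (trans (*-distribʳ-+ n q p) e))
      where
      go : ∀ p q → 0 < p * n → 0 < q * n → p * n ≢ n → q * n ≢ n → q + p ≡ 4 → p * n ≡ 2 * n
      go 2 q _ _ _ _ _ = refl
      go 0 q h _ _ _ _ = contradiction h λ ()
      go 1 q _ _ h _ _ = contradiction (*-identityˡ n) h
      go (suc (suc (suc p))) 0 _ h _ _ _ = contradiction h λ ()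
      go (suc (suc (suc p))) 1 _ _ _ h _ = contradiction (*-identityˡ n) h
      go (suc (suc (suc p))) (suc (suc q)) _ _ _ _ e = contradiction
        (≤-trans (s≤s (s≤s (≤-trans (s≤s (s≤s (s≤s z≤n))) (m≤n+m (3 + p) q)))) (≤-reflexive e)) λ { (s≤s (s≤s (s≤s (s≤s ())))) }
    gSum≡2n : ∀ {g} → Coprime g n → gSum n g S ≡ 2 * n
    gSum≡2n {g} c = middle (gSum-∣ n g S zero-sum) (gSum-∣ n ((n ∸ 1) * g) S zero-sum)
      (gSum>0 n g S (nonzero c)) (gSum>0 n ((n ∸ 1) * g) S (nonzero c′)) (gSum≢n c) (gSum≢n c′) (gSum-neg n g S (nonzero c))
      where
      n-1⊥n : Coprime (n ∸ 1) n
      n-1⊥n {d} (d∣n-1 , d∣n) = ∣1⇒≡1 (∣m+n∣m⇒∣n (subst (d ∣_) (sym (m∸n+n≡m (<⇒≤ 1<n))) d∣n) d∣n-1)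
      c′ : Coprime ((n ∸ 1) * g) n
      c′ = coprime-* n-1⊥n c
    n⊥6 : Coprime n 6
    n⊥6 = Cop.gcd≡1⇒coprime gcd6
    divisor⊥n : ∀ {j} → j ∣ 6 → Coprime j n
    divisor⊥n j∣6 (d∣j , d∣n) = n⊥6 (d∣n , ∣-trans d∣j j∣6)
    -- With all four sums equal to 2 n, the coefficients of n add up to 4 - 12 + 6 + 4 - 2 = 0.
    balanced : ∀ g → Coprime g n → u n (g * a₁) ℤ.+ (u n (g * a₂) ℤ.+ (u n (g * a₃) ℤ.+ u n (g * a₄))) ≡ + 0
    balanced g c = trans (cong (λ w → u n (g * a₁) ℤ.+ (u n (g * a₂) ℤ.+ (u n (g * a₃) ℤ.+ w))) (sym (ℤₚ.+-identityʳ (u n (g * a₄)))))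
      (ℤₚ.*-cancelˡ-≡ (+ n) (uSum n g S) (+ 0) {{ℤ.≢-nonZero λ e → >⇒≢ (<⇒≤ 1<n) (ℤₚ.+-injective e)}} (begin
        + n ℤ.* uSum n g S
          ≡⟨ uSum-residues n g S ⟩
        wave-residues (4 * n) (gSum n g S) (gSum n (2 * g) S) (gSum n (3 * g) S) (gSum n (6 * g) S)
          ≡⟨ cong₂ (λ p q → wave-residues (4 * n) p q (gSum n (3 * g) S) (gSum n (6 * g) S))
               (gSum≡2n c) (gSum≡2n {2 * g} (coprime-* {2} (divisor⊥n (divides 3 refl)) c)) ⟩
        wave-residues (4 * n) (2 * n) (2 * n) (gSum n (3 * g) S) (gSum n (6 * g) S)
          ≡⟨ cong₂ (wave-residues (4 * n) (2 * n) (2 * n))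
               (gSum≡2n {3 * g} (coprime-* {3} (divisor⊥n (divides 2 refl)) c)) (gSum≡2n {6 * g} (coprime-* {6} (divisor⊥n ∣-refl) c)) ⟩
        wave-residues (4 * n) (2 * n) (2 * n) (2 * n) (2 * n)
          ≡⟨ cong₂ (λ p q → p ℤ.- + 6 ℤ.* q ℤ.+ + 3 ℤ.* q ℤ.+ + 2 ℤ.* q ℤ.- q) (ℤₚ.pos-* 4 n) (ℤₚ.pos-* 2 n) ⟩
        + 4 ℤ.* + n ℤ.- + 6 ℤ.* (+ 2 ℤ.* + n) ℤ.+ + 3 ℤ.* (+ 2 ℤ.* + n) ℤ.+ + 2 ℤ.* (+ 2 ℤ.* + n) ℤ.- + 2 ℤ.* + n
          ≡⟨ eq (+ n) ⟩
        + n ℤ.* + 0 ∎))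
      where
      open ≡-Reasoning
      eq : ∀ n → + 4 ℤ.* n ℤ.- + 6 ℤ.* (+ 2 ℤ.* n) ℤ.+ + 3 ℤ.* (+ 2 ℤ.* n) ℤ.+ + 2 ℤ.* (+ 2 ℤ.* n) ℤ.- + 2 ℤ.* n ≡ n ℤ.* + 0
      eq = ℤ-Ring.solve-∀
    impossible : ⊥
    impossible = Correlation.unbalanced n n-large n⊥6 (n⊥S zero) (n⊥S (suc zero)) (n⊥S (suc (suc zero))) (n⊥S (suc (suc (suc zero))))
      (unpaired (true ∷ true ∷ false ∷ false ∷ []) refl (cong (λ w → a₁ + w) (+-identityʳ a₂)))
      (unpaired (true ∷ false ∷ true ∷ false ∷ []) refl (cong (λ w → a₁ + w) (+-identityʳ a₃)))
      (unpaired (true ∷ false ∷ false ∷ true ∷ []) refl (cong (λ w → a₁ + w) (+-identityʳ a₄)))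
      balanced
  by-search : Dec (Any (_≡ n) values) → IndexOne n S
  by-search (no none)   = ⊥-elim (impossible none)
  by-search (yes found) with find found
  ... | v , v∈ , refl = ≤-antisym (minWith-≤ 0 v∈) (≤-minWith 0 v∈ values≥n)
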